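{- Let $K$ be a real quadratic field and let $G(z_1,z_2,\dots,z_r)$ be a totally positive definite integral generalized quadratic form in $r$ variables over $K$. If $G$ is universal, then $G$ has a universal quadratic subform; that is, there is a generalized quadratic form $H$ that is a subform of $G$, has no proper variables, and is universal.
   Context: $K=\mathbb{Q}(\sqrt D)\subset\mathbb{R}$ is a real quadratic field, $\mathcal{O}_K$ its ring of integers, and $\tau:K\to K$, $a+b\sqrt D\mapsto a-b\sqrt D$, its non-trivial automorphism. An element $\alpha\in K$ is totally positive, written $\alpha\succ0$, if $\alpha>0$ and $\tau(\alpha)>0$; write $\alpha\succeq 0$ if $\alpha\ge0$ and $\tau(\alpha)\ge0$. $\mathcal{O}_K^+$ is the set of totally positive elements of $\mathcal{O}_K$. A quadratic form over $K$ in $n$ variables is a homogeneous quadratic polynomial $Q(x_1,\dots,x_n)=\sum_{1\le i\le j\le n}a_{ij}x_ix_j$ with $a_{ij}\in K$; it is integral if all $a_{ij}\in\mathcal{O}_K$. It is totally positive definite (resp. semidefinite) if $Q(x)\succ0$ (resp. $Q(x)\succeq0$) for all $x\in K^n\setminus\{0\}$. A generalized quadratic form (generalized form) in $r$ variables over $K$ is an expression $G(z_1,\dots,z_r)=G_0(z_1,\tau(z_1),\dots,z_r,\tau(z_r))$, where $G_0$ is a quadratic form in $2r$ variables over $K$. It is integral if $G_0$ is integral. We say that $z_i$ (resp. $\tau(z_i)$) appears in $G$ if some monomial with non-zero coefficient in $G_0$ involves the corresponding variable of $G_0$. A variable $z_i$ is a proper variable of $G$ if both $z_i$ and $\tau(z_i)$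 appear in $G$. $G$ is called quadratic if it has no proper variables. Associated quadratic form: after reordering, let $z_1,\dots,z_\ell$ be the non-proper variables and $z_{\ell+1},\dots,z_r$ the proper variables of $G$. The associated quadratic form of $G$ is the quadratic form $Q$ in $2r-\ell$ variables with $G(z_1,\dots,z_r)=Q(z_1',\dots,z_\ell',z_{\ell+1},\tau(z_{\ell+1}),\dots,z_r,\tau(z_r))$ (as formal expressions, treating each $z_i$ and $\tau(z_i)$ as separate variables), where for $j\le\ell$, $z_j'$ is whichever of $z_j$, $\tau(z_j)$ appears in $G$ (if neither appears, put $z_j'=z_j$). $G$ is totally positive definite (resp. semidefinite) if its associated quadratic form $Q$ is totally positive definite (resp. semidefinite). An integral generalized form $G$ represents $\alpha\in\mathcal{O}_K$ if $G(\beta_1,\dots,\beta_r)=\alpha$ for some $\beta_1,\dots,\beta_r\in\mathcal{O}_K$. A totally positive semidefinite integral generalized form is universal if it represents every element of $\mathcal{O}_K^+$. A generalized form $H(z_1,\dots,z_k)$ is a subform of $G(z_1,\dots,z_r)$ if, after some reordering of the variables of $G$, $H(z_1,\dots,z_k)=G(z_1,\dots,z_k,0,\dots,0)$. -}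

module Defs where

open import Algebra.Bundles.Raw using (RawRing)
import Algebra.Definitions.RawSemiring as RawSemiringOps
open import Data.Bool using (if_then_else_)
open import Data.Fin as Fin using (Fin; zero; suc; toℕ; combine; remQuot; inject≤)
open import Data.Fin.Permutation using (Permutation′; _⟨$⟩ʳ_)
import Data.Fin.Properties as Finₚ
open import Data.Integer using (ℤ)
import Data.Integer as ℤ
open import Data.List using (List; []; _∷_; _++_; map; concatMap; filter; allFin; length; lookup)
open import Data.Nat using (ℕ; _≤_)
import Data.Nat as ℕ
open import Data.Product using (_×_; _,_; Σ-syntax; ∃-syntax; uncurry)
open import Data.Rational using (ℚ; 0ℚ; 1ℚ)
import Data.Rational as ℚ
open import Data.Sum using (_⊎_)
open import Level using (0ℓ)
open import Relation.Binary.Definitions using (DecidableEquality)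
open import Relation.Binary.PropositionalEquality using (_≡_; _≢_; refl)
open import Relation.Nullary using (¬_; Dec; does)
open import Relation.Nullary.Decidable using (map′; ¬?; _×-dec_)

-- ⟨ a , b ⟩ stands for a + b√D.  This is the real quadratic field ℚ(√D) when
-- D is not a perfect square, and every real quadratic field is of this form.
record K (D : ℕ) : Set where
  constructor ⟨_,_⟩
  field
    rat irr : ℚ

open K public

fromℤ : ∀ {D} → ℤ → K D
fromℤ n = ⟨ n ℚ./ 1 , 0ℚ ⟩

K-rawRing : ℕ → RawRing 0ℓ 0ℓ
K-rawRing D = record
  { Carrier = K D
  ; _≈_     = _≡_
  ; _+_     = λ { ⟨ a , b ⟩ ⟨ c , d ⟩ → ⟨ a ℚ.+ c , b ℚ.+ d ⟩ }
  ; _*_     = λ { ⟨ a , b ⟩ ⟨ c , d ⟩ →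
                  ⟨ a ℚ.* c ℚ.+ (ℤ.+ D ℚ./ 1) ℚ.* (b ℚ.* d) , a ℚ.* d ℚ.+ b ℚ.* c ⟩ }
  ; -_      = λ { ⟨ a , b ⟩ → ⟨ ℚ.- a , ℚ.- b ⟩ }
  ; 0#      = ⟨ 0ℚ , 0ℚ ⟩
  ; 1#      = ⟨ 1ℚ , 0ℚ ⟩
  }

module _ {D : ℕ} where
  open RawRing (K-rawRing D) public
    using (_+_; _*_; -_; 0#; 1#; rawSemiring)
  open RawSemiringOps rawSemiring public
    using (_^_; sum)

  τ : K D → K D
  τ ⟨ a , b ⟩ = ⟨ a , ℚ.- b ⟩

  infix 4 _≟_
  _≟_ : DecidableEquality (K D)
  ⟨ a , b ⟩ ≟ ⟨ c , d ⟩ =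
    map′ (λ { (refl , refl) → refl }) (λ { refl → refl , refl })
         (a ℚ.≟ c ×-dec b ℚ.≟ d)

  -- Positivity in ℝ, with √D > 0: whichever of a and b√D has the larger
  -- absolute value determines the sign of a + b√D.  The two absolute values
  -- are equal only for a = b = 0, D not being a perfect square.
  Positive : K D → Set
  Positive ⟨ a , b ⟩ = (0ℚ ℚ.< a × Db² ℚ.< a²) ⊎ (0ℚ ℚ.< b × a² ℚ.< Db²)
    where
    a²  = a ℚ.* a
    Db² = (ℤ.+ D ℚ./ 1) ℚ.* (b ℚ.* b)

  NonNegative : K D → Set
  NonNegative α = Positive α ⊎ α ≡ 0#

  infix 4 _≻0 _≽0
  _≻0 : K D → Set
  α ≻0 = Positive α × Positive (τ α)

  _≽0 : K D → Set
  α ≽0 = NonNegative α × NonNegative (τ α)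

  -- Membership in the ring of integers: α is a root of a monic polynomial
  -- Xⁿ + cₙ₋₁ Xⁿ⁻¹ + ⋯ + c₀ with integer coefficients.
  infix 4 _∈𝒪
  _∈𝒪 : K D → Set
  α ∈𝒪 = ∃[ n ] Σ[ c ∈ (Fin n → ℤ) ]
    α ^ n + sum (λ i → fromℤ (c i) * α ^ toℕ i) ≡ 0#

-- coeff i j = coeff j i is the coefficient of the monomial xᵢxⱼ (also for
-- i ≠ j, so it is not an entry of the Gram matrix); each monomial is counted
-- once in eval.
record QuadraticForm (D n : ℕ) : Set where
  field
    coeff     : Fin n → Fin n → K D
    coeff-sym : ∀ i j → coeff i j ≡ coeff j i

open QuadraticForm public

module _ {D n : ℕ} where
  eval : QuadraticForm D n → (Fin n → K D) → K D
  eval Q x = sum λ i → sum λ j →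
    if does (i Fin.≤? j) then coeff Q i j * x i * x j else 0#

  IntegralForm : QuadraticForm D n → Set
  IntegralForm Q = ∀ i j → coeff Q i j ∈𝒪

  PositiveDefiniteForm : QuadraticForm D n → Set
  PositiveDefiniteForm Q = ∀ x → ¬ (∀ i → x i ≡ 0#) → eval Q x ≻0

  PositiveSemidefiniteForm : QuadraticForm D n → Set
  PositiveSemidefiniteForm Q = ∀ x → ¬ (∀ i → x i ≡ 0#) → eval Q x ≽0

  AppearsIn : QuadraticForm D n → Fin n → Set
  AppearsIn Q i = ∃[ j ] coeff Q i j ≢ 0#

  appearsIn? : ∀ Q i → Dec (AppearsIn Q i)
  appearsIn? Q i = Finₚ.any? λ j → ¬? (coeff Q i j ≟ 0#)

-- For injective f: substitute 0 for every variable outside the image of f,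
-- and write yᵢ for the variable x_(f i).
restrict : ∀ {D m n} → (Fin m → Fin n) → QuadraticForm D n → QuadraticForm D m
restrict f Q = record
  { coeff     = λ i j → coeff Q (f i) (f j)
  ; coeff-sym = λ i j → coeff-sym Q (f i) (f j)
  }

-- The variables of G₀ are ordered z₁, τ(z₁), …, zᵣ, τ(zᵣ).
record GeneralizedForm (D r : ℕ) : Set where
  constructor generalized
  field
    G₀ : QuadraticForm D (r ℕ.* 2)

open GeneralizedForm public

zVar τVar : ∀ {r} → Fin r → Fin (r ℕ.* 2)
zVar i = combine i zero
τVar i = combine i (suc zero)

arguments : ∀ {D r} → (Fin r → K D) → Fin (r ℕ.* 2) → K D
arguments z k = uncurry (λ { i zero → z i ; i (suc _) → τ (z i) }) (remQuot 2 k)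

module _ {D r : ℕ} where
  evalG : GeneralizedForm D r → (Fin r → K D) → K D
  evalG G z = eval (G₀ G) (arguments z)

  Integral : GeneralizedForm D r → Set
  Integral G = IntegralForm (G₀ G)

  Proper : GeneralizedForm D r → Fin r → Set
  Proper G i = AppearsIn (G₀ G) (zVar i) × AppearsIn (G₀ G) (τVar i)

  proper? : ∀ G i → Dec (Proper G i)
  proper? G i = appearsIn? (G₀ G) (zVar i) ×-dec appearsIn? (G₀ G) (τVar i)

  Quadratic : GeneralizedForm D r → Set
  Quadratic G = ∀ i → ¬ Proper G i

  -- zⱼ′ for a non-proper variable zⱼ.
  primed : GeneralizedForm D r → Fin r → Fin (r ℕ.* 2)
  primed G j = if does (appearsIn? (G₀ G) (τVar j)) then τVar j else zVar j

  -- z₁′, …, zₗ′ followed by zᵢ, τ(zᵢ) for each proper zᵢ.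
  associatedVars : GeneralizedForm D r → List (Fin (r ℕ.* 2))
  associatedVars G =
    map (primed G) (filter (λ i → ¬? (proper? G i)) (allFin r)) ++
    concatMap (λ i → zVar i ∷ τVar i ∷ []) (filter (proper? G) (allFin r))

  -- The variables of G₀ that are left out do not appear in G, so this is an
  -- equality of formal expressions with G₀, not a specialisation.
  associated : (G : GeneralizedForm D r) → QuadraticForm D (length (associatedVars G))
  associated G = restrict (lookup (associatedVars G)) (G₀ G)

  TotallyPositiveDefinite : GeneralizedForm D r → Set
  TotallyPositiveDefinite G = PositiveDefiniteForm (associated G)

  TotallyPositiveSemidefinite : GeneralizedForm D r → Set
  TotallyPositiveSemidefinite G = PositiveSemidefiniteForm (associated G)

  Represents : GeneralizedForm D r → K D → Set
  Represents G α = Σ[ β ∈ (Fin r → K D) ] (∀ i → β i ∈𝒪) × evalG G β ≡ α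

  Universal : GeneralizedForm D r → Set
  Universal G =
    Integral G × TotallyPositiveSemidefinite G ×
    (∀ α → α ∈𝒪 → α ≻0 → Represents G α)

-- H(z₁,…,zₖ) = G(z_σ(1),…,z_σ(r)) with the last r − k arguments set to 0, as
-- formal expressions: the coefficients of all monomials agree.
infix 4 _IsSubformOf_
_IsSubformOf_ : ∀ {D k r} → GeneralizedForm D k → GeneralizedForm D r → Set
_IsSubformOf_ {D} {k} {r} H G =
  Σ[ k≤r ∈ k ≤ r ] Σ[ σ ∈ Permutation′ r ]
    let ι : Fin (k ℕ.* 2) → Fin (r ℕ.* 2)
        ι v = uncurry (λ i s → combine (σ ⟨$⟩ʳ inject≤ i k≤r) s) (remQuot 2 v)
    in ∀ u v → coeff (G₀ H) u v ≡ coeff (restrict ι (G₀ G)) u v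

-- After multiplying α by the square of a large unit w, a representation G(β) = w²α gives
-- Q(τ(w) y) = α for the definite form Q associated to G, where y contains both βᵢ and τ(βᵢ) for
-- every proper variable zᵢ.  Definiteness of Q bounds τ(w)βᵢ and τ(w)τ(βᵢ) in terms of α alone,
-- whereas w is arbitrarily large, so the algebraic integer βᵢ vanishes.  Dividing the remaining
-- variables by w again represents α without the proper variables.
--
-- All estimates are made with size(x) = rat(x²) = ½ Tr(x²), which is rational, so that neither √D
-- nor an ordering of K is involved.  The unit w comes from Pell's equation.

module Submission where

open import Defs
open import Data.Nat using (ℕ)
import Data.Nat as ℕ
open import Data.Product using (_×_; Σ-syntax; ∃-syntax)
open import Relation.Binary.PropositionalEquality using (_≢_)

open import Algebra.Bundles using (CommutativeRing)
import Algebra.Properties.Semiring.Sum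
import Algebra.Solver.Ring
open import Algebra.Solver.Ring.AlmostCommutativeRing using (fromCommutativeRing; _-Raw-AlmostCommutative⟶_)
open import Algebra.Structures using (IsCommutativeRing)
open import Data.Bool using (true; false; if_then_else_)
open import Data.Empty using (⊥-elim)
open import Data.Fin as Fin using (Fin; zero; suc; toℕ; fromℕ; fromℕ<; combine; remQuot; inject≤; punchIn)
open import Data.Fin.Permutation as Perm
  using (Permutation′; _⟨$⟩ʳ_; _⟨$⟩ˡ_; lift₀; insert; insert-punchIn; inverseˡ)
import Data.Fin.Properties as Finₚ
open import Data.Integer using (ℤ)
import Data.Integer as ℤ
import Data.Integer.Coprimality as ℤ-Coprime
import Data.Integer.Divisibility.Signed as ℤ-Div
import Data.Integer.Properties as ℤₚ
import Data.Integer.Tactic.RingSolver as ℤ-Ring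
open import Data.List using (List; []; _∷_; map; concatMap; filter; allFin; lookup; length)
open import Data.List.Membership.Propositional using (_∈_; find; lose)
open import Data.List.Membership.Propositional.Properties
  using (∈-lookup; ∈-map⁺; ∈-map⁻; ∈-++⁺ˡ; ∈-++⁺ʳ; ∈-filter⁺; ∈-filter⁻; ∈-allFin; ∈-concatMap⁺; ∈-concatMap⁻)
open import Data.List.Relation.Binary.Disjoint.Propositional using (Disjoint)
open import Data.List.Relation.Unary.All as All using ([]; _∷_)
import Data.List.Relation.Unary.All.Properties as Allₚ
open import Data.List.Relation.Unary.AllPairs as AllPairs using ([]; _∷_)
import Data.List.Relation.Unary.AllPairs.Properties as AllPairsₚ
open import Data.List.Relation.Unary.Any as Any using (here; there)
import Data.List.Relation.Unary.Any.Properties as Anyₚ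
open import Data.List.Relation.Unary.Unique.Propositional using (Unique)
import Data.List.Relation.Unary.Unique.Propositional.Properties as Uniqueₚ
import Data.Maybe as Maybe
open import Data.Nat using (zero; suc)
import Data.Nat.Coprimality as Coprime
open import Data.Nat.Induction using (<-wellFounded)
import Data.Nat.Properties as ℕₚ
open import Data.Product as Product using (_,_; proj₁; proj₂; uncurry)
open import Data.Rational using (ℚ; mkℚ; 0ℚ; 1ℚ)
import Data.Rational as ℚ
import Data.Rational.Properties as ℚₚ
import Data.Rational.Unnormalised as ℚᵘ
import Data.Rational.Unnormalised.Properties as ℚᵘₚ
open import Data.Sum using (_⊎_; inj₁; inj₂; [_,_]′)
open import Data.Vec.Functional using () renaming (_∷_ to _◂_)
open import Function using (_∘_; id)
open import Induction.WellFounded using (Acc; acc)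
open import Level using (0ℓ)
open import Relation.Binary.Definitions using (tri<; tri≈; tri>)
open import Relation.Binary.PropositionalEquality
  using (_≡_; refl; sym; trans; cong; cong₂; subst; subst₂; isEquivalence; module ≡-Reasoning)
open import Relation.Nullary using (yes; no; ¬_; Dec; does)
open import Relation.Nullary.Decidable using (dec⇒maybe; dec-true; dec-false; ¬?)
open import Tactic.RingSolver using (solve-∀)
import Tactic.RingSolver.Core.AlmostCommutativeRing as Tac

-- `size` treats the two real embeddings alike, so a bound on size(τ(w)z) alone does not force z to
-- be small: z = w z₀ with z₀ fixed satisfies it for every unit w of norm 1. Bounds for both z and
-- τ(z) do, because 2 size(u) size(z) = size(uz) + size(uτ(z)). This is where properness enters.
-- Positivity is given at points of Kⁿ only. It does not directly exclude a zero at a real point, so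
-- compactness of the sphere offers no lower bound. Elimination with pivots in K yields an explicit
-- rational constant instead. Membership in the ring of integers is a monic equation of unspecified
-- degree. It is converted into integrality of trace and norm, which serves twice: it separates
-- non-zero integers from 0, and it shows that multiplication by ℤ[√D] preserves integrality. The
-- unit w is sought in ℤ[√D] with norm 1, so that its inverse τ(w) lies there too.

ℚ-ring : Tac.AlmostCommutativeRing 0ℓ 0ℓ
ℚ-ring = Tac.fromCommutativeRing ℚₚ.+-*-commutativeRing (λ x → dec⇒maybe (0ℚ ℚₚ.≟ x))

-- The embedding of ℤ into ℚ.

ι : ℤ → ℚ
ι n = n ℚ./ 1

private
  toℚᵘ-ι : ∀ n → ℚ.toℚᵘ (ι n) ℚᵘ.≃ ℚᵘ.mkℚᵘ n 0
  toℚᵘ-ι n = ℚₚ.toℚᵘ-fromℚᵘ (ℚᵘ.mkℚᵘ n 0)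

ι-+ : ∀ m n → ι (m ℤ.+ n) ≡ ι m ℚ.+ ι n
ι-+ m n = ℚₚ.toℚᵘ-injective (begin
  ℚ.toℚᵘ (ι (m ℤ.+ n))                   ≈⟨ toℚᵘ-ι (m ℤ.+ n) ⟩
  ℚᵘ.mkℚᵘ (m ℤ.+ n) 0
    ≈⟨ ℚᵘ.*≡* (cong (ℤ._* ℤ.+ 1) (sym (cong₂ ℤ._+_ (ℤₚ.*-identityʳ m) (ℤₚ.*-identityʳ n)))) ⟩
  ℚᵘ.mkℚᵘ m 0 ℚᵘ.+ ℚᵘ.mkℚᵘ n 0           ≈⟨ ℚᵘₚ.+-cong (toℚᵘ-ι m) (toℚᵘ-ι n) ⟨
  ℚ.toℚᵘ (ι m) ℚᵘ.+ ℚ.toℚᵘ (ι n)         ≈⟨ ℚₚ.toℚᵘ-homo-+ (ι m) (ι n) ⟨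
  ℚ.toℚᵘ (ι m ℚ.+ ι n)                   ∎)
  where open ℚᵘₚ.≃-Reasoning

ι-* : ∀ m n → ι (m ℤ.* n) ≡ ι m ℚ.* ι n
ι-* m n = ℚₚ.toℚᵘ-injective (begin
  ℚ.toℚᵘ (ι (m ℤ.* n))                   ≈⟨ toℚᵘ-ι (m ℤ.* n) ⟩
  ℚᵘ.mkℚᵘ m 0 ℚᵘ.* ℚᵘ.mkℚᵘ n 0           ≈⟨ ℚᵘₚ.*-cong (toℚᵘ-ι m) (toℚᵘ-ι n) ⟨
  ℚ.toℚᵘ (ι m) ℚᵘ.* ℚ.toℚᵘ (ι n)         ≈⟨ ℚₚ.toℚᵘ-homo-* (ι m) (ι n) ⟨
  ℚ.toℚᵘ (ι m ℚ.* ι n)                   ∎)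
  where open ℚᵘₚ.≃-Reasoning

ι-neg : ∀ n → ι (ℤ.- n) ≡ ℚ.- ι n
ι-neg n = ℚₚ.toℚᵘ-injective (begin
  ℚ.toℚᵘ (ι (ℤ.- n))    ≈⟨ toℚᵘ-ι (ℤ.- n) ⟩
  ℚᵘ.- ℚᵘ.mkℚᵘ n 0      ≈⟨ ℚᵘₚ.-‿cong (toℚᵘ-ι n) ⟨
  ℚᵘ.- ℚ.toℚᵘ (ι n)     ≈⟨ ℚₚ.toℚᵘ-homo‿- (ι n) ⟨
  ℚ.toℚᵘ (ℚ.- ι n)      ∎)
  where open ℚᵘₚ.≃-Reasoning

ι-injective : ∀ {m n} → ι m ≡ ι n → m ≡ n
ι-injective {m} {n} eq = ℤₚ.*-cancelʳ-≡ m n (ℤ.+ 1) (ℚᵘₚ.drop-*≡* (begin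
  ℚᵘ.mkℚᵘ m 0      ≈⟨ toℚᵘ-ι m ⟨
  ℚ.toℚᵘ (ι m)     ≡⟨ cong ℚ.toℚᵘ eq ⟩
  ℚ.toℚᵘ (ι n)     ≈⟨ toℚᵘ-ι n ⟩
  ℚᵘ.mkℚᵘ n 0      ∎))
  where open ℚᵘₚ.≃-Reasoning

ι-mono-≤ : ∀ {m n} → m ℤ.≤ n → ι m ℚ.≤ ι n
ι-mono-≤ {m} {n} m≤n = ℚₚ.toℚᵘ-cancel-≤ (begin
  ℚ.toℚᵘ (ι m)     ≃⟨ toℚᵘ-ι m ⟩
  ℚᵘ.mkℚᵘ m 0      ≤⟨ ℚᵘ.*≤* (ℤₚ.*-monoʳ-≤-nonNeg (ℤ.+ 1) m≤n) ⟩
  ℚᵘ.mkℚᵘ n 0      ≃⟨ toℚᵘ-ι n ⟨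
  ℚ.toℚᵘ (ι n)     ∎)
  where open ℚᵘₚ.≤-Reasoning

ι-cancel-< : ∀ {m n} → ι m ℚ.< ι n → m ℤ.< n
ι-cancel-< m<n = ℤₚ.≰⇒> λ n≤m → ℚₚ.<-irrefl refl (ℚₚ.<-≤-trans m<n (ι-mono-≤ n≤m))

ι-cancel-≤ : ∀ {m n} → ι m ℚ.≤ ι n → m ℤ.≤ n
ι-cancel-≤ m≤n = ℤₚ.≮⇒≥ λ n<m → ℤₚ.<-irrefl (ι-injective (ℚₚ.≤-antisym (ι-mono-≤ (ℤₚ.<⇒≤ n<m)) m≤n)) n<m

ι-mono-< : ∀ {m n} → m ℤ.< n → ι m ℚ.< ι n
ι-mono-< m<n = ℚₚ.≰⇒> λ n≤m → ℤₚ.<⇒≱ m<n (ι-cancel-≤ n≤m)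

-- K as a commutative ring, with polynomial identities over it.

δ : ℕ → ℚ
δ D = ι (ℤ.+ D)

module _ {D : ℕ} where

  K-cong : ∀ {a b c d : ℚ} → a ≡ c → b ≡ d → _≡_ {A = K D} ⟨ a , b ⟩ ⟨ c , d ⟩
  K-cong = cong₂ ⟨_,_⟩

  +-assocᴷ : (x y z : K D) → (x + y) + z ≡ x + (y + z)
  +-assocᴷ ⟨ a , b ⟩ ⟨ c , d ⟩ ⟨ e , f ⟩ = K-cong (ℚₚ.+-assoc a c e) (ℚₚ.+-assoc b d f)

  +-commᴷ : (x y : K D) → x + y ≡ y + x
  +-commᴷ ⟨ a , b ⟩ ⟨ c , d ⟩ = K-cong (ℚₚ.+-comm a c) (ℚₚ.+-comm b d)

  *-assocᴷ : (x y z : K D) → (x * y) * z ≡ x * (y * z)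
  *-assocᴷ ⟨ a , b ⟩ ⟨ c , d ⟩ ⟨ e , f ⟩ = K-cong (rational (δ D) a b c d e f) (irrational (δ D) a b c d e f)
    where
    rational : ∀ δ a b c d e f →
      (a ℚ.* c ℚ.+ δ ℚ.* (b ℚ.* d)) ℚ.* e ℚ.+ δ ℚ.* ((a ℚ.* d ℚ.+ b ℚ.* c) ℚ.* f) ≡
      a ℚ.* (c ℚ.* e ℚ.+ δ ℚ.* (d ℚ.* f)) ℚ.+ δ ℚ.* (b ℚ.* (c ℚ.* f ℚ.+ d ℚ.* e))
    rational = solve-∀ ℚ-ring
    irrational : ∀ δ a b c d e f →
      (a ℚ.* c ℚ.+ δ ℚ.* (b ℚ.* d)) ℚ.* f ℚ.+ (a ℚ.* d ℚ.+ b ℚ.* c) ℚ.* e ≡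
      a ℚ.* (c ℚ.* f ℚ.+ d ℚ.* e) ℚ.+ b ℚ.* (c ℚ.* e ℚ.+ δ ℚ.* (d ℚ.* f))
    irrational = solve-∀ ℚ-ring

  *-commᴷ : (x y : K D) → x * y ≡ y * x
  *-commᴷ ⟨ a , b ⟩ ⟨ c , d ⟩ = K-cong (rational (δ D) a b c d) (irrational a b c d)
    where
    rational : ∀ δ a b c d → a ℚ.* c ℚ.+ δ ℚ.* (b ℚ.* d) ≡ c ℚ.* a ℚ.+ δ ℚ.* (d ℚ.* b)
    rational = solve-∀ ℚ-ring
    irrational : ∀ a b c d → a ℚ.* d ℚ.+ b ℚ.* c ≡ c ℚ.* b ℚ.+ d ℚ.* a
    irrational = solve-∀ ℚ-ring

  *-identityˡᴷ : (x : K D) → 1# * x ≡ x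
  *-identityˡᴷ ⟨ a , b ⟩ = K-cong (rational (δ D) a b) (irrational a b)
    where
    rational : ∀ δ a b → 1ℚ ℚ.* a ℚ.+ δ ℚ.* (0ℚ ℚ.* b) ≡ a
    rational = solve-∀ ℚ-ring
    irrational : ∀ a b → 1ℚ ℚ.* b ℚ.+ 0ℚ ℚ.* a ≡ b
    irrational = solve-∀ ℚ-ring

  *-distribˡ-+ᴷ : (x y z : K D) → x * (y + z) ≡ x * y + x * z
  *-distribˡ-+ᴷ ⟨ a , b ⟩ ⟨ c , d ⟩ ⟨ e , f ⟩ = K-cong (rational (δ D) a b c d e f) (irrational a b c d e f)
    where
    rational : ∀ δ a b c d e f →
      a ℚ.* (c ℚ.+ e) ℚ.+ δ ℚ.* (b ℚ.* (d ℚ.+ f)) ≡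
      a ℚ.* c ℚ.+ δ ℚ.* (b ℚ.* d) ℚ.+ (a ℚ.* e ℚ.+ δ ℚ.* (b ℚ.* f))
    rational = solve-∀ ℚ-ring
    irrational : ∀ a b c d e f →
      a ℚ.* (d ℚ.+ f) ℚ.+ b ℚ.* (c ℚ.+ e) ≡
      a ℚ.* d ℚ.+ b ℚ.* c ℚ.+ (a ℚ.* f ℚ.+ b ℚ.* e)
    irrational = solve-∀ ℚ-ring

  K-isCommutativeRing : IsCommutativeRing _≡_ (_+_ {D}) _*_ -_ 0# 1#
  K-isCommutativeRing = record
    { isRing = record
      { +-isAbelianGroup = record
        { isGroup = record
          { isMonoid = record
            { isSemigroup = record
              { isMagma = record { isEquivalence = isEquivalence ; ∙-cong = cong₂ _+_ }
              ; assoc = +-assocᴷ }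
            ; identity = (λ x → K-cong (ℚₚ.+-identityˡ _) (ℚₚ.+-identityˡ _))
                       , (λ x → K-cong (ℚₚ.+-identityʳ _) (ℚₚ.+-identityʳ _)) }
          ; inverse = (λ x → K-cong (ℚₚ.+-inverseˡ (rat x)) (ℚₚ.+-inverseˡ (irr x)))
                    , (λ x → K-cong (ℚₚ.+-inverseʳ (rat x)) (ℚₚ.+-inverseʳ (irr x)))
          ; ⁻¹-cong = cong (-_) }
        ; comm = +-commᴷ }
      ; *-cong = cong₂ _*_
      ; *-assoc = *-assocᴷ
      ; *-identity = *-identityˡᴷ , (λ x → trans (*-commᴷ x 1#) (*-identityˡᴷ x))
      ; distrib = *-distribˡ-+ᴷ , λ x y z → trans (*-commᴷ (y + z) x)
          (trans (*-distribˡ-+ᴷ x y z) (cong₂ _+_ (*-commᴷ x y) (*-commᴷ x z))) }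
    ; *-comm = *-commᴷ }

  fromℤ-+ : ∀ m n → fromℤ {D} (m ℤ.+ n) ≡ fromℤ m + fromℤ n
  fromℤ-+ m n = K-cong (ι-+ m n) refl

  fromℤ-* : ∀ m n → fromℤ {D} (m ℤ.* n) ≡ fromℤ m * fromℤ n
  fromℤ-* m n = K-cong (trans (ι-* m n) (rational (δ D) (ι m) (ι n))) (irrational (ι m) (ι n))
    where
    rational : ∀ δ a b → a ℚ.* b ≡ a ℚ.* b ℚ.+ δ ℚ.* (0ℚ ℚ.* 0ℚ)
    rational = solve-∀ ℚ-ring
    irrational : ∀ a b → 0ℚ ≡ a ℚ.* 0ℚ ℚ.+ 0ℚ ℚ.* b
    irrational = solve-∀ ℚ-ring

  fromℤ-neg : ∀ n → fromℤ {D} (ℤ.- n) ≡ - fromℤ n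
  fromℤ-neg n = K-cong (ι-neg n) refl

K-commutativeRing : ℕ → CommutativeRing 0ℓ 0ℓ
K-commutativeRing D = record { isCommutativeRing = K-isCommutativeRing {D} }

ℤ⟶K : ∀ D → ℤ.+-*-rawRing -Raw-AlmostCommutative⟶ fromCommutativeRing (K-commutativeRing D)
ℤ⟶K D = record
  { ⟦_⟧ = fromℤ ; +-homo = fromℤ-+ ; *-homo = fromℤ-* ; -‿homo = fromℤ-neg ; 0-homo = refl ; 1-homo = refl }

module K-Solver (D : ℕ) = Algebra.Solver.Ring ℤ.+-*-rawRing (fromCommutativeRing (K-commutativeRing D)) (ℤ⟶K D)
  (λ m n → Maybe.map (cong fromℤ) (dec⇒maybe (m ℤₚ.≟ n)))

module _ {D : ℕ} where
  open K-Solver D using (solve; _:=_; _:+_; _:*_; :-_; con)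

  +-*-*-distrib : (a b c d : K D) → (a + b) * c * d ≡ a * c * d + b * c * d
  +-*-*-distrib = solve 4 (λ a b c d → (a :+ b) :* c :* d := a :* c :* d :+ b :* c :* d) refl

  rank-one-term : (c a b x y : K D) → c * (a * b) * x * y ≡ c * (a * x) * (b * y)
  rank-one-term = solve 5 (λ c a b x y → c :* (a :* b) :* x :* y := c :* (a :* x) :* (b :* y)) refl

  -- Makes a factor `1#` visible, which `complete-square` then replaces by `a * a⁻¹`.
  expose-unit : (a x l t : K D) → a * x * x + x * l + x * l + t ≡ a * x * x + 1# * (x * l + x * l) + t
  expose-unit = solve 4 (λ a x l t →
    a :* x :* x :+ x :* l :+ x :* l :+ t := a :* x :* x :+ con (ℤ.+ 1) :* (x :* l :+ x :* l) :+ t) refl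

  -- A polynomial identity in independent a and b; that b is the inverse of a is used only by the
  -- caller.
  complete-square-with-inverse : (a b x l t : K D) → a * x * x + a * b * (x * l + x * l) + t ≡
    a * ((x + b * l) * (x + b * l)) + (t + - (a * b * b) * (l * l))
  complete-square-with-inverse =
    solve 5 (λ a b x l t →
    a :* x :* x :+ a :* b :* (x :* l :+ x :* l) :+ t := a :* ((x :+ b :* l) :* (x :+ b :* l)) :+
    (t :+ (:- (a :* b :* b)) :* (l :* l))) refl

  vanishing-square : (a l s : K D) → a * ((- l + l) * (- l + l)) + s ≡ s
  vanishing-square = solve 3 (λ a l s → a :* ((:- l :+ l) :* (:- l :+ l)) :+ s := s) refl

  shift-by-multiple : (m b x l t : K D) → m * x + t ≡ m * (x + b * l) + (t + - (m * b) * l)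
  shift-by-multiple = solve 5 (λ m b x l t →
    m :* x :+ t := m :* (x :+ b :* l) :+ (t :+ (:- (m :* b)) :* l)) refl

  first-coefficient : (a : K D) → a * 1# * 1# + 1# * 0# + 1# * 0# + 0# ≡ a
  first-coefficient = solve 1 (λ a →
    a :* con (ℤ.+ 1) :* con (ℤ.+ 1) :+ con (ℤ.+ 1) :* con (ℤ.+ 0) :+ con (ℤ.+ 1) :* con (ℤ.+ 0) :+
    con (ℤ.+ 0) := a) refl

  x∙yz≈y∙xz : (x y z : K D) → x * (y * z) ≡ y * (x * z)
  x∙yz≈y∙xz = solve 3 (λ x y z → x :* (y :* z) := y :* (x :* z)) refl

  wx∙yz≈wy∙xz : (w x y z : K D) → w * x * (y * z) ≡ w * y * (x * z)
  wx∙yz≈wy∙xz = solve 4 (λ w x y z → w :* x :* (y :* z) := w :* y :* (x :* z)) refl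

  x≈x+y-y : (x y : K D) → x ≡ x + y + - y
  x≈x+y-y = solve 2 (λ x y → x := x :+ y :+ (:- y)) refl

  x∙y-z≈-xyz : (x y z : K D) → x * (y * - z) ≡ - (x * y * z)
  x∙y-z≈-xyz = solve 3 (λ x y z → x :* (y :* (:- z)) := :- (x :* y :* z)) refl

  wx∙yz≈y∙wxz : (w x y z : K D) → w * x * (y * z) ≡ y * (w * (x * z))
  wx∙yz≈y∙wxz = solve 4 (λ w x y z → w :* x :* (y :* z) := y :* (w :* (x :* z))) refl

  collect-z+1 : (c z p q : K D) → c * (p * (z * q)) + c * (p * q) ≡ c * ((z + 1#) * p * q)
  collect-z+1 = solve 4 (λ c z p q →
    c :* (p :* (z :* q)) :+ c :* (p :* q) := c :* ((z :+ con (ℤ.+ 1)) :* p :* q)) refl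

  -- With y = τ(z) this says that z is a root of X² - (z + y)X + zy. The factors `1#` and the final
  -- `0#` are what `_^_` and `sum` unfold to in degree 2.
  minimal-polynomial : (z y : K D) → z * (z * 1#) + (z * y * 1# + (- (z + y) * (z * 1#) + 0#)) ≡ 0#
  minimal-polynomial = solve 2 (λ z y →
    z :* (z :* con (ℤ.+ 1)) :+
    (z :* y :* con (ℤ.+ 1) :+ ((:- (z :+ y)) :* (z :* con (ℤ.+ 1)) :+ con (ℤ.+ 0))) := con (ℤ.+ 0)) refl

  xy∙z≈xz∙y : (x y z : K D) → x * y * z ≡ x * z * y
  xy∙z≈xz∙y = solve 3 (λ x y z → x :* y :* z := x :* z :* y) refl

  off-diagonalˡ : (c p q : K D) → c * p * q + 0# ≡ (c + 0#) * p * q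
  off-diagonalˡ = solve 3 (λ c p q → c :* p :* q :+ con (ℤ.+ 0) := (c :+ con (ℤ.+ 0)) :* p :* q) refl

  off-diagonalʳ : (c p q : K D) → 0# + c * p * q ≡ (c + 0#) * p * q
  off-diagonalʳ = solve 3 (λ c p q → con (ℤ.+ 0) :+ c :* p :* q := (c :+ con (ℤ.+ 0)) :* p :* q) refl

  scale-term : (u c p q : K D) → c * (u * p) * (u * q) ≡ u * u * (c * p * q)
  scale-term = solve 4 (λ u c p q → c :* (u :* p) :* (u :* q) := u :* u :* (c :* p :* q)) refl

  x∙0∙y≈0 : (x y : K D) → x * 0# * y ≡ 0#
  x∙0∙y≈0 = solve 2 (λ x y → x :* con (ℤ.+ 0) :* y := con (ℤ.+ 0)) refl

  regroup-units : (u w a : K D) → u * u * (w * (w * a)) ≡ w * u * (w * u) * a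
  regroup-units = solve 3 (λ u w a → u :* u :* (w :* (w :* a)) := w :* u :* (w :* u) :* a) refl

  1∙1∙x≈x : (x : K D) → 1# * 1# * x ≡ x
  1∙1∙x≈x = solve 1 (λ x → con (ℤ.+ 1) :* con (ℤ.+ 1) :* x := x) refl

-- Inequalities between rational numbers.

2ℚ : ℚ
2ℚ = 1ℚ ℚ.+ 1ℚ

-- Turns a ring identity into an inequality: the difference r is exhibited explicitly, usually as a
-- sum of squares with non-negative weights.
≤-by : ∀ {p q r} → 0ℚ ℚ.≤ r → q ≡ p ℚ.+ r → p ℚ.≤ q
≤-by {p} {q} {r} 0≤r q≡p+r = begin
  p          ≡⟨ ℚₚ.+-identityʳ p ⟨
  p ℚ.+ 0ℚ   ≤⟨ ℚₚ.+-monoʳ-≤ p 0≤r ⟩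
  p ℚ.+ r    ≡⟨ q≡p+r ⟨
  q          ∎
  where open ℚₚ.≤-Reasoning

+-nonNeg : ∀ {p q} → 0ℚ ℚ.≤ p → 0ℚ ℚ.≤ q → 0ℚ ℚ.≤ p ℚ.+ q
+-nonNeg = ℚₚ.+-mono-≤

*-monoˡ-≤ : ∀ {r p q} → 0ℚ ℚ.≤ r → p ℚ.≤ q → r ℚ.* p ℚ.≤ r ℚ.* q
*-monoˡ-≤ {r} 0≤r = ℚₚ.*-monoˡ-≤-nonNeg r {{ℚ.nonNegative 0≤r}}

*-nonNeg : ∀ {p q} → 0ℚ ℚ.≤ p → 0ℚ ℚ.≤ q → 0ℚ ℚ.≤ p ℚ.* q
*-nonNeg {p} {q} 0≤p 0≤q = subst (ℚ._≤ p ℚ.* q) (ℚₚ.*-zeroʳ p) (*-monoˡ-≤ 0≤p 0≤q)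

*-monoˡ-< : ∀ {r p q} → 0ℚ ℚ.< r → p ℚ.< q → r ℚ.* p ℚ.< r ℚ.* q
*-monoˡ-< {r} 0<r = ℚₚ.*-monoʳ-<-pos r {{ℚ.positive 0<r}}

*-pos : ∀ {p q} → 0ℚ ℚ.< p → 0ℚ ℚ.< q → 0ℚ ℚ.< p ℚ.* q
*-pos {p} {q} 0<p 0<q = subst (ℚ._< p ℚ.* q) (ℚₚ.*-zeroʳ p) (*-monoˡ-< 0<p 0<q)

*-cancelˡ-< : ∀ {r p q} → 0ℚ ℚ.< r → r ℚ.* p ℚ.< r ℚ.* q → p ℚ.< q
*-cancelˡ-< {r} 0<r = ℚₚ.*-cancelˡ-<-nonNeg r {{ℚ.nonNegative (ℚₚ.<⇒≤ 0<r)}}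

*-cancelˡ-≤ : ∀ {r p q} → 0ℚ ℚ.< r → r ℚ.* p ℚ.≤ r ℚ.* q → p ℚ.≤ q
*-cancelˡ-≤ {r} 0<r = ℚₚ.*-cancelˡ-≤-pos r {{ℚ.positive 0<r}}

square-nonNeg : ∀ p → 0ℚ ℚ.≤ p ℚ.* p
square-nonNeg p with ℚₚ.≤-total 0ℚ p
... | inj₁ 0≤p = *-nonNeg 0≤p 0≤p
... | inj₂ p≤0 = subst (0ℚ ℚ.≤_) (sign p) (*-nonNeg (ℚₚ.neg-antimono-≤ p≤0) (ℚₚ.neg-antimono-≤ p≤0))
  where
  sign : ∀ p → (ℚ.- p) ℚ.* (ℚ.- p) ≡ p ℚ.* p
  sign = solve-∀ ℚ-ring

-- Norm, size and total positivity.

module _ {D : ℕ} where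

  norm size : K D → ℚ
  norm x = rat x ℚ.* rat x ℚ.- δ D ℚ.* (irr x ℚ.* irr x)
  size x = rat (x * x)

  δ-nonNeg : 0ℚ ℚ.≤ δ D
  δ-nonNeg = ι-mono-≤ {ℤ.+ 0} {ℤ.+ D} (ℤ.+≤+ ℕ.z≤n)

  size-nonNeg : (x : K D) → 0ℚ ℚ.≤ size x
  size-nonNeg x = +-nonNeg {rat x ℚ.* rat x} (square-nonNeg (rat x)) (*-nonNeg δ-nonNeg (square-nonNeg (irr x)))

  size-+ : (x y : K D) → size (x + y) ℚ.≤ 2ℚ ℚ.* size x ℚ.+ 2ℚ ℚ.* size y
  size-+ x y = ≤-by {r = size (x + - y)} (size-nonNeg (x + - y))
    (parallelogram (δ D) (rat x) (irr x) (rat y) (irr y))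
    where
    parallelogram : ∀ δ a b c d →
      2ℚ ℚ.* (a ℚ.* a ℚ.+ δ ℚ.* (b ℚ.* b)) ℚ.+ 2ℚ ℚ.* (c ℚ.* c ℚ.+ δ ℚ.* (d ℚ.* d)) ≡
      (a ℚ.+ c) ℚ.* (a ℚ.+ c) ℚ.+ δ ℚ.* ((b ℚ.+ d) ℚ.* (b ℚ.+ d)) ℚ.+
      ((a ℚ.- c) ℚ.* (a ℚ.- c) ℚ.+ δ ℚ.* ((b ℚ.- d) ℚ.* (b ℚ.- d)))
    parallelogram = solve-∀ ℚ-ring

  -- Since size(x) = (x² + τ(x)²)/2, the left side multiplies out to half the sum of the four
  -- products of a square from x with a square from y. They pair off into the squares of xy and
  -- xτ(y) and of their conjugates.
  size-*+size-*τ : (x y : K D) → 2ℚ ℚ.* (size x ℚ.* size y) ≡ size (x * y) ℚ.+ size (x * τ y)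
  size-*+size-*τ x y = identity (δ D) (rat x) (irr x) (rat y) (irr y)
    where
    identity : ∀ δ a b c d →
      2ℚ ℚ.* ((a ℚ.* a ℚ.+ δ ℚ.* (b ℚ.* b)) ℚ.* (c ℚ.* c ℚ.+ δ ℚ.* (d ℚ.* d))) ≡
      (a ℚ.* c ℚ.+ δ ℚ.* (b ℚ.* d)) ℚ.* (a ℚ.* c ℚ.+ δ ℚ.* (b ℚ.* d)) ℚ.+
      δ ℚ.* ((a ℚ.* d ℚ.+ b ℚ.* c) ℚ.* (a ℚ.* d ℚ.+ b ℚ.* c)) ℚ.+
      ((a ℚ.* c ℚ.+ δ ℚ.* (b ℚ.* (ℚ.- d))) ℚ.* (a ℚ.* c ℚ.+ δ ℚ.* (b ℚ.* (ℚ.- d))) ℚ.+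
      δ ℚ.* ((a ℚ.* (ℚ.- d) ℚ.+ b ℚ.* c) ℚ.* (a ℚ.* (ℚ.- d) ℚ.+ b ℚ.* c)))
    identity = solve-∀ ℚ-ring

  size-* : (x y : K D) → size (x * y) ℚ.≤ 2ℚ ℚ.* (size x ℚ.* size y)
  size-* x y = ≤-by (size-nonNeg (x * τ y)) (size-*+size-*τ x y)

  -- Equivalent to x ≻0, but free of the case distinction.
  TotallyPositive : K D → Set
  TotallyPositive x = 0ℚ ℚ.< rat x × 0ℚ ℚ.< norm x

  private
    q<p⇒0<p-q : ∀ {p q} → q ℚ.< p → 0ℚ ℚ.< p ℚ.- q
    q<p⇒0<p-q {p} {q} q<p = subst (ℚ._< p ℚ.- q) (ℚₚ.+-inverseʳ q) (ℚₚ.+-monoˡ-< (ℚ.- q) q<p)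

    0<p-q⇒q<p : ∀ {p q} → 0ℚ ℚ.< p ℚ.- q → q ℚ.< p
    0<p-q⇒q<p {p} {q} 0<p-q =
      subst₂ ℚ._<_ (ℚₚ.+-identityˡ q) (cancel p q) (ℚₚ.+-monoˡ-< q 0<p-q)
      where
      cancel : ∀ p q → p ℚ.- q ℚ.+ q ≡ p
      cancel = solve-∀ ℚ-ring

    neg-neg : ∀ b → ℚ.- (ℚ.- b) ≡ b
    neg-neg = solve-∀ ℚ-ring

    neg-square : ∀ δ b → δ ℚ.* ((ℚ.- b) ℚ.* (ℚ.- b)) ≡ δ ℚ.* (b ℚ.* b)
    neg-square = solve-∀ ℚ-ring

  -- The irrational part cannot dominate in both embeddings, since b and -b would both be positive.
  -- So the rational part dominates in one of them, and hence in both, as the criterion only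
  -- involves b².
  ≻0⇒TotallyPositive : (x : K D) → x ≻0 → TotallyPositive x
  ≻0⇒TotallyPositive x (inj₁ (0<a , N>0) , _) = 0<a , q<p⇒0<p-q N>0
  ≻0⇒TotallyPositive x (inj₂ (0<b , N<0) , inj₁ (0<a , N>0)) =
    0<a , q<p⇒0<p-q (subst (ℚ._< rat x ℚ.* rat x) (neg-square (δ D) (irr x)) N>0)
  ≻0⇒TotallyPositive x (inj₂ (0<b , N<0) , inj₂ (0<-b , _)) =
    ⊥-elim (ℚₚ.<-asym 0<b (subst (ℚ._< 0ℚ) (neg-neg (irr x)) (ℚₚ.neg-antimono-< 0<-b)))

  TotallyPositive⇒≻0 : (x : K D) → TotallyPositive x → x ≻0
  TotallyPositive⇒≻0 x (0<a , 0<N) =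
    inj₁ (0<a , 0<p-q⇒q<p 0<N) ,
    inj₁ (0<a , subst (ℚ._< rat x ℚ.* rat x) (sym (neg-square (δ D) (irr x))) (0<p-q⇒q<p 0<N))

  norm-* : (x y : K D) → norm (x * y) ≡ norm x ℚ.* norm y
  norm-* x y = identity (δ D) (rat x) (irr x) (rat y) (irr y)
    where
    identity : ∀ δ a b c d →
      (a ℚ.* c ℚ.+ δ ℚ.* (b ℚ.* d)) ℚ.* (a ℚ.* c ℚ.+ δ ℚ.* (b ℚ.* d)) ℚ.-
      δ ℚ.* ((a ℚ.* d ℚ.+ b ℚ.* c) ℚ.* (a ℚ.* d ℚ.+ b ℚ.* c)) ≡
      (a ℚ.* a ℚ.- δ ℚ.* (b ℚ.* b)) ℚ.* (c ℚ.* c ℚ.- δ ℚ.* (d ℚ.* d))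
    identity = solve-∀ ℚ-ring

  scalar : ℚ → K D
  scalar q = ⟨ q , 0ℚ ⟩

  rat-scalar-* : ∀ q (x : K D) → rat (scalar q * x) ≡ q ℚ.* rat x
  rat-scalar-* q x = identity (δ D) q (rat x) (irr x)
    where
    identity : ∀ δ q a b → q ℚ.* a ℚ.+ δ ℚ.* (0ℚ ℚ.* b) ≡ q ℚ.* a
    identity = solve-∀ ℚ-ring

  scalar-τ-norm : (x : K D) → x * τ x ≡ scalar (norm x)
  scalar-τ-norm x = K-cong (rational (δ D) (rat x) (irr x)) (irrational (rat x) (irr x))
    where
    rational : ∀ δ a b → a ℚ.* a ℚ.+ δ ℚ.* (b ℚ.* (ℚ.- b)) ≡ a ℚ.* a ℚ.- δ ℚ.* (b ℚ.* b)
    rational = solve-∀ ℚ-ring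
    irrational : ∀ a b → a ℚ.* (ℚ.- b) ℚ.+ b ℚ.* a ≡ 0ℚ
    irrational = solve-∀ ℚ-ring

  scalar-* : ∀ p q → scalar p * scalar q ≡ scalar (p ℚ.* q)
  scalar-* p q = K-cong (rat-scalar-* p (scalar q)) (irrational p q)
    where
    irrational : ∀ p q → p ℚ.* 0ℚ ℚ.+ 0ℚ ℚ.* q ≡ 0ℚ
    irrational = solve-∀ ℚ-ring

  open CommutativeRing (K-commutativeRing D) public using
    (*-assoc; *-comm; *-identityˡ; *-identityʳ; +-assoc; +-comm; +-identityˡ; +-identityʳ; zeroˡ; zeroʳ;
     distribˡ; distribʳ; semiring)

  -- Completing the square: 2 rat(a) rat(a w²) − N(a) size(w) is a sum of squares.
  size≤rat-weighted : (a w : K D) → TotallyPositive a → norm a ℚ.* size w ℚ.≤ 2ℚ ℚ.* rat a ℚ.* rat (a * (w * w))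
  size≤rat-weighted a w (0<s , 0<N) = ≤-by
    (+-nonNeg (square-nonNeg (rat a ℚ.* rat w ℚ.+ δ D ℚ.* (irr a ℚ.* irr w)))
              (*-nonNeg δ-nonNeg (square-nonNeg (rat a ℚ.* irr w ℚ.+ irr a ℚ.* rat w))))
    (identity (δ D) (rat a) (irr a) (rat w) (irr w))
    where
    identity : ∀ δ s t e f →
      2ℚ ℚ.* s ℚ.* (s ℚ.* (e ℚ.* e ℚ.+ δ ℚ.* (f ℚ.* f)) ℚ.+ δ ℚ.* (t ℚ.* (e ℚ.* f ℚ.+ f ℚ.* e))) ≡
      (s ℚ.* s ℚ.- δ ℚ.* (t ℚ.* t)) ℚ.* (e ℚ.* e ℚ.+ δ ℚ.* (f ℚ.* f)) ℚ.+
      ((s ℚ.* e ℚ.+ δ ℚ.* (t ℚ.* f)) ℚ.* (s ℚ.* e ℚ.+ δ ℚ.* (t ℚ.* f)) ℚ.+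
       δ ℚ.* ((s ℚ.* f ℚ.+ t ℚ.* e) ℚ.* (s ℚ.* f ℚ.+ t ℚ.* e)))
    identity = solve-∀ ℚ-ring

  module _ (a : K D) (a≻0 : TotallyPositive a) where
    private
      instance
        N>0 : ℚ.Positive (norm a)
        N>0 = ℚ.positive (proj₂ a≻0)
        N≢0 : ℚ.NonZero (norm a)
        N≢0 = ℚₚ.pos⇒nonZero (norm a)
        N⁻¹>0 : ℚ.Positive (ℚ.1/ norm a)
        N⁻¹>0 = ℚₚ.1/pos⇒pos (norm a)

    abstract
      -- The inverse is τ(a)/N(a); total positivity supplies N(a) ≠ 0.
      inverse : Σ[ a⁻¹ ∈ K D ] a * a⁻¹ ≡ 1#
      inverse = τ a * scalar (ℚ.1/ norm a) , (begin
        a * (τ a * scalar (ℚ.1/ norm a))          ≡⟨ *-assoc a (τ a) _ ⟨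
        a * τ a * scalar (ℚ.1/ norm a)            ≡⟨ cong (_* scalar (ℚ.1/ norm a)) (scalar-τ-norm a) ⟩
        scalar (norm a) * scalar (ℚ.1/ norm a)    ≡⟨ scalar-* (norm a) (ℚ.1/ norm a) ⟩
        scalar (norm a ℚ.* ℚ.1/ norm a)           ≡⟨ cong scalar (ℚₚ.*-inverseʳ (norm a)) ⟩
        1#                                        ∎)
        where open ≡-Reasoning

    abstract
      size-weighted : Σ[ C ∈ ℚ ] 0ℚ ℚ.≤ C × (∀ w → size w ℚ.≤ C ℚ.* rat (a * (w * w)))
      size-weighted = ℚ.1/ norm a ℚ.* (2ℚ ℚ.* rat a)
        , *-nonNeg 0≤N⁻¹ (*-nonNeg (ℚₚ.nonNegative⁻¹ 2ℚ) (ℚₚ.<⇒≤ (proj₁ a≻0)))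
        , λ w → begin
          size w                                                   ≡⟨ ℚₚ.*-identityˡ (size w) ⟨
          1ℚ ℚ.* size w
            ≡⟨ cong (ℚ._* size w) (ℚₚ.*-inverseˡ (norm a)) ⟨
          ℚ.1/ norm a ℚ.* norm a ℚ.* size w
            ≡⟨ ℚₚ.*-assoc (ℚ.1/ norm a) (norm a) (size w) ⟩
          ℚ.1/ norm a ℚ.* (norm a ℚ.* size w)
            ≤⟨ *-monoˡ-≤ 0≤N⁻¹ (size≤rat-weighted a w a≻0) ⟩
          ℚ.1/ norm a ℚ.* (2ℚ ℚ.* rat a ℚ.* rat (a * (w * w)))
            ≡⟨ ℚₚ.*-assoc (ℚ.1/ norm a) (2ℚ ℚ.* rat a) (rat (a * (w * w))) ⟨
          ℚ.1/ norm a ℚ.* (2ℚ ℚ.* rat a) ℚ.* rat (a * (w * w))     ∎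
        where
        open ℚₚ.≤-Reasoning
        0≤N⁻¹ : 0ℚ ℚ.≤ ℚ.1/ norm a
        0≤N⁻¹ = ℚₚ.<⇒≤ (ℚₚ.positive⁻¹ (ℚ.1/ norm a))

-- Symmetric matrices over K: elimination and bounds for linear forms.

module _ {D : ℕ} where
  open Algebra.Properties.Semiring.Sum (semiring {D}) public
    using (sum-cong-≗; ∑-distrib-+; *-distribˡ-sum; *-distribʳ-sum; sum-replicate-zero; ∑-comm)

  -- The quadratic form of the matrix M, summed over all ordered pairs of indices, in contrast to
  -- the triangular sum in `eval`.
  bilinear : ∀ {n} → (Fin n → Fin n → K D) → (Fin n → K D) → K D
  bilinear M x = sum λ i → sum λ j → M i j * x i * x j

  linear : ∀ {n} → (Fin n → K D) → (Fin n → K D) → K D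
  linear m x = sum λ i → m i * x i

  linear-+ : ∀ {n} (m m′ x : Fin n → K D) → linear (λ i → m i + m′ i) x ≡ linear m x + linear m′ x
  linear-+ m m′ x = trans (sum-cong-≗ λ i → distribʳ (x i) (m i) (m′ i))
    (∑-distrib-+ (λ i → m i * x i) (λ i → m′ i * x i))

  linear-* : ∀ {n} c (m x : Fin n → K D) → linear (λ i → c * m i) x ≡ c * linear m x
  linear-* c m x = trans (sum-cong-≗ λ i → *-assoc c (m i) (x i)) (sym (*-distribˡ-sum c (λ i → m i * x i)))

  bilinear-+ : ∀ {n} (M M′ : Fin n → Fin n → K D) x → bilinear (λ i j → M i j + M′ i j) x ≡
    bilinear M x + bilinear M′ x
  bilinear-+ M M′ x = trans
    (sum-cong-≗ λ i → trans (sum-cong-≗ λ j → +-*-*-distrib (M i j) (M′ i j) (x i) (x j))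
      (∑-distrib-+ (row M i) (row M′ i)))
    (∑-distrib-+ (λ i → sum (row M i)) (λ i → sum (row M′ i)))
    where
    row : (Fin _ → Fin _ → K D) → Fin _ → Fin _ → K D
    row M i j = M i j * x i * x j

  bilinear-rank-one : ∀ {n} c (m x : Fin n → K D) →
    bilinear (λ i j → c * (m i * m j)) x ≡ c * (linear m x * linear m x)
  bilinear-rank-one c m x = begin
    (sum λ i → sum λ j → c * (m i * m j) * x i * x j)
      ≡⟨ sum-cong-≗ (λ i → sum-cong-≗ λ j → rank-one-term c (m i) (m j) (x i) (x j)) ⟩
    (sum λ i → sum λ j → c * (m i * x i) * (m j * x j))
      ≡⟨ sum-cong-≗ (λ i → sym (*-distribˡ-sum (c * (m i * x i)) (λ j → m j * x j))) ⟩
    (sum λ i → c * (m i * x i) * linear m x)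
      ≡⟨ *-distribʳ-sum (linear m x) (λ i → c * (m i * x i)) ⟨
    (sum λ i → c * (m i * x i)) * linear m x
      ≡⟨ cong (_* linear m x) (sym (*-distribˡ-sum c (λ i → m i * x i))) ⟩
    c * linear m x * linear m x                            ≡⟨ *-assoc c (linear m x) (linear m x) ⟩
    c * (linear m x * linear m x)                          ∎
    where
    open ≡-Reasoning

  Symmetric : ∀ {n} → (Fin n → Fin n → K D) → Set
  Symmetric M = ∀ i j → M i j ≡ M j i

  bilinear-suc : ∀ {n} (M : Fin (suc n) → Fin (suc n) → K D) → Symmetric M → ∀ x y →
    bilinear M (x ◂ y) ≡
    M zero zero * x * x + x * linear (M zero ∘ suc) y + x * linear (M zero ∘ suc) y +
    bilinear (λ i j → M (suc i) (suc j)) y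
  bilinear-suc M M-sym x y = begin
    M zero zero * x * x + (sum λ j → M zero (suc j) * x * y j) +
    (sum λ i → M (suc i) zero * y i * x + sum λ j → M (suc i) (suc j) * y i * y j)
      ≡⟨ cong₂ (λ p q → M zero zero * x * x + p + q) row
        (trans (∑-distrib-+ (λ i → M (suc i) zero * y i * x) (λ i → sum λ j →
        M (suc i) (suc j) * y i * y j)) (cong (_+ T) column)) ⟩
    M zero zero * x * x + x * L + (x * L + T)
      ≡⟨ +-assoc (M zero zero * x * x + x * L) (x * L) T ⟨
    M zero zero * x * x + x * L + x * L + T ∎
    where
    open ≡-Reasoning
    L = linear (M zero ∘ suc) y
    T = bilinear (λ i j → M (suc i) (suc j)) y
    row : (sum λ j → M zero (suc j) * x * y j) ≡ x * L
    row = trans (sum-cong-≗ λ j →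
      trans (cong (_* y j) (*-comm (M zero (suc j)) x)) (*-assoc x (M zero (suc j)) (y j)))
      (sym (*-distribˡ-sum x (λ j → M zero (suc j) * y j)))
    column : (sum λ i → M (suc i) zero * y i * x) ≡ x * L
    column = trans (sum-cong-≗ λ i →
      trans (*-comm (M (suc i) zero * y i) x) (cong (λ c → x * (c * y i)) (M-sym (suc i) zero)))
      (sym (*-distribˡ-sum x (λ i → M zero (suc i) * y i)))

  module Elimination {n} (M : Fin (suc n) → Fin (suc n) → K D) (M-sym : Symmetric M)
                     (a⁻¹ : K D) (a*a⁻¹≡1 : M zero zero * a⁻¹ ≡ 1#) where

    schur : Fin n → Fin n → K D
    schur i j = M (suc i) (suc j) + - a⁻¹ * (M zero (suc i) * M zero (suc j))

    schur-sym : Symmetric schur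
    schur-sym i j = cong₂ (λ p q → p + - a⁻¹ * q) (M-sym (suc i) (suc j))
      (*-comm (M zero (suc i)) (M zero (suc j)))

    L : (Fin n → K D) → K D
    L = linear (M zero ∘ suc)

    schur-value : ∀ y → bilinear schur y ≡ bilinear (λ i j → M (suc i) (suc j)) y + - a⁻¹ * (L y * L y)
    schur-value y = trans
      (bilinear-+ (λ i j → M (suc i) (suc j)) (λ i j → - a⁻¹ * (M zero (suc i) * M zero (suc j))) y)
                          (cong (bilinear (λ i j → M (suc i) (suc j)) y +_)
                            (bilinear-rank-one (- a⁻¹) (M zero ∘ suc) y))

    complete-square : ∀ x y →
      bilinear M (x ◂ y) ≡ M zero zero * ((x + a⁻¹ * L y) * (x + a⁻¹ * L y)) + bilinear schur y
    complete-square x y = begin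
      bilinear M (x ◂ y)
        ≡⟨ bilinear-suc M M-sym x y ⟩
      a * x * x + x * L y + x * L y + T
        ≡⟨ expose-unit a x (L y) T ⟩
      a * x * x + 1# * (x * L y + x * L y) + T
        ≡⟨ cong (λ u → a * x * x + u * (x * L y + x * L y) + T) a*a⁻¹≡1 ⟨
      a * x * x + a * a⁻¹ * (x * L y + x * L y) + T
        ≡⟨ complete-square-with-inverse a a⁻¹ x (L y) T ⟩
      a * ((x + a⁻¹ * L y) * (x + a⁻¹ * L y)) + (T + - (a * a⁻¹ * a⁻¹) * (L y * L y))
        ≡⟨ cong (λ u → a * ((x + a⁻¹ * L y) * (x + a⁻¹ * L y)) + (T + - u * (L y * L y)))
          (trans (cong (_* a⁻¹) a*a⁻¹≡1) (*-identityˡ a⁻¹)) ⟩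
      a * ((x + a⁻¹ * L y) * (x + a⁻¹ * L y)) + (T + - a⁻¹ * (L y * L y))
        ≡⟨ cong (a * ((x + a⁻¹ * L y) * (x + a⁻¹ * L y)) +_) (schur-value y) ⟨
      a * ((x + a⁻¹ * L y) * (x + a⁻¹ * L y)) + bilinear schur y ∎
      where
      open ≡-Reasoning
      a = M zero zero
      T = bilinear (λ i j → M (suc i) (suc j)) y

    -- This choice of the first coordinate annihilates the completed square. Every value of the
    -- Schur complement is thus a value of M, which is how definiteness is inherited.
    schur-minimum : ∀ y → bilinear M (- (a⁻¹ * L y) ◂ y) ≡ bilinear schur y
    schur-minimum y = trans (complete-square (- (a⁻¹ * L y)) y)
      (vanishing-square (M zero zero) (a⁻¹ * L y) (bilinear schur y))

    -- Rewrites a linear form in the coordinates of the completed square, `x + a⁻¹ * L y` and y, so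
    -- that its two parts can be bounded by the two summands of `complete-square`.
    linear-shift : ∀ m x y → linear m (x ◂ y) ≡
      m zero * (x + a⁻¹ * L y) + linear (λ i → m (suc i) + - (m zero * a⁻¹) * M zero (suc i)) y
    linear-shift m x y = trans (shift-by-multiple (m zero) a⁻¹ x (L y) (linear (m ∘ suc) y))
      (cong (m zero * (x + a⁻¹ * L y) +_)
        (sym (trans (linear-+ (m ∘ suc) (λ i → - (m zero * a⁻¹) * M zero (suc i)) y)
        (cong (linear (m ∘ suc) y +_) (linear-* (- (m zero * a⁻¹)) (M zero ∘ suc) y)))))

  PositiveDefinite : ∀ {n} → (Fin n → Fin n → K D) → Set
  PositiveDefinite M = ∀ x → ¬ (∀ i → x i ≡ 0#) → TotallyPositive (bilinear M x)

  1≢0 : ¬ (1# {D} ≡ 0#)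
  1≢0 ()

  bilinear-zero : ∀ {n} (M : Fin n → Fin n → K D) {x} → (∀ i → x i ≡ 0#) → bilinear M x ≡ 0#
  bilinear-zero {n} M {x} x≡0 = trans
    (sum-cong-≗ λ i → trans (sum-cong-≗ λ j → trans (cong (M i j * x i *_) (x≡0 j)) (zeroʳ (M i j * x i)))
      (sum-replicate-zero n))
    (sum-replicate-zero n)

  -- The pivot is the value at the first basis vector, hence totally positive and invertible.
  leading-value : ∀ {n} (M : Fin (suc n) → Fin (suc n) → K D) → Symmetric M → bilinear M (1# ◂ λ _ → 0#) ≡
    M zero zero
  leading-value {n} M M-sym = begin
    bilinear M (1# ◂ λ _ → 0#)
      ≡⟨ bilinear-suc M M-sym 1# (λ _ → 0#) ⟩
    M zero zero * 1# * 1# + 1# * linear (M zero ∘ suc) (λ _ → 0#) +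
    1# * linear (M zero ∘ suc) (λ _ → 0#) + bilinear (λ i j → M (suc i) (suc j)) (λ _ → 0#)
      ≡⟨ cong₂ (λ p q → M zero zero * 1# * 1# + 1# * p + 1# * p + q) linear≡0
        (bilinear-zero (λ i j → M (suc i) (suc j)) λ _ → refl) ⟩
    M zero zero * 1# * 1# + 1# * 0# + 1# * 0# + 0#
      ≡⟨ first-coefficient (M zero zero) ⟩
    M zero zero ∎
    where
    open ≡-Reasoning
    linear≡0 : linear (M zero ∘ suc) (λ _ → 0#) ≡ 0#
    linear≡0 = trans (sum-cong-≗ λ i → zeroʳ (M zero (suc i))) (sum-replicate-zero n)

  -- Only coordinates are needed in the end, but an elimination step changes a coordinate into
  -- another linear form; arbitrary m makes the induction go through.
  Dominates : ∀ {n} → (Fin n → Fin n → K D) → (Fin n → K D) → Set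
  Dominates M m = Σ[ C ∈ ℚ ] 0ℚ ℚ.≤ C × (∀ x → size (linear m x) ℚ.≤ C ℚ.* rat (bilinear M x))

  rat-nonNeg : ∀ {n} (M : Fin n → Fin n → K D) → PositiveDefinite M → ∀ x → 0ℚ ℚ.≤ rat (bilinear M x)
  rat-nonNeg M M>0 x with Finₚ.all? (λ i → x i ≟ 0#)
  ... | yes x≡0 = ℚₚ.≤-reflexive (sym (cong rat (bilinear-zero M x≡0)))
  ... | no x≢0  = ℚₚ.<⇒≤ (proj₁ (M>0 x x≢0))

  -- Completing squares over K itself, so that no passage to the real closure is needed.
  dominates : ∀ {n} (M : Fin n → Fin n → K D) → Symmetric M → PositiveDefinite M → ∀ m → Dominates M m
  dominates {zero} M M-sym M>0 m = 0ℚ , ℚₚ.≤-refl , λ x → ℚₚ.≤-reflexive (rational (δ D))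
    where
    rational : ∀ δ → 0ℚ ℚ.* 0ℚ ℚ.+ δ ℚ.* (0ℚ ℚ.* 0ℚ) ≡ 0ℚ ℚ.* 0ℚ
    rational = solve-∀ ℚ-ring
  dominates {suc n} M M-sym M>0 m =
    C₀ ℚ.+ C₁ , +-nonNeg 0≤C₀ 0≤C₁ , λ x → bound (x zero) (x ∘ suc)
    where
    a = M zero zero

    a≻0 : TotallyPositive a
    a≻0 = subst TotallyPositive (leading-value M M-sym) (M>0 (1# ◂ λ _ → 0#) λ e₀≡0 → 1≢0 (e₀≡0 zero))

    open Elimination M M-sym (proj₁ (inverse a a≻0)) (proj₂ (inverse a a≻0))

    schur>0 : PositiveDefinite schur
    schur>0 y y≢0 = subst TotallyPositive (schur-minimum y)
      (M>0 (- (proj₁ (inverse a a≻0) * L y) ◂ y) λ xy≡0 → y≢0 (xy≡0 ∘ suc))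

    m′ : Fin n → K D
    m′ i = m (suc i) + - (m zero * proj₁ (inverse a a≻0)) * M zero (suc i)

    IH : Dominates schur m′
    IH = dominates schur schur-sym schur>0 m′

    C′ = proj₁ (size-weighted a a≻0)
    C″ = proj₁ IH

    -- The outer factors 2 come from `size-+`, the inner one from `size-*`; C′ bounds the pivot
    -- variable, C″ the remaining variables by induction.
    C₀ = 2ℚ ℚ.* (2ℚ ℚ.* size (m zero) ℚ.* C′)
    C₁ = 2ℚ ℚ.* C″

    0≤2 : 0ℚ ℚ.≤ 2ℚ
    0≤2 = ℚₚ.nonNegative⁻¹ 2ℚ

    0≤2s : 0ℚ ℚ.≤ 2ℚ ℚ.* size (m zero)
    0≤2s = *-nonNeg 0≤2 (size-nonNeg (m zero))

    0≤C₀ : 0ℚ ℚ.≤ C₀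
    0≤C₀ = *-nonNeg 0≤2 (*-nonNeg 0≤2s (proj₁ (proj₂ (size-weighted a a≻0))))

    0≤C₁ : 0ℚ ℚ.≤ C₁
    0≤C₁ = *-nonNeg 0≤2 (proj₁ (proj₂ IH))

    bound : ∀ x y → size (linear m (x ◂ y)) ℚ.≤ (C₀ ℚ.+ C₁) ℚ.* rat (bilinear M (x ◂ y))
    bound x y = begin
      size (linear m (x ◂ y))
        ≡⟨ cong size (linear-shift m x y) ⟩
      size (m zero * w + linear m′ y)
        ≤⟨ size-+ (m zero * w) (linear m′ y) ⟩
      2ℚ ℚ.* size (m zero * w) ℚ.+ 2ℚ ℚ.* size (linear m′ y)
        ≤⟨ ℚₚ.+-mono-≤ (*-monoˡ-≤ 0≤2
          (ℚₚ.≤-trans (size-* (m zero) w) (ℚₚ.≤-reflexive (sym (ℚₚ.*-assoc 2ℚ (size (m zero)) (size w))))))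
                       (*-monoˡ-≤ 0≤2 (proj₂ (proj₂ IH) y)) ⟩
      2ℚ ℚ.* (2ℚ ℚ.* size (m zero) ℚ.* size w) ℚ.+ 2ℚ ℚ.* (C″ ℚ.* r)
        ≤⟨ ℚₚ.+-monoˡ-≤ (2ℚ ℚ.* (C″ ℚ.* r))
          (*-monoˡ-≤ 0≤2 (*-monoˡ-≤ 0≤2s (proj₂ (proj₂ (size-weighted a a≻0)) w))) ⟩
      2ℚ ℚ.* (2ℚ ℚ.* size (m zero) ℚ.* (C′ ℚ.* q)) ℚ.+ 2ℚ ℚ.* (C″ ℚ.* r)
        ≡⟨ cong₂ ℚ._+_ (reassoc₀ (2ℚ ℚ.* size (m zero)) C′ q) (reassoc₁ C″ r) ⟩
      C₀ ℚ.* q ℚ.+ C₁ ℚ.* r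
        -- Merging the two constants into one adds the cross terms C₁q and C₀r, which are
        -- non-negative.
        ≤⟨ ≤-by (+-nonNeg (*-nonNeg 0≤C₁ 0≤q) (*-nonNeg 0≤C₀ 0≤r)) (expand C₀ C₁ q r) ⟩
      (C₀ ℚ.+ C₁) ℚ.* (q ℚ.+ r)
        ≡⟨ cong (λ v → (C₀ ℚ.+ C₁) ℚ.* rat v) (complete-square x y) ⟨
      (C₀ ℚ.+ C₁) ℚ.* rat (bilinear M (x ◂ y)) ∎
      where
      open ℚₚ.≤-Reasoning
      w = x + proj₁ (inverse a a≻0) * L y
      q = rat (a * (w * w))
      r = rat (bilinear schur y)
      0≤r : 0ℚ ℚ.≤ r
      0≤r = rat-nonNeg schur schur>0 y
      -- 2 rat(a) q is at least N(a) size(w) ≥ 0, and rat(a) > 0.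
      0≤q : 0ℚ ℚ.≤ q
      0≤q = ℚₚ.≮⇒≥ λ q<0 → ℚₚ.<-irrefl refl (ℚₚ.≤-<-trans
        (ℚₚ.≤-trans (*-nonNeg (ℚₚ.<⇒≤ (proj₂ a≻0)) (size-nonNeg w)) (size≤rat-weighted a w a≻0))
        (subst (2ℚ ℚ.* rat a ℚ.* q ℚ.<_) (ℚₚ.*-zeroʳ (2ℚ ℚ.* rat a))
          (*-monoˡ-< (*-pos (ℚₚ.positive⁻¹ 2ℚ) (proj₁ a≻0)) q<0)))
      reassoc₀ : ∀ s c q → 2ℚ ℚ.* (s ℚ.* (c ℚ.* q)) ≡ 2ℚ ℚ.* (s ℚ.* c) ℚ.* q
      reassoc₀ = solve-∀ ℚ-ring
      reassoc₁ : ∀ c r → 2ℚ ℚ.* (c ℚ.* r) ≡ 2ℚ ℚ.* c ℚ.* r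
      reassoc₁ = solve-∀ ℚ-ring
      expand : ∀ c₀ c₁ q r → (c₀ ℚ.+ c₁) ℚ.* (q ℚ.+ r) ≡ c₀ ℚ.* q ℚ.+ c₁ ℚ.* r ℚ.+ (c₁ ℚ.* q ℚ.+ c₀ ℚ.* r)
      expand = solve-∀ ℚ-ring

-- Integrality of rational numbers by descent.

IsInteger : ℚ → Set
IsInteger q = ∃[ n ] q ≡ ι n

int-ι : ∀ n → IsInteger (ι n)
int-ι n = n , refl

int-+ : ∀ {p q} → IsInteger p → IsInteger q → IsInteger (p ℚ.+ q)
int-+ (m , p≡m) (n , q≡n) = m ℤ.+ n , trans (cong₂ ℚ._+_ p≡m q≡n) (sym (ι-+ m n))

int-* : ∀ {p q} → IsInteger p → IsInteger q → IsInteger (p ℚ.* q)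
int-* (m , p≡m) (n , q≡n) = m ℤ.* n , trans (cong₂ ℚ._*_ p≡m q≡n) (sym (ι-* m n))

int-neg : ∀ {p} → IsInteger p → IsInteger (ℚ.- p)
int-neg (m , p≡m) = ℤ.- m , trans (cong ℚ.-_ p≡m) (sym (ι-neg m))

int-- : ∀ {p q} → IsInteger p → IsInteger q → IsInteger (p ℚ.- q)
int-- p∈ℤ q∈ℤ = int-+ p∈ℤ (int-neg q∈ℤ)

clear-denominator : ∀ q → q ℚ.* ι (ℚ.↧ q) ≡ ι (ℚ.↥ q)
clear-denominator q@(mkℚ p m-1 c) = ℚₚ.toℚᵘ-injective (begin
  ℚ.toℚᵘ (q ℚ.* ι (ℚ.↧ q))             ≈⟨ ℚₚ.toℚᵘ-homo-* q (ι (ℚ.↧ q)) ⟩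
  ℚ.toℚᵘ q ℚᵘ.* ℚ.toℚᵘ (ι (ℚ.↧ q))     ≈⟨ ℚᵘₚ.*-congˡ {ℚ.toℚᵘ q} (ℚₚ.toℚᵘ-fromℚᵘ (ℚᵘ.mkℚᵘ (ℚ.↧ q) 0)) ⟩
  ℚ.toℚᵘ q ℚᵘ.* ℚᵘ.mkℚᵘ (ℚ.↧ q) 0      ≈⟨ ℚᵘ.*≡* (cancel p (ℚ.↧ q)) ⟩
  ℚᵘ.mkℚᵘ p 0                          ≈⟨ ℚₚ.toℚᵘ-fromℚᵘ (ℚᵘ.mkℚᵘ p 0) ⟨
  ℚ.toℚᵘ (ι p)                         ∎)
  where
  open ℚᵘₚ.≃-Reasoning
  cancel : ∀ p m → p ℤ.* m ℤ.* ℤ.+ 1 ≡ p ℤ.* (m ℤ.* ℤ.+ 1)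
  cancel p m = ℤₚ.*-assoc p m (ℤ.+ 1)

-- Infinite descent: every term of the sequence is divisible by the denominator of the ratio.
geometric-ratio-integer : ∀ q (s : ℕ → ℤ) → (∀ k → ι (s (suc k)) ≡ q ℚ.* ι (s k)) → s 0 ≢ ℤ.+ 0 → IsInteger q
geometric-ratio-integer q s geometric s₀≢0 = descend s geometric s₀≢0 (<-wellFounded _)
  where
  descend : ∀ s → (∀ k → ι (s (suc k)) ≡ q ℚ.* ι (s k)) → s 0 ≢ ℤ.+ 0 → Acc ℕ._<_ ℤ.∣ s 0 ∣ → IsInteger q
  descend s geometric s₀≢0 (acc smaller) with ℚ.denominator-1 q in den≡
  ... | zero  = ℚ.↥ q , sym
    (trans (ℚₚ./-cong {ℚ.↥ q} {1} {ℚ.↥ q} {suc (ℚ.denominator-1 q)} refl (cong suc (sym den≡)))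
    (ℚₚ.↥p/↧p≡p q))
  -- The quotients by the denominator m form a sequence with the same ratio; as m ≥ 2, its first
  -- term is strictly smaller in absolute value and still non-zero.
  ... | suc d = descend e e-geometric e₀≢0 (smaller e₀<s₀)
    where
    m = ℚ.↧ q

    2≤m : 2 ℕ.≤ ℚ.↧ₙ q
    2≤m = subst (λ k → 2 ℕ.≤ suc k) (sym den≡) (ℕ.s≤s (ℕ.s≤s ℕ.z≤n))

    step : ∀ k → s (suc k) ℤ.* m ≡ ℚ.↥ q ℤ.* s k
    step k = ι-injective (begin
      ι (s (suc k) ℤ.* m)            ≡⟨ ι-* (s (suc k)) m ⟩
      ι (s (suc k)) ℚ.* ι m          ≡⟨ cong (ℚ._* ι m) (geometric k) ⟩
      q ℚ.* ι (s k) ℚ.* ι m          ≡⟨ swap q (ι (s k)) (ι m) ⟩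
      q ℚ.* ι m ℚ.* ι (s k)          ≡⟨ cong (ℚ._* ι (s k)) (clear-denominator q) ⟩
      ι (ℚ.↥ q) ℚ.* ι (s k)          ≡⟨ ι-* (ℚ.↥ q) (s k) ⟨
      ι (ℚ.↥ q ℤ.* s k)              ∎)
      where
      open ≡-Reasoning
      swap : ∀ a b c → a ℚ.* b ℚ.* c ≡ a ℚ.* c ℚ.* b
      swap = solve-∀ ℚ-ring

    coprime : ∀ r → Coprime.Coprime (ℚ.↧ₙ r) ℤ.∣ ℚ.↥ r ∣
    coprime (mkℚ _ _ c) = Coprime.sym (Coprime.recompute c)

    m∣s : ∀ k → m ℤ-Div.∣ s k
    m∣s k = ℤ-Div.∣ᵤ⇒∣ (ℤ-Coprime.coprime-divisor m (ℚ.↥ q) (s k) (coprime q)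
      (ℤ-Div.∣⇒∣ᵤ (ℤ-Div.divides (s (suc k)) (sym (step k)))))

    e : ℕ → ℤ
    e k = ℤ-Div.quotient (m∣s k)

    s≡e*m : ∀ k → s k ≡ e k ℤ.* m
    s≡e*m k = ℤ-Div._∣_.equality (m∣s k)

    e-geometric : ∀ k → ι (e (suc k)) ≡ q ℚ.* ι (e k)
    e-geometric k = ℚ-cancel (begin
      ι (e (suc k)) ℚ.* ι m       ≡⟨ ι-* (e (suc k)) m ⟨
      ι (e (suc k) ℤ.* m)         ≡⟨ cong ι (s≡e*m (suc k)) ⟨
      ι (s (suc k))               ≡⟨ geometric k ⟩
      q ℚ.* ι (s k)               ≡⟨ cong (λ z → q ℚ.* ι z) (s≡e*m k) ⟩
      q ℚ.* ι (e k ℤ.* m)         ≡⟨ cong (q ℚ.*_) (ι-* (e k) m) ⟩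
      q ℚ.* (ι (e k) ℚ.* ι m)     ≡⟨ ℚₚ.*-assoc q (ι (e k)) (ι m) ⟨
      q ℚ.* ι (e k) ℚ.* ι m       ∎)
      where
      open ≡-Reasoning
      0<m : 0ℚ ℚ.< ι m
      0<m = ι-mono-< {ℤ.+ 0} {m} (ℤ.+<+ (ℕ.s≤s ℕ.z≤n))
      ℚ-cancel : ∀ {x y} → x ℚ.* ι m ≡ y ℚ.* ι m → x ≡ y
      ℚ-cancel {x} {y} eq = ℚₚ.≤-antisym
        (ℚₚ.*-cancelʳ-≤-pos (ι m) {{ℚ.positive 0<m}} (ℚₚ.≤-reflexive eq))
        (ℚₚ.*-cancelʳ-≤-pos (ι m) {{ℚ.positive 0<m}} (ℚₚ.≤-reflexive (sym eq)))

    e₀≢0 : e 0 ≢ ℤ.+ 0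
    e₀≢0 e₀≡0 = s₀≢0 (trans (s≡e*m 0) (cong (ℤ._* m) e₀≡0))

    e₀<s₀ : ℤ.∣ e 0 ∣ ℕ.< ℤ.∣ s 0 ∣
    e₀<s₀ = subst (ℤ.∣ e 0 ∣ ℕ.<_) (sym (trans (cong ℤ.∣_∣ (s≡e*m 0)) (ℤₚ.abs-* (e 0) m)))
      (ℕₚ.m<m*n ℤ.∣ e 0 ∣ (ℚ.↧ₙ q) {{ℕ.≢-nonZero (e₀≢0 ∘ ℤₚ.∣i∣≡0⇒i≡0)}} 2≤m)

denominator-pos : ∀ q → 0ℚ ℚ.< ι (ℚ.↧ q)
denominator-pos q = ι-mono-< {ℤ.+ 0} {ℚ.↧ q} (ℤ.+<+ (ℕ.s≤s ℕ.z≤n))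

-- The hypotheses say that f 0 · qᵏ is an integer for all k, that is, the powers of q have a common
-- denominator.
bounded-denominator : ∀ q (f : ℕ → ℚ) → (∀ k → f (suc k) ≡ q ℚ.* f k) → 0ℚ ℚ.< f 0 →
  (∀ k → IsInteger (f k)) → IsInteger q
bounded-denominator q f geometric f₀>0 f-int = geometric-ratio-integer q s
  (λ k → trans (sym (f≡s (suc k))) (trans (geometric k) (cong (q ℚ.*_) (f≡s k))))
  (λ s₀≡0 → ℚₚ.<-irrefl refl (subst (0ℚ ℚ.<_) (trans (f≡s 0) (cong ι s₀≡0)) f₀>0))
  where
  s : ℕ → ℤ
  s k = proj₁ (f-int k)
  f≡s : ∀ k → f k ≡ ι (s k)
  f≡s k = proj₂ (f-int k)

-- The denominator of q clears all powers of q: its product with q is the numerator, and every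
-- further pair of factors q contributes the integer q².
square-integer : ∀ q → IsInteger (q ℚ.* q) → IsInteger q
square-integer q q²-int = bounded-denominator q f (λ _ → refl) (denominator-pos q) f-int
  where
  f : ℕ → ℚ
  f zero    = ι (ℚ.↧ q)
  f (suc k) = q ℚ.* f k
  f-int : ∀ k → IsInteger (f k)
  f-int zero          = int-ι (ℚ.↧ q)
  f-int (suc zero)    = ℚ.↥ q , clear-denominator q
  f-int (suc (suc k)) = subst IsInteger (ℚₚ.*-assoc q q (f k)) (int-* q²-int (f-int k))

-- The ring of integers through trace and norm.

module _ {D : ℕ} where

  -- The subring ℤ[√D], in general smaller than the ring of integers. It contains the Pell units and
  -- serves to measure denominators.
  Lattice : K D → Set
  Lattice x = IsInteger (rat x) × IsInteger (irr x)

  lattice-0 : Lattice 0#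
  lattice-0 = int-ι (ℤ.+ 0) , int-ι (ℤ.+ 0)

  lattice-1 : Lattice 1#
  lattice-1 = int-ι (ℤ.+ 1) , int-ι (ℤ.+ 0)

  lattice-+ : ∀ {x y} → Lattice x → Lattice y → Lattice (x + y)
  lattice-+ (a , b) (c , d) = int-+ a c , int-+ b d

  lattice-neg : ∀ {x} → Lattice x → Lattice (- x)
  lattice-neg (a , b) = int-neg a , int-neg b

  lattice-* : ∀ {x y} → Lattice x → Lattice y → Lattice (x * y)
  lattice-* (a , b) (c , d) =
    int-+ (int-* a c) (int-* (int-ι (ℤ.+ D)) (int-* b d)) , int-+ (int-* a d) (int-* b c)

  lattice-fromℤ : ∀ n → Lattice (fromℤ n)
  lattice-fromℤ n = int-ι n , int-ι (ℤ.+ 0)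

  lattice-sum : ∀ {n} {x : Fin n → K D} → (∀ i → Lattice (x i)) → Lattice (sum x)
  lattice-sum {zero}  _ = lattice-0
  lattice-sum {suc n} x∈Λ = lattice-+ (x∈Λ zero) (lattice-sum (x∈Λ ∘ suc))

  norm-integer : ∀ {x} → Lattice x → IsInteger (norm x)
  norm-integer (a , b) = int-- (int-* a a) (int-* (int-ι (ℤ.+ D)) (int-* b b))

  -- By multiplicativity, N(c) N(x)ᵏ is the norm of an element of ℤ[√D], hence an integer for every
  -- k.
  norm-bounded-denominator : ∀ (c x : K D) → 0ℚ ℚ.< norm c → (∀ k → Lattice (c * x ^ k)) → IsInteger (norm x)
  norm-bounded-denominator c x 0<Nc c*xᵏ∈Λ =
    bounded-denominator (norm x) (λ k → norm (c * x ^ k)) geometric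
      (subst (λ y → 0ℚ ℚ.< norm y) (sym (*-identityʳ c)) 0<Nc) (λ k → norm-integer (c*xᵏ∈Λ k))
    where
    geometric : ∀ k → norm (c * x ^ suc k) ≡ norm x ℚ.* norm (c * x ^ k)
    geometric k = trans
      (cong norm (x∙yz≈y∙xz c x (x ^ k)))
      (norm-* x (c * x ^ k))

  -- For k ≤ n the product is (ez)ᵏ eⁿ⁻ᵏ.
  pow-lattice : ∀ (e z : K D) → Lattice e → Lattice (e * z) → ∀ n k → k ℕ.≤ n → Lattice (e ^ n * z ^ k)
  pow-lattice e z e∈Λ ez∈Λ zero    zero    _ = subst Lattice (sym (*-identityˡ 1#)) lattice-1
  pow-lattice e z e∈Λ ez∈Λ (suc n) zero    _ =
    subst Lattice (sym (*-assoc e (e ^ n) 1#)) (lattice-* e∈Λ (pow-lattice e z e∈Λ ez∈Λ n zero ℕ.z≤n))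
  pow-lattice e z e∈Λ ez∈Λ (suc n) (suc k) (ℕ.s≤s k≤n) =
    subst Lattice (wx∙yz≈wy∙xz e z (e ^ n) (z ^ k))
      (lattice-* ez∈Λ (pow-lattice e z e∈Λ ez∈Λ n k k≤n))

  norm-pow-pos : ∀ (e : K D) n → 0ℚ ℚ.< norm e → 0ℚ ℚ.< norm (e ^ n)
  norm-pow-pos e zero    0<Ne = subst (0ℚ ℚ.<_) (sym (rational (δ D))) (ℚₚ.positive⁻¹ 1ℚ)
    where
    rational : ∀ δ → 1ℚ ℚ.* 1ℚ ℚ.- δ ℚ.* (0ℚ ℚ.* 0ℚ) ≡ 1ℚ
    rational = solve-∀ ℚ-ring
  norm-pow-pos e (suc n) 0<Ne = subst (0ℚ ℚ.<_) (sym (norm-* e (e ^ n))) (*-pos 0<Ne (norm-pow-pos e n 0<Ne))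

  pow-+ : ∀ (z : K D) m n → z ^ (m ℕ.+ n) ≡ z ^ m * z ^ n
  pow-+ z zero    n = sym (*-identityˡ (z ^ n))
  pow-+ z (suc m) n = trans (cong (z *_) (pow-+ z m n)) (sym (*-assoc z (z ^ m) (z ^ n)))

  -- All powers of z, and of z + 1, lie in c⁻¹ℤ[√D] for a single c, so the powers of the two norms have
  -- bounded denominators.
  module _ (z : K D) (z∈𝒪 : z ∈𝒪) where
    private
      n = proj₁ z∈𝒪
      a = proj₁ (proj₂ z∈𝒪)
      root = proj₂ (proj₂ z∈𝒪)

      den : ℤ
      den = ℚ.↧ (rat z) ℤ.* ℚ.↧ (irr z)

      -- e clears the denominators of z, so eⁿ clears those of z⁰, ..., zⁿ. The monic equation then
      -- extends this to all higher powers without enlarging c.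
      e c : K D
      e = fromℤ den
      c = e ^ n

      e*z∈Λ : Lattice (e * z)
      e*z∈Λ = subst IsInteger
        (sym (trans (rational (δ D) (ι den) (rat z) (irr z))
        (cong (ℚ._* rat z) (ι-* (ℚ.↧ (rat z)) (ℚ.↧ (irr z))))))
                (subst IsInteger (swap₁ (rat z) (ι (ℚ.↧ (rat z))) (ι (ℚ.↧ (irr z))))
                  (int-* (ℚ.↥ (rat z) , clear-denominator (rat z)) (int-ι (ℚ.↧ (irr z)))))
            , subst IsInteger (sym
              (trans (irrational (ι den) (rat z) (irr z))
              (cong (ℚ._* irr z) (ι-* (ℚ.↧ (rat z)) (ℚ.↧ (irr z))))))
                (subst IsInteger (swap₂ (irr z) (ι (ℚ.↧ (rat z))) (ι (ℚ.↧ (irr z))))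
                  (int-* (ℚ.↥ (irr z) , clear-denominator (irr z)) (int-ι (ℚ.↧ (rat z)))))
        where
        rational : ∀ δ n a b → n ℚ.* a ℚ.+ δ ℚ.* (0ℚ ℚ.* b) ≡ n ℚ.* a
        rational = solve-∀ ℚ-ring
        irrational : ∀ n a b → n ℚ.* b ℚ.+ 0ℚ ℚ.* a ≡ n ℚ.* b
        irrational = solve-∀ ℚ-ring
        swap₁ : ∀ a p q → a ℚ.* p ℚ.* q ≡ p ℚ.* q ℚ.* a
        swap₁ = solve-∀ ℚ-ring
        swap₂ : ∀ b p q → b ℚ.* q ℚ.* p ≡ p ℚ.* q ℚ.* b
        swap₂ = solve-∀ ℚ-ring

      0<Nc : 0ℚ ℚ.< norm c
      0<Nc = norm-pow-pos e n (subst (0ℚ ℚ.<_) (sym (rational (δ D) (ι den))) (*-pos 0<den 0<den))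
        where
        0<den : 0ℚ ℚ.< ι den
        0<den = subst (0ℚ ℚ.<_) (sym (ι-* (ℚ.↧ (rat z)) (ℚ.↧ (irr z))))
          (*-pos (denominator-pos (rat z)) (denominator-pos (irr z)))
        rational : ∀ δ n → n ℚ.* n ℚ.- δ ℚ.* (0ℚ ℚ.* 0ℚ) ≡ n ℚ.* n
        rational = solve-∀ ℚ-ring

      zⁿ≡ : z ^ n ≡ - sum (λ i → fromℤ (a i) * z ^ toℕ i)
      zⁿ≡ = begin
        z ^ n               ≡⟨ x≈x+y-y (z ^ n) S ⟩
        z ^ n + S + - S     ≡⟨ cong (_+ - S) root ⟩
        0# + - S            ≡⟨ +-identityˡ (- S) ⟩
        - S                 ∎
        where
        open ≡-Reasoning
        S = sum (λ i → fromℤ (a i) * z ^ toℕ i)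

      reduce : ∀ m → c * z ^ (m ℕ.+ n) ≡ - sum (λ i → fromℤ (a i) * (c * z ^ (m ℕ.+ toℕ i)))
      reduce m = begin
        c * z ^ (m ℕ.+ n)                                              ≡⟨ cong (c *_) (pow-+ z m n) ⟩
        c * (z ^ m * z ^ n)                                            ≡⟨ cong (λ p → c * (z ^ m * p)) zⁿ≡ ⟩
        c * (z ^ m * - sum (λ i → fromℤ (a i) * z ^ toℕ i))
          ≡⟨ x∙y-z≈-xyz c (z ^ m) (sum (λ i → fromℤ (a i) * z ^ toℕ i)) ⟩
        - (c * z ^ m * sum (λ i → fromℤ (a i) * z ^ toℕ i))
          ≡⟨ cong -_ (*-distribˡ-sum (c * z ^ m) (λ i → fromℤ (a i) * z ^ toℕ i)) ⟩
        - sum (λ i → c * z ^ m * (fromℤ (a i) * z ^ toℕ i))            ≡⟨ cong -_ (sum-cong-≗ λ i → term i) ⟩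
        - sum (λ i → fromℤ (a i) * (c * z ^ (m ℕ.+ toℕ i)))            ∎
        where
        open ≡-Reasoning
        term : ∀ i → c * z ^ m * (fromℤ (a i) * z ^ toℕ i) ≡ fromℤ (a i) * (c * z ^ (m ℕ.+ toℕ i))
        term i = trans
          (wx∙yz≈y∙wxz c (z ^ m) (fromℤ (a i)) (z ^ toℕ i))
          (cong (λ p → fromℤ (a i) * (c * p)) (sym (pow-+ z m (toℕ i))))

      -- Raising m shifts the window of exponents m, ..., m + n by one. Only the top exponent is
      -- new, and `reduce` expresses it by the lower ones with integer coefficients.
      window : ∀ m j → j ℕ.≤ n → Lattice (c * z ^ (m ℕ.+ j))
      window zero    j j≤n = pow-lattice e z (lattice-fromℤ den) e*z∈Λ n j j≤n
      window (suc m) j j≤n with j ℕₚ.≟ n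
      ... | no j≢n   = subst (λ k → Lattice (c * z ^ k)) (ℕₚ.+-suc m j) (window m (suc j) (ℕₚ.≤∧≢⇒< j≤n j≢n))
      ... | yes refl = subst Lattice (sym (reduce (suc m)))
        (lattice-neg (lattice-sum λ i → lattice-* (lattice-fromℤ (a i))
          (subst (λ k → Lattice (c * z ^ k)) (ℕₚ.+-suc m (toℕ i)) (window m (suc (toℕ i)) (Finₚ.toℕ<n i)))))

      c*zᵏ∈Λ : ∀ k → Lattice (c * z ^ k)
      c*zᵏ∈Λ k = subst (λ j → Lattice (c * z ^ j)) (ℕₚ.+-identityʳ k) (window k 0 ℕ.z≤n)

      -- The extra factor zʲ is there for the induction: removing one factor z + 1 leaves the two
      -- exponents j + 1 and j.
      c*[z+1]ᵏ*zʲ∈Λ : ∀ k j → Lattice (c * ((z + 1#) ^ k * z ^ j))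
      c*[z+1]ᵏ*zʲ∈Λ zero    j = subst (λ y → Lattice (c * y)) (sym (*-identityˡ (z ^ j))) (c*zᵏ∈Λ j)
      c*[z+1]ᵏ*zʲ∈Λ (suc k) j = subst Lattice
        (collect-z+1 c z ((z + 1#) ^ k) (z ^ j))
        (lattice-+ (c*[z+1]ᵏ*zʲ∈Λ k (suc j)) (c*[z+1]ᵏ*zʲ∈Λ k j))

    𝒪⇒norm : IsInteger (norm z)
    𝒪⇒norm = norm-bounded-denominator c z 0<Nc c*zᵏ∈Λ

    -- The trace is N(z + 1) - N(z) - 1, so the norm argument is applied to z + 1 as well.
    𝒪⇒trace : IsInteger (rat z ℚ.+ rat z)
    𝒪⇒trace = subst IsInteger (trace (δ D) (rat z) (irr z))
      (int-- (int-- (norm-bounded-denominator c (z + 1#) 0<Nc λ k →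
        subst (λ y → Lattice (c * y)) (*-identityʳ ((z + 1#) ^ k)) (c*[z+1]ᵏ*zʲ∈Λ k 0)) 𝒪⇒norm) (int-ι (ℤ.+ 1)))
      where
      trace : ∀ δ a b →
        (a ℚ.+ 1ℚ) ℚ.* (a ℚ.+ 1ℚ) ℚ.- δ ℚ.* ((b ℚ.+ 0ℚ) ℚ.* (b ℚ.+ 0ℚ)) ℚ.-
        (a ℚ.* a ℚ.- δ ℚ.* (b ℚ.* b)) ℚ.- 1ℚ ≡ a ℚ.+ a
      trace = solve-∀ ℚ-ring

  -- z is a root of X² - Tr(z) X + N(z). Together with `𝒪⇒trace` and `𝒪⇒norm` this allows
  -- integrality of a product to be checked on two rational numbers, without constructing its
  -- equation from those of the factors.
  trace∧norm⇒𝒪 : (z : K D) → IsInteger (rat z ℚ.+ rat z) → IsInteger (norm z) → z ∈𝒪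
  trace∧norm⇒𝒪 z (t , t≡) (m , m≡) = 2 , coefficient , (begin
    z * (z * 1#) + (fromℤ m * 1# + (fromℤ (ℤ.- t) * (z * 1#) + 0#))
      ≡⟨ cong₂ (λ p q → z * (z * 1#) + (p * 1# + (q * (z * 1#) + 0#))) fromℤ-m fromℤ-t ⟩
    z * (z * 1#) + (z * τ z * 1# + (- (z + τ z) * (z * 1#) + 0#))
      ≡⟨ minimal-polynomial z (τ z) ⟩
    0# ∎)
    where
    open ≡-Reasoning
    coefficient : Fin 2 → ℤ
    coefficient zero    = m
    coefficient (suc _) = ℤ.- t
    fromℤ-m : fromℤ m ≡ z * τ z
    fromℤ-m = trans (cong scalar (sym m≡)) (sym (scalar-τ-norm z))
    fromℤ-t : fromℤ (ℤ.- t) ≡ - (z + τ z)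
    fromℤ-t = trans (fromℤ-neg t) (cong -_ (K-cong (sym t≡) (sym (ℚₚ.+-inverseʳ (irr z)))))

  -- The quantity is the trace of √D z. Its square equals D (Tr(z)² - 4 N(z)), an integer.
  irrational-part-integer : ∀ {z : K D} → z ∈𝒪 → IsInteger (δ D ℚ.* (irr z ℚ.+ irr z))
  irrational-part-integer {z} z∈𝒪 = square-integer _ (subst IsInteger (identity (δ D) (rat z) (irr z))
    (int-* (int-ι (ℤ.+ D)) (int-- (int-* t t) (int-* (int-ι (ℤ.+ 4)) (𝒪⇒norm z z∈𝒪)))))
    where
    t = 𝒪⇒trace z z∈𝒪
    identity : ∀ δ a b → δ ℚ.* ((a ℚ.+ a) ℚ.* (a ℚ.+ a) ℚ.- ι (ℤ.+ 4) ℚ.* (a ℚ.* a ℚ.- δ ℚ.* (b ℚ.* b))) ≡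
      δ ℚ.* (b ℚ.+ b) ℚ.* (δ ℚ.* (b ℚ.+ b))
    identity = solve-∀ ℚ-ring

  -- For x = m + n√D the trace of xz is m Tr(z) + n Tr(√D z); the norm is multiplicative.
  lattice-*-𝒪 : ∀ {x z : K D} → Lattice x → z ∈𝒪 → x * z ∈𝒪
  lattice-*-𝒪 {x} {z} x∈Λ z∈𝒪 = trace∧norm⇒𝒪 (x * z)
    (subst IsInteger (identity (δ D) (rat x) (irr x) (rat z) (irr z))
      (int-+ (int-* (proj₁ x∈Λ) (𝒪⇒trace z z∈𝒪)) (int-* (proj₂ x∈Λ) (irrational-part-integer z∈𝒪))))
    (subst IsInteger (sym (norm-* x z)) (int-* (norm-integer x∈Λ) (𝒪⇒norm z z∈𝒪)))
    where
    identity : ∀ δ x y a b → x ℚ.* (a ℚ.+ a) ℚ.+ y ℚ.* (δ ℚ.* (b ℚ.+ b)) ≡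
      x ℚ.* a ℚ.+ δ ℚ.* (y ℚ.* b) ℚ.+ (x ℚ.* a ℚ.+ δ ℚ.* (y ℚ.* b))
    identity = solve-∀ ℚ-ring

  square-zero : ∀ p → p ℚ.* p ≡ 0ℚ → p ≡ 0ℚ
  square-zero p p²≡0 with ℚₚ.<-cmp p 0ℚ
  ... | tri≈ _ p≡0 _ = p≡0
  ... | tri> _ _ 0<p = ⊥-elim (ℚₚ.<-irrefl (sym p²≡0) (*-pos 0<p 0<p))
  ... | tri< p<0 _ _ = ⊥-elim
    (ℚₚ.<-irrefl (sym p²≡0)
    (subst (0ℚ ℚ.<_) (sign p) (*-pos (ℚₚ.neg-antimono-< p<0) (ℚₚ.neg-antimono-< p<0))))
    where
    sign : ∀ p → (ℚ.- p) ℚ.* (ℚ.- p) ≡ p ℚ.* p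
    sign = solve-∀ ℚ-ring

  size-zero : 0ℚ ℚ.< δ D → ∀ (z : K D) → size z ℚ.≤ 0ℚ → z ≡ 0#
  size-zero 0<δ z size≤0 = K-cong (square-zero (rat z) a²≡0) (square-zero (irr z) b²≡0)
    where
    a² = rat z ℚ.* rat z
    δb² = δ D ℚ.* (irr z ℚ.* irr z)
    0≤δb² : 0ℚ ℚ.≤ δb²
    0≤δb² = *-nonNeg (δ-nonNeg {D}) (square-nonNeg (irr z))
    a²≡0 : a² ≡ 0ℚ
    a²≡0 = ℚₚ.≤-antisym (ℚₚ.≤-trans (≤-by {r = δb²} 0≤δb² refl) size≤0) (square-nonNeg (rat z))
    b²≡0 : irr z ℚ.* irr z ≡ 0ℚ
    b²≡0 = ℚₚ.≤-antisym (*-cancelˡ-≤ 0<δ (subst (δb² ℚ.≤_) (sym (ℚₚ.*-zeroʳ (δ D)))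
      (ℚₚ.≤-trans (≤-by {r = a²} (square-nonNeg (rat z)) (ℚₚ.+-comm a² δb²)) size≤0))) (square-nonNeg (irr z))

  -- 2 size(z) is the trace of z².
  𝒪-size-gap : 0ℚ ℚ.< δ D → ∀ {z : K D} → z ∈𝒪 → 2ℚ ℚ.* size z ℚ.< 1ℚ → z ≡ 0#
  𝒪-size-gap 0<δ {z} z∈𝒪 small =
    size-zero 0<δ z (*-cancelˡ-≤ (ℚₚ.positive⁻¹ 2ℚ)
    (subst₂ ℚ._≤_ (sym (proj₂ trace²)) (sym (ℚₚ.*-zeroʳ 2ℚ))
    (ι-mono-≤ {proj₁ trace²} {ℤ.+ 0} (below-one (ι-cancel-< (subst (ℚ._< 1ℚ) (proj₂ trace²) small))))))
    where
    trace² : IsInteger (2ℚ ℚ.* size z)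
    trace² = subst IsInteger (identity (δ D) (rat z) (irr z))
      (int-- (int-* t t) (int-* (int-ι (ℤ.+ 2)) (𝒪⇒norm z z∈𝒪)))
      where
      t = 𝒪⇒trace z z∈𝒪
      identity : ∀ δ a b → (a ℚ.+ a) ℚ.* (a ℚ.+ a) ℚ.- ι (ℤ.+ 2) ℚ.* (a ℚ.* a ℚ.- δ ℚ.* (b ℚ.* b)) ≡
        2ℚ ℚ.* (a ℚ.* a ℚ.+ δ ℚ.* (b ℚ.* b))
      identity = solve-∀ ℚ-ring
    below-one : ∀ {i} → i ℤ.< ℤ.+ 1 → i ℤ.≤ ℤ.+ 0
    below-one = ℤₚ.i<j⇒i≤pred[j]

-- Pell's equation by way of Conway's river.

ℤ-square-nonNeg : ∀ i → ℤ.+ 0 ℤ.≤ i ℤ.* i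
ℤ-square-nonNeg i = ι-cancel-≤ (subst (0ℚ ℚ.≤_) (sym (ι-* i i)) (square-nonNeg (ι i)))

0≤i∧i≤n⇒∣i∣≤n : ∀ {i n} → ℤ.+ 0 ℤ.≤ i → i ℤ.≤ ℤ.+ n → ℤ.∣ i ∣ ℕ.≤ n
0≤i∧i≤n⇒∣i∣≤n {i} 0≤i i≤n = ℤₚ.drop‿+≤+ (subst (ℤ._≤ _) (sym (ℤₚ.0≤i⇒+∣i∣≡i 0≤i)) i≤n)

∣i∣≡1⇒i≡±1 : ∀ i → ℤ.∣ i ∣ ≡ 1 → i ≡ ℤ.+ 1 ⊎ i ≡ ℤ.- ℤ.+ 1
∣i∣≡1⇒i≡±1 (ℤ.+ _)      refl = inj₁ refl
∣i∣≡1⇒i≡±1 ℤ.-[1+ _ ]   refl = inj₂ refl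

n≤n*n : ∀ n → n ℕ.≤ n ℕ.* n
n≤n*n zero    = ℕ.z≤n
n≤n*n (suc n) = ℕₚ.m≤m*n (suc n) (suc n)

∣i∣≤n⇒0≤i+n : ∀ i {n} → ℤ.∣ i ∣ ℕ.≤ n → ℤ.+ 0 ℤ.≤ i ℤ.+ ℤ.+ n
∣i∣≤n⇒0≤i+n (ℤ.+ m)     _   = ℤ.+≤+ ℕ.z≤n
∣i∣≤n⇒0≤i+n ℤ.-[1+ m ] {n} m<n = subst (ℤ.+ 0 ℤ.≤_) (sym (ℤₚ.⊖-≥ m<n)) (ℤ.+≤+ ℕ.z≤n)

module Pell (D : ℕ) (nonsquare : ∀ m → m ℕ.* m ≢ D) where

  D≢0 : D ≢ 0
  D≢0 D≡0 = nonsquare 0 (sym D≡0)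

  -- Otherwise m/n would be a rational square root of D, an integer by `square-integer`.
  ratio-irrational : ∀ m n → ℤ.+ 1 ℤ.≤ n → m ℤ.* m ≢ ℤ.+ D ℤ.* (n ℤ.* n)
  ratio-irrational m n 1≤n m²≡Dn² =
    nonsquare ℤ.∣ k ∣ (trans (sym (ℤₚ.abs-* k k)) (cong ℤ.∣_∣ (ι-injective {k ℤ.* k} {ℤ.+ D} (begin
    ι (k ℤ.* k)       ≡⟨ ι-* k k ⟩
    ι k ℚ.* ι k       ≡⟨ cong₂ ℚ._*_ (sym x≡k) (sym x≡k) ⟩
    x ℚ.* x           ≡⟨ x²≡D ⟩
    δ D               ∎))))
    where
    open ≡-Reasoning
    instance
      n>0 : ℚ.Positive (ι n)
      n>0 = ℚ.positive (ι-mono-< {ℤ.+ 0} {n} (ℤₚ.suc[i]≤j⇒i<j 1≤n))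
      n≢0 : ℚ.NonZero (ι n)
      n≢0 = ℚₚ.pos⇒nonZero (ι n)
    n⁻¹ = ℚ.1/ ι n
    x = ι m ℚ.* n⁻¹
    x²≡D : x ℚ.* x ≡ δ D
    x²≡D = begin
      ι m ℚ.* n⁻¹ ℚ.* (ι m ℚ.* n⁻¹)                     ≡⟨ regroup (ι m) n⁻¹ ⟩
      ι m ℚ.* ι m ℚ.* (n⁻¹ ℚ.* n⁻¹)
        ≡⟨ cong (ℚ._* (n⁻¹ ℚ.* n⁻¹))
          (trans (sym (ι-* m m))
          (trans (cong ι m²≡Dn²) (trans (ι-* (ℤ.+ D) (n ℤ.* n)) (cong (δ D ℚ.*_) (ι-* n n))))) ⟩
      δ D ℚ.* (ι n ℚ.* ι n) ℚ.* (n⁻¹ ℚ.* n⁻¹)           ≡⟨ regroup′ (δ D) (ι n) n⁻¹ ⟩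
      δ D ℚ.* ((ι n ℚ.* n⁻¹) ℚ.* (ι n ℚ.* n⁻¹))
        ≡⟨ cong (λ u → δ D ℚ.* (u ℚ.* u)) (ℚₚ.*-inverseʳ (ι n)) ⟩
      δ D ℚ.* (1ℚ ℚ.* 1ℚ)                               ≡⟨ ℚₚ.*-identityʳ (δ D) ⟩
      δ D                                               ∎
      where
      regroup : ∀ m n → m ℚ.* n ℚ.* (m ℚ.* n) ≡ m ℚ.* m ℚ.* (n ℚ.* n)
      regroup = solve-∀ ℚ-ring
      regroup′ : ∀ d m n → d ℚ.* (m ℚ.* m) ℚ.* (n ℚ.* n) ≡ d ℚ.* ((m ℚ.* n) ℚ.* (m ℚ.* n))
      regroup′ = solve-∀ ℚ-ring
    x-int : IsInteger x
    x-int = square-integer x (ℤ.+ D , x²≡D)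
    k = proj₁ x-int
    x≡k = proj₂ x-int

  d : ℤ
  d = ℤ.+ D

  -- A ℤ-basis α = p + q√D, β = r + s√D of ℤ[√D] with N(α) > 0 > N(β).
  record Basis : Set where
    field
      p q r s : ℤ
      det : p ℤ.* s ℤ.- q ℤ.* r ≡ ℤ.+ 1
      1≤p : ℤ.+ 1 ℤ.≤ p
      0≤q : ℤ.+ 0 ℤ.≤ q
      0≤r : ℤ.+ 0 ℤ.≤ r
      1≤s : ℤ.+ 1 ℤ.≤ s
      Nα>0 : ℤ.+ 0 ℤ.< p ℤ.* p ℤ.- d ℤ.* (q ℤ.* q)
      Nβ<0 : ℤ.+ 0 ℤ.< d ℤ.* (s ℤ.* s) ℤ.- r ℤ.* r

    -- N(Xα + Yβ) = aX² + 2bXY - cY², so a, b and c describe the norm form in the given basis.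
    -- `total` measures how far down the river the basis lies.
    a b c total : ℤ
    a = p ℤ.* p ℤ.- d ℤ.* (q ℤ.* q)
    b = p ℤ.* r ℤ.- d ℤ.* (q ℤ.* s)
    c = d ℤ.* (s ℤ.* s) ℤ.- r ℤ.* r
    total = p ℤ.+ q ℤ.+ (r ℤ.+ s)

    -- A unimodular change of basis preserves the discriminant. As a and c are positive, both a and
    -- b² are bounded by D, which leaves finitely many shapes.
    b²+ac≡D : b ℤ.* b ℤ.+ a ℤ.* c ≡ d
    b²+ac≡D = begin
      b ℤ.* b ℤ.+ a ℤ.* c                                              ≡⟨ identity d p q r s ⟩
      d ℤ.* ((p ℤ.* s ℤ.- q ℤ.* r) ℤ.* (p ℤ.* s ℤ.- q ℤ.* r))          ≡⟨ cong (λ u → d ℤ.* (u ℤ.* u)) det ⟩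
      d ℤ.* (ℤ.+ 1 ℤ.* ℤ.+ 1)                                          ≡⟨ ℤₚ.*-identityʳ d ⟩
      d                                                                ∎
      where
      open ≡-Reasoning
      identity : ∀ d p q r s →
        (p ℤ.* r ℤ.- d ℤ.* (q ℤ.* s)) ℤ.* (p ℤ.* r ℤ.- d ℤ.* (q ℤ.* s)) ℤ.+
        (p ℤ.* p ℤ.- d ℤ.* (q ℤ.* q)) ℤ.* (d ℤ.* (s ℤ.* s) ℤ.- r ℤ.* r) ≡
        d ℤ.* ((p ℤ.* s ℤ.- q ℤ.* r) ℤ.* (p ℤ.* s ℤ.- q ℤ.* r))
      identity = ℤ-Ring.solve-∀

    0≤a : ℤ.+ 0 ℤ.≤ a
    0≤a = ℤₚ.<⇒≤ Nα>0

    a≤ac : a ℤ.≤ a ℤ.* c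
    a≤ac = subst (ℤ._≤ a ℤ.* c) (ℤₚ.*-identityʳ a)
      (ℤₚ.*-monoˡ-≤-nonNeg a {{ℤ.nonNegative 0≤a}} (ℤₚ.i<j⇒suc[i]≤j Nβ<0))

    ∣a∣≤D : ℤ.∣ a ∣ ℕ.≤ D
    ∣a∣≤D = 0≤i∧i≤n⇒∣i∣≤n 0≤a (begin
      a                        ≤⟨ a≤ac ⟩
      a ℤ.* c                  ≡⟨ ℤₚ.+-identityˡ (a ℤ.* c) ⟨
      ℤ.+ 0 ℤ.+ a ℤ.* c        ≤⟨ ℤₚ.+-monoˡ-≤ (a ℤ.* c) (ℤ-square-nonNeg b) ⟩
      b ℤ.* b ℤ.+ a ℤ.* c      ≡⟨ b²+ac≡D ⟩
      d                        ∎)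
      where open ℤₚ.≤-Reasoning

    ∣b∣≤D : ℤ.∣ b ∣ ℕ.≤ D
    ∣b∣≤D = ℕₚ.≤-trans (n≤n*n ℤ.∣ b ∣) (subst (ℕ._≤ D) (ℤₚ.abs-* b b) (0≤i∧i≤n⇒∣i∣≤n (ℤ-square-nonNeg b) (begin
      b ℤ.* b                  ≡⟨ ℤₚ.+-identityʳ (b ℤ.* b) ⟨
      b ℤ.* b ℤ.+ ℤ.+ 0        ≤⟨ ℤₚ.+-monoʳ-≤ (b ℤ.* b) (ℤₚ.≤-trans 0≤a a≤ac) ⟩
      b ℤ.* b ℤ.+ a ℤ.* c      ≡⟨ b²+ac≡D ⟩
      d                        ∎)))
      where open ℤₚ.≤-Reasoning

    0≤b+D : ℤ.+ 0 ℤ.≤ b ℤ.+ d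
    0≤b+D = ∣i∣≤n⇒0≤i+n b ∣b∣≤D

    ∣b+D∣≤D+D : ℤ.∣ b ℤ.+ d ∣ ℕ.≤ D ℕ.+ D
    ∣b+D∣≤D+D = ℕₚ.≤-trans (ℤₚ.∣i+j∣≤∣i∣+∣j∣ b d) (ℕₚ.+-monoˡ-≤ D ∣b∣≤D)

    -- The pair (a, b) as an element of a finite set; b may be negative and is shifted by D into the
    -- range from 0 to 2D.
    code : Fin (suc D ℕ.* suc (D ℕ.+ D))
    code = combine (fromℕ< (ℕ.s≤s ∣a∣≤D)) (fromℕ< (ℕ.s≤s ∣b+D∣≤D+D))

    -- Here κ = τ(α)β, which equals b + √D because the determinant is 1, and aβ = ατ(α)β = ακ. The
    -- quotient β/α = κ/a therefore depends on a and b only. This is the rational part;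
    -- `aβ≡ακ-irrational` is the other one.
    aβ≡ακ-rational : a ℤ.* r ≡ p ℤ.* b ℤ.+ d ℤ.* q
    aβ≡ακ-rational = trans (identity d p q r s)
      (trans (cong (λ u → p ℤ.* b ℤ.+ d ℤ.* (q ℤ.* u)) det)
      (cong (λ u → p ℤ.* b ℤ.+ d ℤ.* u) (ℤₚ.*-identityʳ q)))
      where
      identity : ∀ d p q r s → (p ℤ.* p ℤ.- d ℤ.* (q ℤ.* q)) ℤ.* r ≡
        p ℤ.* (p ℤ.* r ℤ.- d ℤ.* (q ℤ.* s)) ℤ.+ d ℤ.* (q ℤ.* (p ℤ.* s ℤ.- q ℤ.* r))
      identity = ℤ-Ring.solve-∀

    aβ≡ακ-irrational : a ℤ.* s ≡ q ℤ.* b ℤ.+ p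
    aβ≡ακ-irrational = trans (identity d p q r s)
      (trans (cong (λ u → q ℤ.* b ℤ.+ p ℤ.* u) det) (cong (λ u → q ℤ.* b ℤ.+ u) (ℤₚ.*-identityʳ p)))
      where
      identity : ∀ d p q r s → (p ℤ.* p ℤ.- d ℤ.* (q ℤ.* q)) ℤ.* s ≡
        q ℤ.* (p ℤ.* r ℤ.- d ℤ.* (q ℤ.* s)) ℤ.+ p ℤ.* (p ℤ.* s ℤ.- q ℤ.* r)
      identity = ℤ-Ring.solve-∀

  open Basis

  code-injective : ∀ x y → code x ≡ code y → a x ≡ a y × b x ≡ b y
  code-injective x y eq = a≡a , trans (sym (cancel (b x) d)) (trans (cong (ℤ._- d) b+D≡b+D) (cancel (b y) d))
    where
    cancel : ∀ m n → m ℤ.+ n ℤ.- n ≡ m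
    cancel = ℤ-Ring.solve-∀
    split = Finₚ.combine-injective (fromℕ< (ℕ.s≤s (∣a∣≤D x))) _ (fromℕ< (ℕ.s≤s (∣a∣≤D y))) _ eq
    a≡a : a x ≡ a y
    a≡a = trans (sym (ℤₚ.0≤i⇒+∣i∣≡i (0≤a x)))
      (trans (cong ℤ.+_ (Finₚ.fromℕ<-injective _ _ _ _ (proj₁ split))) (ℤₚ.0≤i⇒+∣i∣≡i (0≤a y)))
    b+D≡b+D : b x ℤ.+ d ≡ b y ℤ.+ d
    b+D≡b+D = trans (sym (ℤₚ.0≤i⇒+∣i∣≡i (0≤b+D x)))
      (trans (cong ℤ.+_ (Finₚ.fromℕ<-injective _ _ _ _ (proj₂ split))) (ℤₚ.0≤i⇒+∣i∣≡i (0≤b+D y)))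

  -- The basis 1, √D, with norms 1 and -D.
  initial : Basis
  initial = record
    { p = ℤ.+ 1 ; q = ℤ.+ 0 ; r = ℤ.+ 0 ; s = ℤ.+ 1 ; det = refl
    ; 1≤p = ℤₚ.≤-refl ; 0≤q = ℤₚ.≤-refl ; 0≤r = ℤₚ.≤-refl ; 1≤s = ℤₚ.≤-refl
    ; Nα>0 = subst (ℤ.+ 0 ℤ.<_) (sym (Nα d)) (ℤ.+<+ (ℕ.s≤s ℕ.z≤n))
    ; Nβ<0 = subst (ℤ.+ 0 ℤ.<_) (sym (Nβ d)) (ℤ.+<+ (ℕₚ.n≢0⇒n>0 D≢0)) }
    where
    Nα : ∀ d → ℤ.+ 1 ℤ.* ℤ.+ 1 ℤ.- d ℤ.* (ℤ.+ 0 ℤ.* ℤ.+ 0) ≡ ℤ.+ 1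
    Nα = ℤ-Ring.solve-∀
    Nβ : ∀ d → d ℤ.* (ℤ.+ 1 ℤ.* ℤ.+ 1) ℤ.- ℤ.+ 0 ℤ.* ℤ.+ 0 ≡ d
    Nβ = ℤ-Ring.solve-∀

  -- A step along Conway's river of x² − Dy².
  step : (x : Basis) → Σ[ y ∈ Basis ] total x ℤ.< total y
  -- α + β replaces whichever of α and β has norm of the same sign, so the new pair again has norms
  -- of opposite signs. Norm 0 is excluded by irrationality.
  step x with ℤₚ.<-cmp (ℤ.+ 0) ((p x ℤ.+ r x) ℤ.* (p x ℤ.+ r x) ℤ.- d ℤ.* ((q x ℤ.+ s x) ℤ.* (q x ℤ.+ s x)))
  ... | tri≈ _ N≡0 _ = ⊥-elim
    (ratio-irrational (p x ℤ.+ r x) (q x ℤ.+ s x) (ℤₚ.+-mono-≤ (0≤q x) (1≤s x))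
    (ℤₚ.i-j≡0⇒i≡j _ _ (sym N≡0)))
  ... | tri< N>0 _ _ = record
    { p = p x ℤ.+ r x ; q = q x ℤ.+ s x ; r = r x ; s = s x
    ; det = trans (identity (p x) (q x) (r x) (s x)) (det x)
    ; 1≤p = ℤₚ.+-mono-≤ (1≤p x) (0≤r x)
    ; 0≤q = ℤₚ.+-mono-≤ (0≤q x) (ℤₚ.≤-trans (ℤ.+≤+ ℕ.z≤n) (1≤s x))
    ; 0≤r = 0≤r x ; 1≤s = 1≤s x
    ; Nα>0 = N>0 ; Nβ<0 = Nβ<0 x }
    , ℤₚ.+-monoˡ-< (r x ℤ.+ s x) (subst (p x ℤ.+ q x ℤ.<_) (total-identity (p x) (q x) (r x) (s x))
        (subst (ℤ._< p x ℤ.+ q x ℤ.+ (r x ℤ.+ s x)) (ℤₚ.+-identityʳ (p x ℤ.+ q x))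
          (ℤₚ.+-monoʳ-< (p x ℤ.+ q x) (ℤₚ.suc[i]≤j⇒i<j (ℤₚ.+-mono-≤ (0≤r x) (1≤s x))))))
    where
    identity : ∀ p q r s → (p ℤ.+ r) ℤ.* s ℤ.- (q ℤ.+ s) ℤ.* r ≡ p ℤ.* s ℤ.- q ℤ.* r
    identity = ℤ-Ring.solve-∀
    total-identity : ∀ p q r s → p ℤ.+ q ℤ.+ (r ℤ.+ s) ≡ p ℤ.+ r ℤ.+ (q ℤ.+ s)
    total-identity = ℤ-Ring.solve-∀
  ... | tri> _ _ N<0 = record
    { p = p x ; q = q x ; r = p x ℤ.+ r x ; s = q x ℤ.+ s x
    ; det = trans (identity (p x) (q x) (r x) (s x)) (det x)
    ; 1≤p = 1≤p x ; 0≤q = 0≤q x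
    ; 0≤r = ℤₚ.+-mono-≤ (ℤₚ.≤-trans (ℤ.+≤+ ℕ.z≤n) (1≤p x)) (0≤r x)
    ; 1≤s = ℤₚ.+-mono-≤ (0≤q x) (1≤s x)
    ; Nα>0 = Nα>0 x ; Nβ<0 = subst (ℤ.+ 0 ℤ.<_) (negate d (p x ℤ.+ r x) (q x ℤ.+ s x)) (ℤₚ.neg-mono-< N<0) }
    , ℤₚ.+-monoʳ-< (p x ℤ.+ q x) (subst (r x ℤ.+ s x ℤ.<_) (total-identity (p x) (q x) (r x) (s x))
        (subst (ℤ._< r x ℤ.+ s x ℤ.+ (p x ℤ.+ q x)) (ℤₚ.+-identityʳ (r x ℤ.+ s x))
          (ℤₚ.+-monoʳ-< (r x ℤ.+ s x) (ℤₚ.suc[i]≤j⇒i<j (ℤₚ.+-mono-≤ (1≤p x) (0≤q x))))))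
    where
    identity : ∀ p q r s → p ℤ.* (q ℤ.+ s) ℤ.- q ℤ.* (p ℤ.+ r) ≡ p ℤ.* s ℤ.- q ℤ.* r
    identity = ℤ-Ring.solve-∀
    total-identity : ∀ p q r s → r ℤ.+ s ℤ.+ (p ℤ.+ q) ≡ p ℤ.+ r ℤ.+ (q ℤ.+ s)
    total-identity = ℤ-Ring.solve-∀
    negate : ∀ d m n → ℤ.- (m ℤ.* m ℤ.- d ℤ.* (n ℤ.* n)) ≡ d ℤ.* (n ℤ.* n) ℤ.- m ℤ.* m
    negate = ℤ-Ring.solve-∀

  river : ℕ → Basis
  river zero    = initial
  river (suc k) = proj₁ (step (river k))

  total-increasing : ∀ {i j} → i ℕ.<′ j → total (river i) ℤ.< total (river j)
  total-increasing {i} ℕ.≤′-refl        = proj₂ (step (river i))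
  total-increasing {i} {suc j} (ℕ.≤′-step i<j) = ℤₚ.<-trans (total-increasing i<j) (proj₂ (step (river j)))

  -- If x and y span lattices of the same shape, then y = u x for the unit u = s·α(y) − q·β(y).
  module Automorphism (x y : Basis) (a≡a : a x ≡ a y) (b≡b : b x ≡ b y) where

    u v : ℤ
    u = s x ℤ.* p y ℤ.- q x ℤ.* r y
    v = s x ℤ.* q y ℤ.- q x ℤ.* s y

    instance
      a≢0 : ℤ.NonZero (a x)
      a≢0 = ℤ.>-nonZero (Nα>0 x)

    aβ-rational : a x ℤ.* r y ≡ p y ℤ.* b x ℤ.+ d ℤ.* q y
    aβ-rational = subst₂ (λ m n → m ℤ.* r y ≡ p y ℤ.* n ℤ.+ d ℤ.* q y) (sym a≡a) (sym b≡b) (aβ≡ακ-rational y)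

    aβ-irrational : a x ℤ.* s y ≡ q y ℤ.* b x ℤ.+ p y
    aβ-irrational = subst₂ (λ m n → m ℤ.* s y ≡ q y ℤ.* n ℤ.+ p y) (sym a≡a) (sym b≡b) (aβ≡ακ-irrational y)

    -- Rational part of β(y) α(x) = α(y) β(x): bases of the same shape have the same quotient β/α.
    -- The factor a clears the denominator of κ/a and is cancelled afterwards.
    ratio-rational : r y ℤ.* p x ℤ.+ d ℤ.* (s y ℤ.* q x) ≡ p y ℤ.* r x ℤ.+ d ℤ.* (q y ℤ.* s x)
    ratio-rational = ℤₚ.*-cancelˡ-≡ (a x) _ _ (begin
      a x ℤ.* (r y ℤ.* p x ℤ.+ d ℤ.* (s y ℤ.* q x))
        ≡⟨ expand d (a x) (r y) (p x) (s y) (q x) ⟩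
      (a x ℤ.* r y) ℤ.* p x ℤ.+ d ℤ.* ((a x ℤ.* s y) ℤ.* q x)
        ≡⟨ cong₂ (λ m n → m ℤ.* p x ℤ.+ d ℤ.* (n ℤ.* q x)) aβ-rational aβ-irrational ⟩
      (p y ℤ.* b x ℤ.+ d ℤ.* q y) ℤ.* p x ℤ.+ d ℤ.* ((q y ℤ.* b x ℤ.+ p y) ℤ.* q x)
        ≡⟨ exchange d (b x) (p x) (q x) (p y) (q y) ⟩
      p y ℤ.* (p x ℤ.* b x ℤ.+ d ℤ.* q x) ℤ.+ d ℤ.* (q y ℤ.* (q x ℤ.* b x ℤ.+ p x))
        ≡⟨ cong₂ (λ m n → p y ℤ.* m ℤ.+ d ℤ.* (q y ℤ.* n)) (aβ≡ακ-rational x) (aβ≡ακ-irrational x) ⟨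
      p y ℤ.* (a x ℤ.* r x) ℤ.+ d ℤ.* (q y ℤ.* (a x ℤ.* s x))
        ≡⟨ collect d (a x) (p y) (r x) (q y) (s x) ⟩
      a x ℤ.* (p y ℤ.* r x ℤ.+ d ℤ.* (q y ℤ.* s x)) ∎)
      where
      open ≡-Reasoning
      expand : ∀ d a r p s q → a ℤ.* (r ℤ.* p ℤ.+ d ℤ.* (s ℤ.* q)) ≡ (a ℤ.* r) ℤ.* p ℤ.+ d ℤ.* ((a ℤ.* s) ℤ.* q)
      expand = ℤ-Ring.solve-∀
      exchange : ∀ d b p q p′ q′ → (p′ ℤ.* b ℤ.+ d ℤ.* q′) ℤ.* p ℤ.+ d ℤ.* ((q′ ℤ.* b ℤ.+ p′) ℤ.* q) ≡
        p′ ℤ.* (p ℤ.* b ℤ.+ d ℤ.* q) ℤ.+ d ℤ.* (q′ ℤ.* (q ℤ.* b ℤ.+ p))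
      exchange = ℤ-Ring.solve-∀
      collect : ∀ d a p r q s → p ℤ.* (a ℤ.* r) ℤ.+ d ℤ.* (q ℤ.* (a ℤ.* s)) ≡
        a ℤ.* (p ℤ.* r ℤ.+ d ℤ.* (q ℤ.* s))
      collect = ℤ-Ring.solve-∀

    ratio-irrational-part : r y ℤ.* q x ℤ.+ s y ℤ.* p x ≡ p y ℤ.* s x ℤ.+ q y ℤ.* r x
    ratio-irrational-part = ℤₚ.*-cancelˡ-≡ (a x) _ _ (begin
      a x ℤ.* (r y ℤ.* q x ℤ.+ s y ℤ.* p x)
        ≡⟨ expand (a x) (r y) (q x) (s y) (p x) ⟩
      (a x ℤ.* r y) ℤ.* q x ℤ.+ (a x ℤ.* s y) ℤ.* p x
        ≡⟨ cong₂ (λ m n → m ℤ.* q x ℤ.+ n ℤ.* p x) aβ-rational aβ-irrational ⟩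
      (p y ℤ.* b x ℤ.+ d ℤ.* q y) ℤ.* q x ℤ.+ (q y ℤ.* b x ℤ.+ p y) ℤ.* p x
        ≡⟨ exchange d (b x) (p x) (q x) (p y) (q y) ⟩
      p y ℤ.* (q x ℤ.* b x ℤ.+ p x) ℤ.+ q y ℤ.* (p x ℤ.* b x ℤ.+ d ℤ.* q x)
        ≡⟨ cong₂ (λ m n → p y ℤ.* n ℤ.+ q y ℤ.* m) (aβ≡ακ-rational x) (aβ≡ακ-irrational x) ⟨
      p y ℤ.* (a x ℤ.* s x) ℤ.+ q y ℤ.* (a x ℤ.* r x)
        ≡⟨ collect (a x) (p y) (r x) (q y) (s x) ⟩
      a x ℤ.* (p y ℤ.* s x ℤ.+ q y ℤ.* r x) ∎)
      where
      open ≡-Reasoning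
      expand : ∀ a r q s p → a ℤ.* (r ℤ.* q ℤ.+ s ℤ.* p) ≡ (a ℤ.* r) ℤ.* q ℤ.+ (a ℤ.* s) ℤ.* p
      expand = ℤ-Ring.solve-∀
      exchange : ∀ d b p q p′ q′ → (p′ ℤ.* b ℤ.+ d ℤ.* q′) ℤ.* q ℤ.+ (q′ ℤ.* b ℤ.+ p′) ℤ.* p ≡
        p′ ℤ.* (q ℤ.* b ℤ.+ p) ℤ.+ q′ ℤ.* (p ℤ.* b ℤ.+ d ℤ.* q)
      exchange = ℤ-Ring.solve-∀
      collect : ∀ a p r q s → p ℤ.* (a ℤ.* s) ℤ.+ q ℤ.* (a ℤ.* r) ≡ a ℤ.* (p ℤ.* s ℤ.+ q ℤ.* r)
      collect = ℤ-Ring.solve-∀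

    -- Multiplying the unit s(x) α(y) - q(x) β(y) by α(x) and exchanging β(y) α(x) for α(y) β(x)
    -- gives α(y) (s(x) α(x) - q(x) β(x)). The bracket is the determinant, 1.
    uα-rational : u ℤ.* p x ℤ.+ d ℤ.* (v ℤ.* q x) ≡ p y
    uα-rational = begin
      u ℤ.* p x ℤ.+ d ℤ.* (v ℤ.* q x)
        ≡⟨ expand d (p x) (q x) (s x) (p y) (q y) (r y) (s y) ⟩
      s x ℤ.* (p y ℤ.* p x ℤ.+ d ℤ.* (q y ℤ.* q x)) ℤ.- q x ℤ.* (r y ℤ.* p x ℤ.+ d ℤ.* (s y ℤ.* q x))
        ≡⟨ cong (λ m → s x ℤ.* (p y ℤ.* p x ℤ.+ d ℤ.* (q y ℤ.* q x)) ℤ.- q x ℤ.* m) ratio-rational ⟩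
      s x ℤ.* (p y ℤ.* p x ℤ.+ d ℤ.* (q y ℤ.* q x)) ℤ.- q x ℤ.* (p y ℤ.* r x ℤ.+ d ℤ.* (q y ℤ.* s x))
        ≡⟨ collect d (p x) (q x) (r x) (s x) (p y) (q y) ⟩
      p y ℤ.* (p x ℤ.* s x ℤ.- q x ℤ.* r x)
        ≡⟨ trans (cong (p y ℤ.*_) (det x)) (ℤₚ.*-identityʳ (p y)) ⟩
      p y ∎
      where
      open ≡-Reasoning
      expand : ∀ d p q s p′ q′ r′ s′ → (s ℤ.* p′ ℤ.- q ℤ.* r′) ℤ.* p ℤ.+ d ℤ.* ((s ℤ.* q′ ℤ.- q ℤ.* s′) ℤ.* q) ≡
        s ℤ.* (p′ ℤ.* p ℤ.+ d ℤ.* (q′ ℤ.* q)) ℤ.- q ℤ.* (r′ ℤ.* p ℤ.+ d ℤ.* (s′ ℤ.* q))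
      expand = ℤ-Ring.solve-∀
      collect : ∀ d p q r s p′ q′ →
        s ℤ.* (p′ ℤ.* p ℤ.+ d ℤ.* (q′ ℤ.* q)) ℤ.- q ℤ.* (p′ ℤ.* r ℤ.+ d ℤ.* (q′ ℤ.* s)) ≡
        p′ ℤ.* (p ℤ.* s ℤ.- q ℤ.* r)
      collect = ℤ-Ring.solve-∀

    uα-irrational : u ℤ.* q x ℤ.+ v ℤ.* p x ≡ q y
    uα-irrational = begin
      u ℤ.* q x ℤ.+ v ℤ.* p x
        ≡⟨ expand (p x) (q x) (s x) (p y) (q y) (r y) (s y) ⟩
      s x ℤ.* (p y ℤ.* q x ℤ.+ q y ℤ.* p x) ℤ.- q x ℤ.* (r y ℤ.* q x ℤ.+ s y ℤ.* p x)
        ≡⟨ cong (λ m → s x ℤ.* (p y ℤ.* q x ℤ.+ q y ℤ.* p x) ℤ.- q x ℤ.* m) ratio-irrational-part ⟩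
      s x ℤ.* (p y ℤ.* q x ℤ.+ q y ℤ.* p x) ℤ.- q x ℤ.* (p y ℤ.* s x ℤ.+ q y ℤ.* r x)
        ≡⟨ collect (p x) (q x) (r x) (s x) (p y) (q y) ⟩
      q y ℤ.* (p x ℤ.* s x ℤ.- q x ℤ.* r x)
        ≡⟨ trans (cong (q y ℤ.*_) (det x)) (ℤₚ.*-identityʳ (q y)) ⟩
      q y ∎
      where
      open ≡-Reasoning
      expand : ∀ p q s p′ q′ r′ s′ → (s ℤ.* p′ ℤ.- q ℤ.* r′) ℤ.* q ℤ.+ (s ℤ.* q′ ℤ.- q ℤ.* s′) ℤ.* p ≡
        s ℤ.* (p′ ℤ.* q ℤ.+ q′ ℤ.* p) ℤ.- q ℤ.* (r′ ℤ.* q ℤ.+ s′ ℤ.* p)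
      expand = ℤ-Ring.solve-∀
      collect : ∀ p q r s p′ q′ → s ℤ.* (p′ ℤ.* q ℤ.+ q′ ℤ.* p) ℤ.- q ℤ.* (p′ ℤ.* s ℤ.+ q′ ℤ.* r) ≡
        q′ ℤ.* (p ℤ.* s ℤ.- q ℤ.* r)
      collect = ℤ-Ring.solve-∀

    -- α(y) is the unit times α(x), and the two have the same norm a ≠ 0, which cancels.
    unit-norm : u ℤ.* u ℤ.- d ℤ.* (v ℤ.* v) ≡ ℤ.+ 1
    unit-norm = ℤₚ.*-cancelˡ-≡ (a x) _ _ (begin
      a x ℤ.* (u ℤ.* u ℤ.- d ℤ.* (v ℤ.* v))
        ≡⟨ multiplicative d (p x) (q x) u v ⟩
      (u ℤ.* p x ℤ.+ d ℤ.* (v ℤ.* q x)) ℤ.* (u ℤ.* p x ℤ.+ d ℤ.* (v ℤ.* q x)) ℤ.- d ℤ.*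
        ((u ℤ.* q x ℤ.+ v ℤ.* p x) ℤ.* (u ℤ.* q x ℤ.+ v ℤ.* p x))
        ≡⟨ cong₂ (λ m n → m ℤ.* m ℤ.- d ℤ.* (n ℤ.* n)) uα-rational uα-irrational ⟩
      a y
        ≡⟨ a≡a ⟨
      a x
        ≡⟨ ℤₚ.*-identityʳ (a x) ⟨
      a x ℤ.* ℤ.+ 1 ∎)
      where
      open ≡-Reasoning
      multiplicative : ∀ d p q u v → (p ℤ.* p ℤ.- d ℤ.* (q ℤ.* q)) ℤ.* (u ℤ.* u ℤ.- d ℤ.* (v ℤ.* v)) ≡
        (u ℤ.* p ℤ.+ d ℤ.* (v ℤ.* q)) ℤ.* (u ℤ.* p ℤ.+ d ℤ.* (v ℤ.* q)) ℤ.- d ℤ.*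
          ((u ℤ.* q ℤ.+ v ℤ.* p) ℤ.* (u ℤ.* q ℤ.+ v ℤ.* p))
      multiplicative = ℤ-Ring.solve-∀

    -- If v = 0, the unit is ±1, and the sign is + because both first coordinates p are positive. So
    -- α(x) = α(y), and then aβ = ακ determines β as well.
    same-basis : v ≡ ℤ.+ 0 → total x ≡ total y
    same-basis v≡0 = cong₂ ℤ._+_ (cong₂ ℤ._+_ px≡py qx≡qy) (cong₂ ℤ._+_ rx≡ry sx≡sy)
      where
      open ≡-Reasoning
      py≡u*px : p y ≡ u ℤ.* p x
      py≡u*px = trans (sym uα-rational)
        (trans (cong (λ w → u ℤ.* p x ℤ.+ d ℤ.* (w ℤ.* q x)) v≡0) (identity d u (p x) (q x)))
        where
        identity : ∀ d u p q → u ℤ.* p ℤ.+ d ℤ.* (ℤ.+ 0 ℤ.* q) ≡ u ℤ.* p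
        identity = ℤ-Ring.solve-∀
      qy≡u*qx : q y ≡ u ℤ.* q x
      qy≡u*qx = trans (sym uα-irrational)
        (trans (cong (λ w → u ℤ.* q x ℤ.+ w ℤ.* p x) v≡0) (identity u (p x) (q x)))
        where
        identity : ∀ u p q → u ℤ.* q ℤ.+ ℤ.+ 0 ℤ.* p ≡ u ℤ.* q
        identity = ℤ-Ring.solve-∀
      ∣u∣≡1 : ℤ.∣ u ∣ ≡ 1
      ∣u∣≡1 = ℕₚ.m*n≡1⇒m≡1 ℤ.∣ u ∣ ℤ.∣ u ∣
        (trans (sym (ℤₚ.abs-* u u))
        (cong ℤ.∣_∣ (trans (sym (identity d u))
        (subst (λ w → u ℤ.* u ℤ.- d ℤ.* (w ℤ.* w) ≡ ℤ.+ 1) v≡0 unit-norm))))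
        where
        identity : ∀ d u → u ℤ.* u ℤ.- d ℤ.* (ℤ.+ 0 ℤ.* ℤ.+ 0) ≡ u ℤ.* u
        identity = ℤ-Ring.solve-∀
      u≡1 : u ≡ ℤ.+ 1
      u≡1 = [ id , (λ u≡-1 → ⊥-elim (ℤₚ.<-irrefl refl (ℤₚ.<-≤-trans (ℤₚ.suc[i]≤j⇒i<j (1≤p y))
        (subst (ℤ._≤ ℤ.+ 0) (sym (trans py≡u*px (trans (cong (ℤ._* p x) u≡-1) (ℤₚ.-1*i≡-i (p x)))))
          (ℤₚ.neg-mono-≤ (ℤₚ.≤-trans (ℤ.+≤+ ℕ.z≤n) (1≤p x))))))) ]′ (∣i∣≡1⇒i≡±1 u ∣u∣≡1)
      px≡py : p x ≡ p y
      px≡py = sym (trans py≡u*px (trans (cong (ℤ._* p x) u≡1) (ℤₚ.*-identityˡ (p x))))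
      qx≡qy : q x ≡ q y
      qx≡qy = sym (trans qy≡u*qx (trans (cong (ℤ._* q x) u≡1) (ℤₚ.*-identityˡ (q x))))
      rx≡ry : r x ≡ r y
      rx≡ry = ℤₚ.*-cancelˡ-≡ (a x) (r x) (r y) (begin
        a x ℤ.* r x                       ≡⟨ aβ≡ακ-rational x ⟩
        p x ℤ.* b x ℤ.+ d ℤ.* q x         ≡⟨ cong₂ (λ m n → m ℤ.* b x ℤ.+ d ℤ.* n) px≡py qx≡qy ⟩
        p y ℤ.* b x ℤ.+ d ℤ.* q y         ≡⟨ aβ-rational ⟨
        a x ℤ.* r y                       ∎)
      sx≡sy : s x ≡ s y
      sx≡sy = ℤₚ.*-cancelˡ-≡ (a x) (s x) (s y) (begin
        a x ℤ.* s x                       ≡⟨ aβ≡ακ-irrational x ⟩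
        q x ℤ.* b x ℤ.+ p x               ≡⟨ cong₂ (λ m n → n ℤ.* b x ℤ.+ m) px≡py qx≡qy ⟩
        q y ℤ.* b x ℤ.+ p y               ≡⟨ aβ-irrational ⟨
        a x ℤ.* s y                       ∎)

  module Repetition {i j : ℕ} (i<j : i ℕ.< j) (same-code : code (river i) ≡ code (river j)) where
    private
      same : a (river i) ≡ a (river j) × b (river i) ≡ b (river j)
      same = code-injective (river i) (river j) same-code
    open Automorphism (river i) (river j) (proj₁ same) (proj₂ same)

    -- `total` increases strictly along the river, so a repeated shape is never a repeated basis and
    -- the unit is not trivial.
    v≢0 : v ≢ ℤ.+ 0
    v≢0 v≡0 = ℤₚ.<-irrefl (same-basis v≡0) (total-increasing (ℕₚ.<⇒<′ i<j))

    solution : Σ[ x ∈ ℤ ] Σ[ y ∈ ℤ ] x ℤ.* x ℤ.- d ℤ.* (y ℤ.* y) ≡ ℤ.+ 1 × y ≢ ℤ.+ 0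
    solution = u , v , unit-norm , v≢0

  abstract
    pell : Σ[ x ∈ ℤ ] Σ[ y ∈ ℤ ] x ℤ.* x ℤ.- d ℤ.* (y ℤ.* y) ≡ ℤ.+ 1 × y ≢ ℤ.+ 0
    -- One more point of the river is considered than there are codes.
    pell = let i , j , i<j , same-code =
                 Finₚ.pigeonhole (ℕₚ.n<1+n (suc D ℕ.* suc (D ℕ.+ D))) (λ k → code (river (toℕ k)))
           in Repetition.solution i<j same-code

  -- Squaring x + y√D replaces x by x² + Dy² ≥ x² ≥ 2x > x once x ≥ 2. To start, y ≠ 0 gives x² = 1
  -- + Dy² ≥ 2, hence |x| ≥ 2.
  large-pell : ∀ n → Σ[ x ∈ ℤ ] Σ[ y ∈ ℤ ] x ℤ.* x ℤ.- d ℤ.* (y ℤ.* y) ≡ ℤ.+ 1 × ℤ.+ (2 ℕ.+ n) ℤ.≤ x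
  large-pell zero = ℤ.+ ℤ.∣ x ∣ , y , trans (cong (ℤ._- d ℤ.* (y ℤ.* y)) ∣x∣²≡x²)
    (proj₁ (proj₂ (proj₂ pell))) , ℤ.+≤+ (ℕₚ.≮⇒≥ not-small)
    where
    x = proj₁ pell
    y = proj₁ (proj₂ pell)
    ∣x∣²≡x² : ℤ.+ ℤ.∣ x ∣ ℤ.* ℤ.+ ℤ.∣ x ∣ ≡ x ℤ.* x
    ∣x∣²≡x² = trans (sym (ℤₚ.pos-* ℤ.∣ x ∣ ℤ.∣ x ∣))
      (trans (cong ℤ.+_ (sym (ℤₚ.abs-* x x))) (ℤₚ.0≤i⇒+∣i∣≡i (ℤ-square-nonNeg x)))
    D∣y∣²<∣x∣² : suc (D ℕ.* (ℤ.∣ y ∣ ℕ.* ℤ.∣ y ∣)) ≡ ℤ.∣ x ∣ ℕ.* ℤ.∣ x ∣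
    D∣y∣²<∣x∣² = ℤₚ.+-injective (begin
      ℤ.+ 1 ℤ.+ ℤ.+ (D ℕ.* (ℤ.∣ y ∣ ℕ.* ℤ.∣ y ∣))
        ≡⟨ cong (λ w → ℤ.+ 1 ℤ.+ w) (ℤₚ.pos-* D (ℤ.∣ y ∣ ℕ.* ℤ.∣ y ∣)) ⟩
      ℤ.+ 1 ℤ.+ d ℤ.* ℤ.+ (ℤ.∣ y ∣ ℕ.* ℤ.∣ y ∣)
        ≡⟨ cong (λ w → ℤ.+ 1 ℤ.+ d ℤ.* w)
          (trans (cong ℤ.+_ (sym (ℤₚ.abs-* y y))) (ℤₚ.0≤i⇒+∣i∣≡i (ℤ-square-nonNeg y))) ⟩
      ℤ.+ 1 ℤ.+ d ℤ.* (y ℤ.* y)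
        ≡⟨ cong (λ w → w ℤ.+ d ℤ.* (y ℤ.* y)) (proj₁ (proj₂ (proj₂ pell))) ⟨
      x ℤ.* x ℤ.- d ℤ.* (y ℤ.* y) ℤ.+ d ℤ.* (y ℤ.* y)    ≡⟨ cancel (x ℤ.* x) (d ℤ.* (y ℤ.* y)) ⟩
      x ℤ.* x                                            ≡⟨ ∣x∣²≡x² ⟨
      ℤ.+ ℤ.∣ x ∣ ℤ.* ℤ.+ ℤ.∣ x ∣                        ≡⟨ ℤₚ.pos-* ℤ.∣ x ∣ ℤ.∣ x ∣ ⟨
      ℤ.+ (ℤ.∣ x ∣ ℕ.* ℤ.∣ x ∣)                          ∎)
      where
      open ≡-Reasoning
      cancel : ∀ m n → m ℤ.- n ℤ.+ n ≡ m
      cancel = ℤ-Ring.solve-∀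
    Dy²>0 : 0 ℕ.< D ℕ.* (ℤ.∣ y ∣ ℕ.* ℤ.∣ y ∣)
    Dy²>0 = ℕₚ.*-mono-< (ℕₚ.n≢0⇒n>0 D≢0) (ℕₚ.*-mono-< 0<∣y∣ 0<∣y∣)
      where
      0<∣y∣ : 0 ℕ.< ℤ.∣ y ∣
      0<∣y∣ = ℕₚ.n≢0⇒n>0 (proj₂ (proj₂ (proj₂ pell)) ∘ ℤₚ.∣i∣≡0⇒i≡0)
    not-small : ¬ ℤ.∣ x ∣ ℕ.< 2
    not-small ∣x∣<2 = ℕₚ.<⇒≱ (ℕ.s≤s Dy²>0)
      (subst (ℕ._≤ 1) (sym D∣y∣²<∣x∣²) (ℕₚ.*-mono-≤ (ℕ.s≤s⁻¹ ∣x∣<2) (ℕ.s≤s⁻¹ ∣x∣<2)))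
  large-pell (suc n) = x ℤ.* x ℤ.+ d ℤ.* (y ℤ.* y) , x ℤ.* y ℤ.+ y ℤ.* x
    , trans (identity d x y) (cong (λ w → w ℤ.* w) x²-dy²≡1)
    , (begin
      ℤ.+ 1 ℤ.+ ℤ.+ (2 ℕ.+ n)            ≤⟨ ℤₚ.+-mono-≤ (ℤₚ.≤-trans (ℤ.+≤+ (ℕ.s≤s ℕ.z≤n)) n≤x) n≤x ⟩
      x ℤ.+ x                            ≡⟨ double x ⟩
      ℤ.+ 2 ℤ.* x
        ≤⟨ ℤₚ.*-monoʳ-≤-nonNeg x {{ℤ.nonNegative (ℤₚ.≤-trans (ℤ.+≤+ ℕ.z≤n) n≤x)}}
          (ℤₚ.≤-trans (ℤ.+≤+ (ℕ.s≤s (ℕ.s≤s ℕ.z≤n))) n≤x) ⟩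
      x ℤ.* x                            ≡⟨ ℤₚ.+-identityʳ (x ℤ.* x) ⟨
      x ℤ.* x ℤ.+ ℤ.+ 0
        ≤⟨ ℤₚ.+-monoʳ-≤ (x ℤ.* x)
          (subst (ℤ._≤ d ℤ.* (y ℤ.* y)) (ℤₚ.*-zeroʳ d) (ℤₚ.*-monoˡ-≤-nonNeg d (ℤ-square-nonNeg y))) ⟩
      x ℤ.* x ℤ.+ d ℤ.* (y ℤ.* y)        ∎)
    where
    open ℤₚ.≤-Reasoning
    x = proj₁ (large-pell n)
    y = proj₁ (proj₂ (large-pell n))
    x²-dy²≡1 = proj₁ (proj₂ (proj₂ (large-pell n)))
    n≤x = proj₂ (proj₂ (proj₂ (large-pell n)))
    double : ∀ x → x ℤ.+ x ≡ ℤ.+ 2 ℤ.* x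
    double = ℤ-Ring.solve-∀
    identity : ∀ d x y →
      (x ℤ.* x ℤ.+ d ℤ.* (y ℤ.* y)) ℤ.* (x ℤ.* x ℤ.+ d ℤ.* (y ℤ.* y)) ℤ.- d ℤ.*
        ((x ℤ.* y ℤ.+ y ℤ.* x) ℤ.* (x ℤ.* y ℤ.+ y ℤ.* x)) ≡
      (x ℤ.* x ℤ.- d ℤ.* (y ℤ.* y)) ℤ.* (x ℤ.* x ℤ.- d ℤ.* (y ℤ.* y))
    identity = ℤ-Ring.solve-∀

-- Quadratic forms, their doubled Gram matrices and changes of variables.

module _ {D : ℕ} where

  sum-zero : ∀ {n} {g : Fin n → K D} → (∀ i → g i ≡ 0#) → sum g ≡ 0#
  sum-zero {n} g≡0 = trans (sum-cong-≗ g≡0) (sum-replicate-zero n)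

  single : ∀ {n} → Fin n → (Fin n → K D) → Fin n → K D
  single i g j = if does (i Fin.≟ j) then g j else 0#

  sum-single : ∀ {n} (i : Fin n) (g : Fin n → K D) → sum (single i g) ≡ g i
  sum-single zero    g =
    trans (cong (g zero +_) (sum-zero {g = single zero g ∘ suc} λ _ → refl)) (+-identityʳ (g zero))
  sum-single (suc i) g = trans (+-identityˡ (sum (single i (g ∘ suc)))) (sum-single i (g ∘ suc))

  does-injective : ∀ {m n} (f : Fin m → Fin n) →
    (∀ {i j} → f i ≡ f j → i ≡ j) → ∀ i j → does (f i Fin.≟ f j) ≡ does (i Fin.≟ j)
  does-injective f f-inj i j with i Fin.≟ j
  ... | yes i≡j = dec-true (f i Fin.≟ f j) (cong f i≡j)
  ... | no  i≢j = dec-false (f i Fin.≟ f j) (i≢j ∘ f-inj)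

  does-sym : ∀ {n} (i j : Fin n) → does (i Fin.≟ j) ≡ does (j Fin.≟ i)
  does-sym i j with j Fin.≟ i
  ... | yes j≡i = dec-true (i Fin.≟ j) (sym j≡i)
  ... | no  j≢i = dec-false (i Fin.≟ j) (j≢i ∘ sym)

  -- Each g a is spread over the fibre of f at a, which has at most one point, and the two sums are
  -- exchanged.
  sum-reindex : ∀ {m n} (f : Fin m → Fin n) → (∀ {i j} → f i ≡ f j → i ≡ j) → (g : Fin n → K D) →
    (∀ a → (∀ i → f i ≢ a) → g a ≡ 0#) → sum g ≡ sum (g ∘ f)
  sum-reindex f f-inj g g≡0 = begin
    sum g                                        ≡⟨ sum-cong-≗ fibre ⟩
    (sum λ a → sum λ i → single (f i) g a)       ≡⟨ ∑-comm (λ a i → single (f i) g a) ⟩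
    (sum λ i → sum λ a → single (f i) g a)       ≡⟨ sum-cong-≗ (λ i → sum-single (f i) g) ⟩
    sum (g ∘ f)                                  ∎
    where
    open ≡-Reasoning
    fibre : ∀ a → g a ≡ sum λ i → single (f i) g a
    fibre a with Finₚ.any? (λ i → f i Fin.≟ a)
    ... | yes (i₀ , refl) = sym (trans
      (sum-cong-≗ λ i → cong (if_then g (f i₀) else 0#) (trans (does-injective f f-inj i i₀) (does-sym i i₀)))
      (sum-single i₀ (λ _ → g (f i₀))))
    ... | no  a∉f = trans (g≡0 a λ i fi≡a → a∉f (i , fi≡a))
      (sym (sum-zero λ i → cong (if_then g a else 0#) (dec-false (f i Fin.≟ a) λ fi≡a → a∉f (i , fi≡a))))

  halve : (x y : K D) → x + x ≡ y + y → x ≡ y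
  halve x y eq = K-cong (halveℚ (cong rat eq)) (halveℚ (cong irr eq))
    where
    2*½ : ∀ p → (p ℚ.+ p) ℚ.* ℚ.½ ≡ p
    2*½ p = trans (double p) (trans (cong (p ℚ.*_) refl) (ℚₚ.*-identityʳ p))
      where
      double : ∀ p → (p ℚ.+ p) ℚ.* ℚ.½ ≡ p ℚ.* (ℚ.½ ℚ.+ ℚ.½)
      double = solve-∀ ℚ-ring
    halveℚ : ∀ {p q} → p ℚ.+ p ≡ q ℚ.+ q → p ≡ q
    halveℚ {p} {q} 2p≡2q = trans (sym (2*½ p)) (trans (cong (ℚ._* ℚ.½) 2p≡2q) (2*½ q))

  module _ {n} (Q : QuadraticForm D n) where

    -- The symmetric matrix of 2Q: diagonal coefficients are doubled and the others kept, so no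
    -- halves occur.
    gram : Fin n → Fin n → K D
    gram i j = coeff Q i j + (if does (i Fin.≟ j) then coeff Q i j else 0#)

    gram-sym : Symmetric gram
    gram-sym i j with Finₚ.<-cmp i j
    ... | tri≈ _ refl _ = refl
    ... | tri< _ i≢j _ = cong₂ _+_ (coeff-sym Q i j) (trans
      (cong (if_then coeff Q i j else 0#) (dec-false (i Fin.≟ j) i≢j))
      (sym (cong (if_then coeff Q j i else 0#) (dec-false (j Fin.≟ i) (i≢j ∘ sym)))))
    ... | tri> _ i≢j _ = cong₂ _+_ (coeff-sym Q i j) (trans
      (cong (if_then coeff Q i j else 0#) (dec-false (i Fin.≟ j) i≢j))
      (sym (cong (if_then coeff Q j i else 0#) (dec-false (j Fin.≟ i) (i≢j ∘ sym)))))

    private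
      term : (Fin n → K D) → Fin n → Fin n → K D
      term x i j = if does (i Fin.≤? j) then coeff Q i j * x i * x j else 0#

      swap : ∀ (x : Fin n → K D) i j → coeff Q j i * x j * x i ≡ coeff Q i j * x i * x j
      swap x i j = trans (cong (λ c → c * x j * x i) (coeff-sym Q j i))
        (xy∙z≈xz∙y (coeff Q i j) (x j) (x i))

      symmetrise : ∀ x i j → term x i j + term x j i ≡ gram i j * x i * x j
      symmetrise x i j with Finₚ.<-cmp i j
      ... | tri< i<j i≢j _ = trans
        (cong₂ _+_ (cong (if_then coeff Q i j * x i * x j else 0#) (dec-true (i Fin.≤? j) (ℕₚ.<⇒≤ i<j)))
                   (cong (if_then coeff Q j i * x j * x i else 0#) (dec-false (j Fin.≤? i) (ℕₚ.<⇒≱ i<j))))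
        (trans (off-diagonalˡ (coeff Q i j) (x i) (x j))
        (cong (λ b → (coeff Q i j + (if b then coeff Q i j else 0#)) * x i * x j)
          (sym (dec-false (i Fin.≟ j) i≢j))))
      ... | tri> _ i≢j j<i = trans
        (cong₂ _+_ (cong (if_then coeff Q i j * x i * x j else 0#) (dec-false (i Fin.≤? j) (ℕₚ.<⇒≱ j<i)))
                   (trans (cong (if_then coeff Q j i * x j * x i else 0#)
                     (dec-true (j Fin.≤? i) (ℕₚ.<⇒≤ j<i))) (swap x i j)))
        (trans (off-diagonalʳ (coeff Q i j) (x i) (x j))
        (cong (λ b → (coeff Q i j + (if b then coeff Q i j else 0#)) * x i * x j)
          (sym (dec-false (i Fin.≟ j) i≢j))))
      ... | tri≈ _ refl _ = trans
        (cong₂ _+_ (cong (if_then coeff Q i i * x i * x i else 0#) (dec-true (i Fin.≤? i) ℕₚ.≤-refl))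
                   (cong (if_then coeff Q i i * x i * x i else 0#) (dec-true (i Fin.≤? i) ℕₚ.≤-refl)))
        (trans (sym (+-*-*-distrib (coeff Q i i) (coeff Q i i) (x i) (x i)))
        (cong (λ b → (coeff Q i i + (if b then coeff Q i i else 0#)) * x i * x i)
          (sym (dec-true (i Fin.≟ i) refl))))

    -- The triangular sum is added to its transpose: off the diagonal exactly one of the two terms
    -- is present, on the diagonal both are.
    eval+eval : ∀ x → eval Q x + eval Q x ≡ bilinear gram x
    eval+eval x = begin
      eval Q x + eval Q x
        ≡⟨ cong (eval Q x +_) (∑-comm (term x)) ⟩
      (sum λ i → sum λ j → term x i j) + (sum λ i → sum λ j → term x j i)
        ≡⟨ ∑-distrib-+ (λ i → sum λ j → term x i j) (λ i → sum λ j → term x j i) ⟨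
      (sum λ i → (sum λ j → term x i j) + (sum λ j → term x j i))
        ≡⟨ sum-cong-≗ (λ i → sym (∑-distrib-+ (λ j → term x i j) (λ j → term x j i))) ⟩
      (sum λ i → sum λ j → term x i j + term x j i)
        ≡⟨ sum-cong-≗ (λ i → sum-cong-≗ (symmetrise x i)) ⟩
      bilinear gram x ∎
      where open ≡-Reasoning

    -- Compares monomials rather than arguments, so that x and y may differ at variables that do not
    -- appear in Q.
    eval-cong : ∀ x y → (∀ i j → coeff Q i j * x i * x j ≡ coeff Q i j * y i * y j) → eval Q x ≡ eval Q y
    eval-cong x y x≈y = sum-cong-≗ λ i → sum-cong-≗ λ j → cong (if does (i Fin.≤? j) then_else 0#) (x≈y i j)

    eval-cong-≗ : ∀ x y → (∀ i → x i ≡ y i) → eval Q x ≡ eval Q y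
    eval-cong-≗ x y x≗y = eval-cong x y λ i j → cong₂ (λ p q → coeff Q i j * p * q) (x≗y i) (x≗y j)

    eval-zero : ∀ {x} → (∀ i → x i ≡ 0#) → eval Q x ≡ 0#
    eval-zero {x} x≡0 = halve (eval Q x) 0#
      (trans (eval+eval x) (trans (bilinear-zero gram x≡0) (sym (+-identityˡ 0#))))

    eval-scale : ∀ u x → eval Q (λ i → u * x i) ≡ u * u * eval Q x
    eval-scale u x = halve (eval Q λ i → u * x i) (u * u * eval Q x) (begin
      eval Q (λ i → u * x i) + eval Q (λ i → u * x i)   ≡⟨ eval+eval (λ i → u * x i) ⟩
      bilinear gram (λ i → u * x i)
        ≡⟨ sum-cong-≗ (λ i → sum-cong-≗ λ j → scale-term u (gram i j) (x i) (x j)) ⟩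
      (sum λ i → sum λ j → u * u * (gram i j * x i * x j))
        ≡⟨ sum-cong-≗ (λ i → sym (*-distribˡ-sum (u * u) (λ j → gram i j * x i * x j))) ⟩
      (sum λ i → u * u * sum λ j → gram i j * x i * x j)
        ≡⟨ *-distribˡ-sum (u * u) (λ i → sum λ j → gram i j * x i * x j) ⟨
      u * u * bilinear gram x                           ≡⟨ cong (u * u *_) (eval+eval x) ⟨
      u * u * (eval Q x + eval Q x)                     ≡⟨ distribˡ (u * u) (eval Q x) (eval Q x) ⟩
      u * u * eval Q x + u * u * eval Q x               ∎)
      where
      open ≡-Reasoning

  gram-restrict : ∀ {m n} (Q : QuadraticForm D n) (f : Fin m → Fin n) → (∀ {i j} → f i ≡ f j → i ≡ j) →
    ∀ i j → gram Q (f i) (f j) ≡ gram (restrict f Q) i j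
  gram-restrict Q f f-inj i j =
    cong (λ b → coeff Q (f i) (f j) + (if b then coeff Q (f i) (f j) else 0#)) (does-injective f f-inj i j)

  -- Doubling a form turns the ordered sum over i ≤ j into one that is insensitive to the order of the variables.
  eval-restrict : ∀ {m n} (Q : QuadraticForm D n) (f : Fin m → Fin n) → (∀ {i j} → f i ≡ f j → i ≡ j) → ∀ y →
    (∀ a → (∀ i → f i ≢ a) → ∀ b → coeff Q a b * y a * y b ≡ 0#) → eval Q y ≡ eval (restrict f Q) (y ∘ f)
  eval-restrict Q f f-inj y vanish = halve (eval Q y) (eval (restrict f Q) (y ∘ f)) (begin
    eval Q y + eval Q y
      ≡⟨ eval+eval Q y ⟩
    bilinear (gram Q) y
      ≡⟨ sum-reindex f f-inj (λ a → sum λ b → gram Q a b * y a * y b) (λ a a∉f → sum-zero (gram-vanish a a∉f)) ⟩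
    (sum λ i → sum λ b → gram Q (f i) b * y (f i) * y b)
      ≡⟨ sum-cong-≗ (λ i → sum-reindex f f-inj (λ b → gram Q (f i) b * y (f i) * y b) λ b b∉f →
        trans (flip (f i) b) (gram-vanish b b∉f (f i))) ⟩
    (sum λ i → sum λ j → gram Q (f i) (f j) * y (f i) * y (f j))
      ≡⟨ sum-cong-≗ (λ i → sum-cong-≗ λ j → cong (λ c → c * y (f i) * y (f j)) (gram-restrict Q f f-inj i j)) ⟩
    bilinear (gram (restrict f Q)) (y ∘ f)
      ≡⟨ eval+eval (restrict f Q) (y ∘ f) ⟨
    eval (restrict f Q) (y ∘ f) + eval (restrict f Q) (y ∘ f) ∎)
    where
    open ≡-Reasoning
    gram-vanish : ∀ a → (∀ i → f i ≢ a) → ∀ b → gram Q a b * y a * y b ≡ 0#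
    gram-vanish a a∉f b with does (a Fin.≟ b)
    ... | false = trans (cong (λ c → c * y a * y b) (+-identityʳ (coeff Q a b))) (vanish a a∉f b)
    ... | true  = trans (+-*-*-distrib (coeff Q a b) (coeff Q a b) (y a) (y b))
                    (trans (cong₂ _+_ (vanish a a∉f b) (vanish a a∉f b)) (+-identityˡ 0#))
    flip : ∀ a b → gram Q a b * y a * y b ≡ gram Q b a * y b * y a
    flip a b = trans (cong (λ c → c * y a * y b) (gram-sym Q a b))
      (xy∙z≈xz∙y (gram Q b a) (y a) (y b))

  TotallyPositive-double : (x : K D) → TotallyPositive x → TotallyPositive (x + x)
  TotallyPositive-double x (0<a , 0<N) = ℚₚ.+-mono-< 0<a 0<a ,
    subst (0ℚ ℚ.<_) (quadruple (δ D) (rat x) (irr x))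
      (*-pos {ι (ℤ.+ 4)} (ι-mono-< {ℤ.+ 0} {ℤ.+ 4} (ℤ.+<+ (ℕ.s≤s ℕ.z≤n))) 0<N)
    where
    quadruple : ∀ δ a b → ι (ℤ.+ 4) ℚ.* (a ℚ.* a ℚ.- δ ℚ.* (b ℚ.* b)) ≡
      (a ℚ.+ a) ℚ.* (a ℚ.+ a) ℚ.- δ ℚ.* ((b ℚ.+ b) ℚ.* (b ℚ.+ b))
    quadruple = solve-∀ ℚ-ring

  gram-positive-definite : ∀ {n} (Q : QuadraticForm D n) → PositiveDefiniteForm Q → PositiveDefinite (gram Q)
  gram-positive-definite Q Q>0 x x≢0 =
    subst TotallyPositive (eval+eval Q x)
      (TotallyPositive-double (eval Q x) (≻0⇒TotallyPositive (eval Q x) (Q>0 x x≢0)))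

  finite-bound : ∀ {n} (C : Fin n → ℚ) → (∀ i → 0ℚ ℚ.≤ C i) → Σ[ B ∈ ℚ ] 0ℚ ℚ.≤ B × (∀ i → C i ℚ.≤ B)
  finite-bound {zero}  C 0≤C = 0ℚ , ℚₚ.≤-refl , λ ()
  finite-bound {suc n} C 0≤C = C zero ℚ.+ B , +-nonNeg (0≤C zero) 0≤B , λ
    { zero    → ≤-by 0≤B refl
    ; (suc i) → ℚₚ.≤-trans (C≤B i) (≤-by (0≤C zero) (ℚₚ.+-comm (C zero) B)) }
    where
    B = proj₁ (finite-bound (C ∘ suc) (0≤C ∘ suc))
    0≤B = proj₁ (proj₂ (finite-bound (C ∘ suc) (0≤C ∘ suc)))
    C≤B = proj₂ (proj₂ (finite-bound (C ∘ suc) (0≤C ∘ suc)))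

  -- A coordinate is a linear form, to which `dominates` applies. B is the sum of the finitely many
  -- constants, and the factor 2 arises because `gram` belongs to 2Q.
  coordinate-bound : ∀ {n} (Q : QuadraticForm D n) → PositiveDefiniteForm Q →
    Σ[ C ∈ ℚ ] 0ℚ ℚ.≤ C × (∀ x i → size (x i) ℚ.≤ C ℚ.* rat (eval Q x))
  coordinate-bound {n} Q Q>0 = 2ℚ ℚ.* B , *-nonNeg (ℚₚ.nonNegative⁻¹ 2ℚ) 0≤B , bound
    where
    M>0 = gram-positive-definite Q Q>0
    dominated : ∀ i → Dominates (gram Q) (single i λ _ → 1#)
    dominated i = dominates (gram Q) (gram-sym Q) M>0 (single i λ _ → 1#)
    finite = finite-bound (λ i → proj₁ (dominated i)) (λ i → proj₁ (proj₂ (dominated i)))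
    B = proj₁ finite
    0≤B = proj₁ (proj₂ finite)
    linear-single : ∀ x i → linear (single i λ _ → 1#) x ≡ x i
    linear-single x i = trans (sum-cong-≗ step) (sum-single i x)
      where
      step : ∀ j → single i (λ _ → 1#) j * x j ≡ single i x j
      step j with does (i Fin.≟ j)
      ... | true  = *-identityˡ (x j)
      ... | false = zeroˡ (x j)
    bound : ∀ x i → size (x i) ℚ.≤ 2ℚ ℚ.* B ℚ.* rat (eval Q x)
    bound x i = begin
      size (x i)                                           ≡⟨ cong size (linear-single x i) ⟨
      size (linear (single i λ _ → 1#) x)                  ≤⟨ proj₂ (proj₂ (dominated i)) x ⟩
      proj₁ (dominated i) ℚ.* rat (bilinear (gram Q) x)
        ≤⟨ ℚₚ.*-monoʳ-≤-nonNeg (rat (bilinear (gram Q) x)) {{ℚ.nonNegative (rat-nonNeg (gram Q) M>0 x)}}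
          (proj₂ (proj₂ finite) i) ⟩
      B ℚ.* rat (bilinear (gram Q) x)                      ≡⟨ cong (λ v → B ℚ.* rat v) (eval+eval Q x) ⟨
      B ℚ.* (rat (eval Q x) ℚ.+ rat (eval Q x))            ≡⟨ double B (rat (eval Q x)) ⟩
      2ℚ ℚ.* B ℚ.* rat (eval Q x)                          ∎
      where
      open ℚₚ.≤-Reasoning
      double : ∀ b r → b ℚ.* (r ℚ.+ r) ≡ 2ℚ ℚ.* b ℚ.* r
      double = solve-∀ ℚ-ring

  -- Extension by zero along an injective f. Summing over the fibre avoids an explicit inverse.
  pushforward : ∀ {m n} → (Fin m → Fin n) → (Fin m → K D) → Fin n → K D
  pushforward f x a = sum λ i → if does (f i Fin.≟ a) then x i else 0#

  pushforward-image : ∀ {m n} (f : Fin m → Fin n) →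
    (∀ {i j} → f i ≡ f j → i ≡ j) → ∀ x i → pushforward f x (f i) ≡ x i
  pushforward-image f f-inj x i = trans (sum-cong-≗ λ j → cong (if_then x j else 0#)
    (trans (does-injective f f-inj j i) (does-sym j i))) (sum-single i x)

  pushforward-outside : ∀ {m n} (f : Fin m → Fin n) x a → (∀ i → f i ≢ a) → pushforward f x a ≡ 0#
  pushforward-outside f x a a∉f = sum-zero λ i → cong (if_then x i else 0#) (dec-false (f i Fin.≟ a) (a∉f i))

  eval-pushforward : ∀ {m n} (Q : QuadraticForm D n) (f : Fin m → Fin n) → (∀ {i j} → f i ≡ f j → i ≡ j) → ∀ x →
    eval Q (pushforward f x) ≡ eval (restrict f Q) x
  eval-pushforward Q f f-inj x = trans
    (eval-restrict Q f f-inj (pushforward f x) λ a a∉f b → trans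
      (cong (λ p → coeff Q a b * p * pushforward f x b) (pushforward-outside f x a a∉f))
      (x∙0∙y≈0 (coeff Q a b) (pushforward f x b)))
    (eval-cong-≗ (restrict f Q) (pushforward f x ∘ f) x (pushforward-image f f-inj x))

-- Selecting variables, and the list of variables of the associated form.

lookup-injective : ∀ {A : Set} {xs : List A} → Unique xs → ∀ {i j} → lookup xs i ≡ lookup xs j → i ≡ j
lookup-injective {xs = _ ∷ _}  (_ ∷ _)      {zero}  {zero}  _  = refl
lookup-injective {xs = _ ∷ xs} (x∉xs ∷ _)   {zero}  {suc j} eq =
  ⊥-elim (All.lookup x∉xs (∈-lookup {xs = xs} j) eq)
lookup-injective {xs = _ ∷ xs} (x∉xs ∷ _)   {suc i} {zero}  eq =
  ⊥-elim (All.lookup x∉xs (∈-lookup {xs = xs} i) (sym eq))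
lookup-injective {xs = _ ∷ _}  (_ ∷ xs!)    {suc i} {suc j} eq = cong suc (lookup-injective xs! eq)

-- `fromℕ r` is the last position, so making room for it moves none of the first k.
inject≤-punchIn : ∀ {k r} (i : Fin k) (k≤r : k ℕ.≤ r) (k≤1+r : k ℕ.≤ suc r) → inject≤ i k≤1+r ≡
  punchIn (fromℕ r) (inject≤ i k≤r)
inject≤-punchIn {suc k} {suc r} zero    _ _ = refl
inject≤-punchIn {suc k} {suc r} (suc i) (ℕ.s≤s k≤r) (ℕ.s≤s k≤1+r) = cong suc (inject≤-punchIn i k≤r k≤1+r)

-- A reordering that puts exactly the elements with P in the first k positions, in the shape that
-- the definition of subform requires.
Selection : ∀ {r} → (Fin r → Set) → Set
Selection {r} P = Σ[ k ∈ ℕ ] Σ[ k≤r ∈ k ℕ.≤ r ] Σ[ σ ∈ Permutation′ r ]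
  (∀ i → P (σ ⟨$⟩ʳ inject≤ i k≤r)) × (∀ a → P a → ∃[ i ] σ ⟨$⟩ʳ inject≤ i k≤r ≡ a)

select : ∀ {r} (P : Fin r → Set) → (∀ i → Dec (P i)) → Selection P
select {zero}  P P? = 0 , ℕ.z≤n , Perm.id , (λ ()) , λ ()
select {suc r} P P? with P? zero | select (P ∘ suc) (P? ∘ suc)
... | yes P₀ | k , k≤r , σ , sound , complete = suc k , ℕ.s≤s k≤r , lift₀ σ
  , (λ { zero → P₀ ; (suc i) → sound i })
  , λ { zero    _  → zero , refl
      ; (suc a) Pa → suc (proj₁ (complete a Pa)) , cong suc (proj₂ (complete a Pa)) }
... | no ¬P₀ | k , k≤r , σ , sound , complete = k , k≤1+r , τ′
  , (λ i → subst P (sym (image i)) (sound i))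
  , λ { zero    P₀ → ⊥-elim (¬P₀ P₀)
      ; (suc a) Pa → proj₁ (complete a Pa) , trans (image (proj₁ (complete a Pa)))
        (cong suc (proj₂ (complete a Pa))) }
  where
  k≤1+r : k ℕ.≤ suc r
  k≤1+r = ℕₚ.m≤n⇒m≤1+n k≤r
  τ′ : Permutation′ (suc r)
  -- The rejected element 0 is sent to the end, behind the first k positions.
  τ′ = insert (fromℕ r) zero σ
  image : ∀ i → τ′ ⟨$⟩ʳ inject≤ i k≤1+r ≡ suc (σ ⟨$⟩ʳ inject≤ i k≤r)
  image i = trans (cong (τ′ ⟨$⟩ʳ_) (inject≤-punchIn i k≤r k≤1+r))
    (insert-punchIn (fromℕ r) zero σ (inject≤ i k≤r))

⟨$⟩ʳ-injective : ∀ {r} (σ : Permutation′ r) {i j} → σ ⟨$⟩ʳ i ≡ σ ⟨$⟩ʳ j → i ≡ j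
⟨$⟩ʳ-injective σ eq = trans (sym (inverseˡ σ)) (trans (cong (σ ⟨$⟩ˡ_) eq) (inverseˡ σ))

index : ∀ {r} → Fin (r ℕ.* 2) → Fin r
index = proj₁ ∘ remQuot 2

index-combine : ∀ {r} (i : Fin r) (s : Fin 2) → index (combine i s) ≡ i
index-combine i s = cong proj₁ (Finₚ.remQuot-combine i s)

data VarView (r : ℕ) : Fin (r ℕ.* 2) → Set where
  z-var : ∀ i → VarView r (zVar {r} i)
  τ-var : ∀ i → VarView r (τVar {r} i)

varView : ∀ {r} (v : Fin (r ℕ.* 2)) → VarView r v
varView {r} v = subst (VarView r) (Finₚ.combine-remQuot {r} 2 v) (uncurry view (remQuot 2 v))
  where
  view : (i : Fin r) (s : Fin 2) → VarView r (combine i s)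
  view i zero       = z-var {r} i
  view i (suc zero) = τ-var {r} i

module _ {D r : ℕ} (G : GeneralizedForm D r) where

  private
    pair : Fin r → List (Fin (r ℕ.* 2))
    pair i = zVar i ∷ τVar i ∷ []

    ¬proper? = λ i → ¬? (proper? G i)

    index-primed : ∀ j → index (primed G j) ≡ j
    index-primed j with does (appearsIn? (G₀ G) (τVar j))
    ... | true  = index-combine j (suc zero)
    ... | false = index-combine j zero

    index-pair : ∀ {v i} → v ∈ pair i → index v ≡ i
    index-pair {i = i} (here refl)         = index-combine i zero
    index-pair {i = i} (there (here refl)) = index-combine i (suc zero)

    pair-unique : ∀ i → Unique (pair i)
    pair-unique i = (zVar≢τVar ∷ []) ∷ [] ∷ []
      where
      zVar≢τVar : zVar i ≢ τVar i
      zVar≢τVar eq with () ← Finₚ.combine-injectiveʳ i zero i (suc zero) eq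

    pair-disjoint : ∀ {i j} → i ≢ j → Disjoint (pair i) (pair j)
    pair-disjoint i≢j (v∈i , v∈j) = i≢j (trans (sym (index-pair v∈i)) (index-pair v∈j))

  -- `index` recovers the variable from each entry: a non-proper variable contributes one entry, a
  -- proper one two distinct entries, and the two halves of the list have disjoint indices.
  associatedVars-unique : Unique (associatedVars G)
  associatedVars-unique = Uniqueₚ.++⁺
    (Uniqueₚ.map⁺ (λ {i} {j} eq → trans (sym (index-primed i)) (trans (cong index eq) (index-primed j)))
      (Uniqueₚ.filter⁺ ¬proper? (Uniqueₚ.allFin⁺ r)))
    (Uniqueₚ.concat⁺
      (Allₚ.map⁺ (All.universal pair-unique _))
      (AllPairsₚ.map⁺ (AllPairs.map pair-disjoint
        (Uniqueₚ.filter⁺ (proper? G) (Uniqueₚ.allFin⁺ r)))))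
    (λ (v∈nonproper , v∈proper) → nonproper-index v∈nonproper (proper-index v∈proper))
    where
    nonproper-index : ∀ {v} → v ∈ map (primed G) (filter ¬proper? (allFin r)) → ¬ Proper G (index v)
    nonproper-index v∈ with i , i∈ , refl ← ∈-map⁻ (primed G) v∈ =
      subst (¬_ ∘ Proper G) (sym (index-primed i)) (proj₂ (∈-filter⁻ ¬proper? {xs = allFin r} i∈))
    proper-index : ∀ {v} → v ∈ concatMap pair (filter (proper? G) (allFin r)) → Proper G (index v)
    proper-index v∈ with i , i∈ , v∈i ← find (∈-concatMap⁻ pair {xs = filter (proper? G) (allFin r)} v∈) =
      subst (Proper G) (sym (index-pair v∈i)) (proj₂ (∈-filter⁻ (proper? G) {xs = allFin r} i∈))

  private
    classify : ∀ {v} i → v ∈ pair i → (¬ Proper G i → primed G i ≡ v) → v ∈ associatedVars G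
    classify i v∈i nonproper with proper? G i
    ... | yes p = ∈-++⁺ʳ (map (primed G) (filter ¬proper? (allFin r)))
      (∈-concatMap⁺ pair (lose (∈-filter⁺ (proper? G) (∈-allFin i) p) v∈i))
    ... | no ¬p = ∈-++⁺ˡ (subst (_∈ map (primed G) (filter ¬proper? (allFin r))) (nonproper ¬p)
      (∈-map⁺ (primed G) (∈-filter⁺ ¬proper? (∈-allFin i) ¬p)))

  -- Both arguments of a proper variable are listed. For a non-proper one at most one argument
  -- appears, and `primed` picks it.
  associatedVars-complete : ∀ v → AppearsIn (G₀ G) v → v ∈ associatedVars G
  associatedVars-complete v v-appears with varView {r} v
  ... | z-var i = classify i (here refl) λ ¬p → cong (if_then τVar i else zVar i)
    (dec-false (appearsIn? (G₀ G) (τVar i)) λ τ-appears → ¬p (v-appears , τ-appears))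
  ... | τ-var i = classify i (there (here refl)) λ _ → cong (if_then τVar i else zVar i)
    (dec-true (appearsIn? (G₀ G) (τVar i)) v-appears)

-- Conjugation and large units.

archimedean : ∀ q → ∃[ n ] q ℚ.< ι (ℤ.+ n)
archimedean q = n , ℚₚ.≰⇒> λ n≤q → ℚₚ.<-irrefl refl (begin-strict
  ι (ℤ.+ n)                          ≡⟨ ℚₚ.*-identityʳ (ι (ℤ.+ n)) ⟨
  ι (ℤ.+ n) ℚ.* 1ℚ
    ≤⟨ *-monoˡ-≤ (ι-mono-≤ {ℤ.+ 0} {ℤ.+ n} (ℤ.+≤+ ℕ.z≤n)) (ι-mono-≤ {ℤ.+ 1} {ℚ.↧ q} (ℤ.+≤+ (ℕ.s≤s ℕ.z≤n))) ⟩
  ι (ℤ.+ n) ℚ.* ι (ℚ.↧ q)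
    ≤⟨ ℚₚ.*-monoʳ-≤-nonNeg (ι (ℚ.↧ q)) {{ℚ.nonNegative (ℚₚ.<⇒≤ (denominator-pos q))}} n≤q ⟩
  q ℚ.* ι (ℚ.↧ q)                    ≡⟨ clear-denominator q ⟩
  ι (ℚ.↥ q)                          <⟨ ι-mono-< (ℤₚ.≤-<-trans (i≤∣i∣ (ℚ.↥ q)) (ℤ.+<+ (ℕₚ.n<1+n ℤ.∣ ℚ.↥ q ∣))) ⟩
  ι (ℤ.+ n)                          ∎)
  where
  open ℚₚ.≤-Reasoning
  n = suc ℤ.∣ ℚ.↥ q ∣
  i≤∣i∣ : ∀ i → i ℤ.≤ ℤ.+ ℤ.∣ i ∣
  i≤∣i∣ (ℤ.+ _)    = ℤₚ.≤-refl
  i≤∣i∣ ℤ.-[1+ _ ] = ℤ.-≤+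

module _ {D : ℕ} where

  τ-involutive : (x : K D) → τ (τ x) ≡ x
  τ-involutive x = K-cong refl (neg-neg (irr x))
    where
    neg-neg : ∀ b → ℚ.- (ℚ.- b) ≡ b
    neg-neg = solve-∀ ℚ-ring

  τ-* : (x y : K D) → τ (x * y) ≡ τ x * τ y
  τ-* x y = K-cong (rational (δ D) (rat x) (irr x) (rat y) (irr y)) (irrational (rat x) (irr x) (rat y) (irr y))
    where
    rational : ∀ δ a b c d → a ℚ.* c ℚ.+ δ ℚ.* (b ℚ.* d) ≡ a ℚ.* c ℚ.+ δ ℚ.* ((ℚ.- b) ℚ.* (ℚ.- d))
    rational = solve-∀ ℚ-ring
    irrational : ∀ a b c d → ℚ.- (a ℚ.* d ℚ.+ b ℚ.* c) ≡ a ℚ.* (ℚ.- d) ℚ.+ (ℚ.- b) ℚ.* c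
    irrational = solve-∀ ℚ-ring

  -- rat(α) rat(w²α) = rat(w)² N(α) + D (rat(w) irr(α) + irr(w) rat(α))².
  TotallyPositive-*-square : ∀ (w α : K D) → norm w ≡ 1ℚ → 0ℚ ℚ.< rat w → TotallyPositive α →
    TotallyPositive (w * (w * α))
  TotallyPositive-*-square w α Nw≡1 0<x (0<a , 0<N) =
    *-cancelˡ-< 0<a (subst₂ ℚ._<_ (sym (ℚₚ.*-zeroʳ (rat α)))
      (sym (identity (δ D) (rat w) (irr w) (rat α) (irr α)))
      (ℚₚ.+-mono-<-≤ (*-pos (*-pos 0<x 0<x) 0<N)
        (*-nonNeg (δ-nonNeg {D}) (square-nonNeg (rat w ℚ.* irr α ℚ.+ irr w ℚ.* rat α))))) ,
    subst (0ℚ ℚ.<_) (sym (trans (norm-* w (w * α))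
      (trans (cong₂ ℚ._*_ Nw≡1 (norm-* w α))
      (trans (cong (λ n → 1ℚ ℚ.* (n ℚ.* norm α)) Nw≡1) (units (norm α)))))) 0<N
    where
    units : ∀ n → 1ℚ ℚ.* (1ℚ ℚ.* n) ≡ n
    units = solve-∀ ℚ-ring
    identity : ∀ δ x y a b →
      a ℚ.* (x ℚ.* (x ℚ.* a ℚ.+ δ ℚ.* (y ℚ.* b)) ℚ.+ δ ℚ.* (y ℚ.* (x ℚ.* b ℚ.+ y ℚ.* a))) ≡
      x ℚ.* x ℚ.* (a ℚ.* a ℚ.- δ ℚ.* (b ℚ.* b)) ℚ.+ δ ℚ.* ((x ℚ.* b ℚ.+ y ℚ.* a) ℚ.* (x ℚ.* b ℚ.+ y ℚ.* a))
    identity = solve-∀ ℚ-ring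

  LargeUnit : ℚ → Set
  LargeUnit B = Σ[ w ∈ K D ] Lattice w × norm w ≡ 1ℚ × 0ℚ ℚ.< rat w × B ℚ.< size (τ w)

  -- For w = x + y√D one has size(τ(w)) = x² + Dy² ≥ x, so a Pell solution with x above B suffices.
  large-unit : (∀ m → m ℕ.* m ≢ D) → ∀ B → LargeUnit B
  large-unit nonsquare B = ⟨ ι x , ι y ⟩ , (int-ι x , int-ι y) , norm≡1 , 0<x , large
    where
    n = proj₁ (archimedean B)
    solution = Pell.large-pell D nonsquare n
    x = proj₁ solution
    y = proj₁ (proj₂ solution)
    n≤x = proj₂ (proj₂ (proj₂ solution))
    norm≡1 : ι x ℚ.* ι x ℚ.- δ D ℚ.* (ι y ℚ.* ι y) ≡ 1ℚ
    norm≡1 = trans (sym (begin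
      ι (x ℤ.* x ℤ.- ℤ.+ D ℤ.* (y ℤ.* y))              ≡⟨ ι-+ (x ℤ.* x) (ℤ.- (ℤ.+ D ℤ.* (y ℤ.* y))) ⟩
      ι (x ℤ.* x) ℚ.+ ι (ℤ.- (ℤ.+ D ℤ.* (y ℤ.* y)))    ≡⟨ cong₂ ℚ._+_ (ι-* x x) (ι-neg (ℤ.+ D ℤ.* (y ℤ.* y))) ⟩
      ι x ℚ.* ι x ℚ.- ι (ℤ.+ D ℤ.* (y ℤ.* y))
        ≡⟨ cong (λ z → ι x ℚ.* ι x ℚ.- z) (trans (ι-* (ℤ.+ D) (y ℤ.* y)) (cong (δ D ℚ.*_) (ι-* y y))) ⟩
      ι x ℚ.* ι x ℚ.- δ D ℚ.* (ι y ℚ.* ι y)            ∎)) (cong ι (proj₁ (proj₂ (proj₂ solution))))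
      where open ≡-Reasoning
    1≤x : 1ℚ ℚ.≤ ι x
    1≤x = ι-mono-≤ {ℤ.+ 1} {x} (ℤₚ.≤-trans (ℤ.+≤+ (ℕ.s≤s ℕ.z≤n)) n≤x)
    0<x : 0ℚ ℚ.< ι x
    0<x = ℚₚ.<-≤-trans (ℚₚ.positive⁻¹ 1ℚ) 1≤x
    large : B ℚ.< ι x ℚ.* ι x ℚ.+ δ D ℚ.* ((ℚ.- ι y) ℚ.* (ℚ.- ι y))
    large = begin-strict
      B                   <⟨ proj₂ (archimedean B) ⟩
      ι (ℤ.+ n)           ≤⟨ ι-mono-≤ (ℤₚ.≤-trans (ℤ.+≤+ (ℕₚ.m≤n+m n 2)) n≤x) ⟩
      ι x                 ≡⟨ ℚₚ.*-identityʳ (ι x) ⟨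
      ι x ℚ.* 1ℚ          ≤⟨ *-monoˡ-≤ (ℚₚ.<⇒≤ 0<x) 1≤x ⟩
      ι x ℚ.* ι x         ≤⟨ ≤-by (*-nonNeg (δ-nonNeg {D}) (square-nonNeg (ℚ.- ι y))) refl ⟩
      ι x ℚ.* ι x ℚ.+ δ D ℚ.* ((ℚ.- ι y) ℚ.* (ℚ.- ι y))  ∎
      where open ℚₚ.≤-Reasoning

  module _ {r : ℕ} where
    private
      -- `arguments` reduces through `remQuot` to `quotRem`, whose components are swapped; the
      -- rewriting below needs this form.
      quotRem-combine : (i : Fin r) (s : Fin 2) → Fin.quotRem 2 (combine i s) ≡ (s , i)
      quotRem-combine i s = cong Product.swap (Finₚ.remQuot-combine i s)

    arguments-z : (z : Fin r → K D) → ∀ i → arguments z (zVar i) ≡ z i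
    arguments-z z i rewrite quotRem-combine i zero = refl

    arguments-τ : (z : Fin r → K D) → ∀ i → arguments z (τVar i) ≡ τ (z i)
    arguments-τ z i rewrite quotRem-combine i (suc zero) = refl

-- Representations in which the proper variables vanish.

vars : ∀ {D r} (G : GeneralizedForm D r) → Fin (length (associatedVars G)) → Fin (r ℕ.* 2)
vars G = lookup (associatedVars G)

vars-injective : ∀ {D r} (G : GeneralizedForm D r) {i j} → vars G i ≡ vars G j → i ≡ j
vars-injective G = lookup-injective (associatedVars-unique G)

vars-complete : ∀ {D r} (G : GeneralizedForm D r) v → AppearsIn (G₀ G) v → ∃[ i ] vars G i ≡ v
vars-complete G v v-appears = Any.index v∈V , sym (Anyₚ.lookup-index v∈V)
  where v∈V = associatedVars-complete G v v-appears

-- An omitted variable has only zero coefficients. Hence this holds for every y, also when its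
-- entries are not of the form z, τ(z).
eval-associated : ∀ {D r} (G : GeneralizedForm D r) y → eval (G₀ G) y ≡ eval (associated G) (y ∘ vars G)
eval-associated G y = eval-restrict (G₀ G) (vars G) (vars-injective G) y absent
  where
  absent : ∀ a → (∀ i → vars G i ≢ a) → ∀ b → coeff (G₀ G) a b * y a * y b ≡ 0#
  absent a a∉V b with coeff (G₀ G) a b ≟ 0#
  ... | yes c≡0 = trans (cong (λ c → c * y a * y b) c≡0) (trans (cong (_* y b) (zeroˡ (y a))) (zeroˡ (y b)))
  ... | no  c≢0 = let i , vᵢ≡a = vars-complete G a (b , c≢0) in ⊥-elim (a∉V i vᵢ≡a)

-- If w is a unit that is large compared with α, then every representation of w²α by G is
-- zero at the proper variables: z and τ(z) both are arguments of the definite form associated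
-- to G, hence size (τ(w) z) and size (τ(w) τ(z)) are bounded in terms of α, and they add up to
-- 2 size (τ(w)) size (z).
module Rescaling {D : ℕ} (0<δ : 0ℚ ℚ.< δ D) {r : ℕ} (G : GeneralizedForm D r)
  (C : ℚ) (C-bound : ∀ x i → size (x i) ℚ.≤ C ℚ.* rat (eval (associated G) x))
  (α : K D) (w : K D) (w∈Λ : Lattice w) (Nw≡1 : norm w ≡ 1ℚ)
  (w-large : 2ℚ ℚ.* (C ℚ.* rat α) ℚ.< size (τ w))
  (β : Fin r → K D) (β∈𝒪 : ∀ i → β i ∈𝒪) (Gβ≡w²α : evalG G β ≡ w * (w * α)) where

  private
    u : K D
    u = τ w

    w*u≡1 : w * u ≡ 1#
    w*u≡1 = trans (scalar-τ-norm w) (cong scalar Nw≡1)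

    u²w²α≡α : u * u * (w * (w * α)) ≡ α
    u²w²α≡α = begin
      u * u * (w * (w * α))        ≡⟨ regroup-units u w α ⟩
      w * u * (w * u) * α          ≡⟨ cong (λ e → e * e * α) w*u≡1 ⟩
      1# * 1# * α                  ≡⟨ 1∙1∙x≈x α ⟩
      α                            ∎
      where
      open ≡-Reasoning

    eval-u : eval (associated G) (λ i → u * arguments β (vars G i)) ≡ α
    eval-u = begin
      eval (associated G) (λ i → u * arguments β (vars G i))
        ≡⟨ eval-scale (associated G) u (arguments β ∘ vars G) ⟩
      u * u * eval (associated G) (arguments β ∘ vars G)
        ≡⟨ cong (u * u *_) (eval-associated G (arguments β)) ⟨
      u * u * evalG G β                                         ≡⟨ cong (u * u *_) Gβ≡w²α ⟩
      u * u * (w * (w * α))                                     ≡⟨ u²w²α≡α ⟩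
      α                                                         ∎
      where open ≡-Reasoning

    argument-bound : ∀ v → AppearsIn (G₀ G) v → size (u * arguments β v) ℚ.≤ C ℚ.* rat α
    argument-bound v v-appears = subst₂ (λ a b → size (u * arguments β a) ℚ.≤ C ℚ.* rat b) (proj₂ i) eval-u
      (C-bound (λ i → u * arguments β (vars G i)) (proj₁ i))
      where i = vars-complete G v v-appears

  proper-zero : ∀ p → Proper G p → β p ≡ 0#
  proper-zero p (z-appears , τ-appears) = 𝒪-size-gap 0<δ (β∈𝒪 p) (ℚₚ.≰⇒> λ 1≤2s → ℚₚ.<-irrefl refl (begin-strict
    size u                                              ≡⟨ ℚₚ.*-identityʳ (size u) ⟨
    size u ℚ.* 1ℚ                                       ≤⟨ *-monoˡ-≤ (size-nonNeg u) 1≤2s ⟩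
    size u ℚ.* (2ℚ ℚ.* size (β p))                      ≡⟨ commute (size u) (size (β p)) ⟩
    2ℚ ℚ.* (size u ℚ.* size (β p))                      ≡⟨ size-*+size-*τ u (β p) ⟩
    size (u * β p) ℚ.+ size (u * τ (β p))
      ≡⟨ cong₂ (λ a b → size (u * a) ℚ.+ size (u * b)) (arguments-z β p) (arguments-τ β p) ⟨
    size (u * arguments β (zVar p)) ℚ.+ size (u * arguments β (τVar p))
                                                        ≤⟨ ℚₚ.+-mono-≤ (argument-bound (zVar p) z-appears)
                                                          (argument-bound (τVar p) τ-appears) ⟩
    C ℚ.* rat α ℚ.+ C ℚ.* rat α                         ≡⟨ double (C ℚ.* rat α) ⟩
    2ℚ ℚ.* (C ℚ.* rat α)                                <⟨ w-large ⟩
    size u                                              ∎))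
    where
    open ℚₚ.≤-Reasoning
    commute : ∀ u b → u ℚ.* (2ℚ ℚ.* b) ≡ 2ℚ ℚ.* (u ℚ.* b)
    commute = solve-∀ ℚ-ring
    double : ∀ c → c ℚ.+ c ≡ 2ℚ ℚ.* c
    double = solve-∀ ℚ-ring

  private
    -- Chosen such that zᵢ′ is multiplied by u for each non-proper zᵢ.
    multiplier : Fin r → K D
    multiplier i = if does (appearsIn? (G₀ G) (τVar i)) then τ u else u

  rescaled : Fin r → K D
  rescaled i = multiplier i * β i

  rescaled-integral : ∀ i → rescaled i ∈𝒪
  rescaled-integral i = lattice-*-𝒪 {x = multiplier i} (choice (does (appearsIn? (G₀ G) (τVar i)))) (β∈𝒪 i)
    where
    choice : ∀ b → Lattice (if b then τ u else u)
    choice true  = proj₁ w∈Λ , int-neg (int-neg (proj₂ w∈Λ))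
    choice false = proj₁ w∈Λ , int-neg (proj₂ w∈Λ)

  rescaled-proper : ∀ p → Proper G p → rescaled p ≡ 0#
  rescaled-proper p p-proper = trans (cong (multiplier p *_) (proper-zero p p-proper)) (zeroʳ (multiplier p))

  private
    rescaled-τ : ∀ i → AppearsIn (G₀ G) (τVar i) → arguments rescaled (τVar i) ≡ u * arguments β (τVar i)
    rescaled-τ i τ-appears = begin
      arguments rescaled (τVar i)      ≡⟨ arguments-τ rescaled i ⟩
      τ (multiplier i * β i)
        ≡⟨ cong (λ b → τ ((if b then τ u else u) * β i)) (dec-true (appearsIn? (G₀ G) (τVar i)) τ-appears) ⟩
      τ (τ u * β i)                    ≡⟨ τ-* (τ u) (β i) ⟩
      τ (τ u) * τ (β i)                ≡⟨ cong₂ _*_ (τ-involutive u) (sym (arguments-τ β i)) ⟩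
      u * arguments β (τVar i)         ∎
      where open ≡-Reasoning

    -- At a proper variable the multiplier is τ(u) instead of u, and the two sides agree because β
    -- vanishes there.
    rescaled-z : ∀ i → AppearsIn (G₀ G) (zVar i) → Dec (Proper G i) → arguments rescaled (zVar i) ≡
      u * arguments β (zVar i)
    rescaled-z i z-appears i-proper? =
      trans (arguments-z rescaled i) (trans (by-properness i-proper?) (cong (u *_) (sym (arguments-z β i))))
      where
      by-properness : Dec (Proper G i) → rescaled i ≡ u * β i
      by-properness (yes i-proper) = trans (rescaled-proper i i-proper)
        (trans (sym (zeroʳ u)) (cong (u *_) (sym (proper-zero i i-proper))))
      by-properness (no ¬i-proper) = cong (λ b → (if b then τ u else u) * β i)
        (dec-false (appearsIn? (G₀ G) (τVar i)) λ τ-appears → ¬i-proper (z-appears , τ-appears))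

    rescaled-argument : ∀ {v} → VarView r v → AppearsIn (G₀ G) v → arguments rescaled v ≡ u * arguments β v
    rescaled-argument (τ-var i) τ-appears = rescaled-τ i τ-appears
    rescaled-argument (z-var i) z-appears = rescaled-z i z-appears (proper? G i)

  -- The argument of a non-proper variable that does not appear in G may be scaled by τ(u), so the
  -- comparison with u times the old arguments is made monomial by monomial, over non-zero
  -- coefficients only.
  rescaled-represents : evalG G rescaled ≡ α
  rescaled-represents = begin
    eval (G₀ G) (arguments rescaled)
      ≡⟨ eval-cong (G₀ G) (arguments rescaled) (λ v → u * arguments β v) term ⟩
    eval (G₀ G) (λ v → u * arguments β v)         ≡⟨ eval-scale (G₀ G) u (arguments β) ⟩
    u * u * evalG G β                             ≡⟨ cong (u * u *_) Gβ≡w²α ⟩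
    u * u * (w * (w * α))                         ≡⟨ u²w²α≡α ⟩
    α                                             ∎
    where
    open ≡-Reasoning
    term : ∀ a b → coeff (G₀ G) a b * arguments rescaled a * arguments rescaled b ≡
                   coeff (G₀ G) a b * (u * arguments β a) * (u * arguments β b)
    term a b = by-coefficient (coeff (G₀ G) a b ≟ 0#)
      where
      absent : ∀ p q → coeff (G₀ G) a b ≡ 0# → coeff (G₀ G) a b * p * q ≡ 0#
      absent p q c≡0 = trans (cong (λ c → c * p * q) c≡0) (trans (cong (_* q) (zeroˡ p)) (zeroˡ q))
      by-coefficient : Dec (coeff (G₀ G) a b ≡ 0#) →
        coeff (G₀ G) a b * arguments rescaled a * arguments rescaled b ≡
        coeff (G₀ G) a b * (u * arguments β a) * (u * arguments β b)
      by-coefficient (yes c≡0) = trans (absent (arguments rescaled a) (arguments rescaled b) c≡0)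
        (sym (absent (u * arguments β a) (u * arguments β b) c≡0))
      by-coefficient (no c≢0) = cong₂ (λ p q → coeff (G₀ G) a b * p * q)
        (rescaled-argument (varView {r} a) (b , c≢0))
        (rescaled-argument (varView {r} b) (a , λ c≡0 → c≢0 (trans (coeff-sym (G₀ G) a b) c≡0)))

represented-without-proper : ∀ {D r} (G : GeneralizedForm D r) →
  (∀ m → m ℕ.* m ≢ D) → TotallyPositiveDefinite G →
  (∀ α → α ∈𝒪 → α ≻0 → Represents G α) → ∀ α → α ∈𝒪 → α ≻0 →
  Σ[ γ ∈ (Fin r → K D) ] (∀ i → γ i ∈𝒪) × (∀ p → Proper G p → γ p ≡ 0#) × evalG G γ ≡ α
represented-without-proper {D} {r} G nonsquare G>0 universal α α∈𝒪 α≻0 =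
  with-bound (proj₁ bound) (proj₂ (proj₂ bound))
  where
  bound = coordinate-bound (associated G) G>0
  0<δ : 0ℚ ℚ.< δ D
  0<δ = ι-mono-< {ℤ.+ 0} {ℤ.+ D} (ℤ.+<+ (ℕₚ.n≢0⇒n>0 λ D≡0 → nonsquare 0 (sym D≡0)))
  Conclusion : Set
  Conclusion = Σ[ γ ∈ (Fin r → K D) ] (∀ i → γ i ∈𝒪) × (∀ p → Proper G p → γ p ≡ 0#) × evalG G γ ≡ α
  module _ (C : ℚ) (C-bound : ∀ x i → size (x i) ℚ.≤ C ℚ.* rat (eval (associated G) x)) where
    with-representation : ∀ w → Lattice w → norm w ≡ 1ℚ → 2ℚ ℚ.* (C ℚ.* rat α) ℚ.< size (τ w) →
      Represents G (w * (w * α)) → Conclusion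
    with-representation w w∈Λ Nw≡1 w-large (β , β∈𝒪 , Gβ≡w²α) =
      rescaled , rescaled-integral , rescaled-proper , rescaled-represents
      where open Rescaling 0<δ G C C-bound α w w∈Λ Nw≡1 w-large β β∈𝒪 Gβ≡w²α
    with-unit : LargeUnit (2ℚ ℚ.* (C ℚ.* rat α)) → Conclusion
    with-unit (w , w∈Λ , Nw≡1 , 0<x , w-large) = with-representation w w∈Λ Nw≡1 w-large
      -- w²α is again integral and totally positive, so universality applies to it.
      (universal (w * (w * α)) (lattice-*-𝒪 {x = w} w∈Λ (lattice-*-𝒪 {x = w} w∈Λ α∈𝒪))
        (TotallyPositive⇒≻0 (w * (w * α)) (TotallyPositive-*-square w α Nw≡1 0<x (≻0⇒TotallyPositive α α≻0))))
    with-bound : Conclusion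
    with-bound = with-unit (large-unit nonsquare (2ℚ ℚ.* (C ℚ.* rat α)))

-- The subform in the non-proper variables.

module Subform {D r : ℕ} (G : GeneralizedForm D r) (S : Selection (¬_ ∘ Proper G)) where

  k = proj₁ S
  k≤r = proj₁ (proj₂ S)
  σ = proj₁ (proj₂ (proj₂ S))

  ρ : Fin k → Fin r
  ρ i = σ ⟨$⟩ʳ inject≤ i k≤r

  ρ-nonproper : ∀ i → ¬ Proper G (ρ i)
  ρ-nonproper = proj₁ (proj₂ (proj₂ (proj₂ S)))

  ρ-complete : ∀ a → ¬ Proper G a → ∃[ i ] ρ i ≡ a
  ρ-complete = proj₂ (proj₂ (proj₂ (proj₂ S)))

  ρ-injective : ∀ {i j} → ρ i ≡ ρ j → i ≡ j
  ρ-injective {i} {j} eq = Finₚ.inject≤-injective k≤r k≤r i j (⟨$⟩ʳ-injective σ eq)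

  -- Written exactly like the injection in the definition of subform, so that the coefficients agree
  -- by `refl`.
  ν : Fin (k ℕ.* 2) → Fin (r ℕ.* 2)
  ν v = uncurry (λ i s → combine (ρ i) s) (remQuot 2 v)

  ν-combine : ∀ i s → ν (combine i s) ≡ combine (ρ i) s
  ν-combine i s = cong (uncurry λ i s → combine (ρ i) s) (Finₚ.remQuot-combine i s)

  ν-injective : ∀ {v v′} → ν v ≡ ν v′ → v ≡ v′
  ν-injective {v} {v′} eq = trans (sym (Finₚ.combine-remQuot {k} 2 v)) (trans
    (cong₂ combine (ρ-injective (proj₁ components)) (proj₂ components)) (Finₚ.combine-remQuot {k} 2 v′))
    where
    components = Finₚ.combine-injective (ρ (proj₁ (remQuot {k} 2 v))) (proj₂ (remQuot {k} 2 v))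
      (ρ (proj₁ (remQuot {k} 2 v′))) (proj₂ (remQuot {k} 2 v′)) eq

  H : GeneralizedForm D k
  H = generalized (restrict ν (G₀ G))

  subform : H IsSubformOf G
  subform = k≤r , σ , λ u v → refl

  quadratic : Quadratic H
  quadratic i (z-appears , τ-appears) = ρ-nonproper i (appears zero z-appears , appears (suc zero) τ-appears)
    where
    appears : ∀ s → AppearsIn (G₀ H) (combine i s) → AppearsIn (G₀ G) (combine (ρ i) s)
    appears s (v , c≢0) = ν v , subst (λ a → coeff (G₀ G) a (ν v) ≢ 0#) (ν-combine i s) c≢0

  -- Extension by zero makes each value of the form associated to H a value of the one associated to
  -- G. The lists of variables of the two forms are computed separately, so x̂ = 0 is treated as a
  -- possible case; the value is then 0, which semidefiniteness permits.
  positive-semidefinite : TotallyPositiveDefinite G → TotallyPositiveSemidefinite H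
  positive-semidefinite G>0 x _ = subst _≽0 (sym value) (nonNegative (Finₚ.all? λ i → x̂ i ≟ 0#))
    where
    y = pushforward (vars H) x
    x̂ = pushforward ν y ∘ vars G
    value : eval (associated H) x ≡ eval (associated G) x̂
    value = begin
      eval (associated H) x              ≡⟨ eval-pushforward (G₀ H) (vars H) (vars-injective H) x ⟨
      eval (G₀ H) y                      ≡⟨ eval-pushforward (G₀ G) ν ν-injective y ⟨
      eval (G₀ G) (pushforward ν y)      ≡⟨ eval-associated G (pushforward ν y) ⟩
      eval (associated G) x̂              ∎
      where open ≡-Reasoning
    nonNegative : Dec (∀ i → x̂ i ≡ 0#) → eval (associated G) x̂ ≽0
    nonNegative (yes x̂≡0) = inj₂ Q≡0 , inj₂ (cong τ Q≡0)
      where Q≡0 = eval-zero (associated G) x̂≡0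
    nonNegative (no x̂≢0) = let 0<Q , 0<τQ = G>0 x̂ x̂≢0 in inj₁ 0<Q , inj₁ 0<τQ

  arguments-ν : ∀ (z : Fin r → K D) v → arguments z (ν v) ≡ arguments (z ∘ ρ) v
  arguments-ν z v with varView {k} v
  ... | z-var i = trans (cong (arguments z) (ν-combine i zero))
    (trans (arguments-z z (ρ i)) (sym (arguments-z (z ∘ ρ) i)))
  ... | τ-var i = trans (cong (arguments z) (ν-combine i (suc zero)))
    (trans (arguments-τ z (ρ i)) (sym (arguments-τ (z ∘ ρ) i)))

  -- Outside the image of ν lie only the arguments of proper variables, where γ is zero.
  evalG-subform : ∀ (γ : Fin r → K D) → (∀ p → Proper G p → γ p ≡ 0#) → evalG H (γ ∘ ρ) ≡ evalG G γ
  evalG-subform γ γ≡0 = sym (trans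
    (eval-restrict (G₀ G) ν ν-injective (arguments γ) λ a a∉ν b →
      trans (cong (λ p → coeff (G₀ G) a b * p * arguments γ b) (outside a a∉ν))
        (trans (cong (_* arguments γ b) (zeroʳ (coeff (G₀ G) a b))) (zeroˡ (arguments γ b))))
    (eval-cong-≗ (G₀ H) (arguments γ ∘ ν) (arguments (γ ∘ ρ)) (arguments-ν γ)))
    where
    outside-proper : ∀ i s → (∀ v → ν v ≢ combine i s) → γ i ≡ 0#
    outside-proper i s ∉ν with proper? G i
    ... | yes i-proper = γ≡0 i i-proper
    ... | no ¬i-proper = let j , ρj≡i = ρ-complete i ¬i-proper in
      ⊥-elim (∉ν (combine j s) (trans (ν-combine j s) (cong (λ a → combine a s) ρj≡i)))
    outside : ∀ a → (∀ v → ν v ≢ a) → arguments γ a ≡ 0#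
    outside a a∉ν with varView {r} a
    ... | z-var i = trans (arguments-z γ i) (outside-proper i zero a∉ν)
    ... | τ-var i = trans (arguments-τ γ i) (cong τ (outside-proper i (suc zero) a∉ν))

theorem7 : ∀ (D : ℕ) → (∀ m → m ℕ.* m ≢ D) →
    ∀ (r : ℕ) (G : GeneralizedForm D r) →
    TotallyPositiveDefinite G → Integral G → Universal G →
    ∃[ k ] Σ[ H ∈ GeneralizedForm D k ] (H IsSubformOf G × Quadratic H × Universal H)
theorem7 D nonsquare r G G>0 G-integral (_ , _ , G-universal) =
  k , H , subform , quadratic
  , (λ i j → G-integral (ν i) (ν j))
  , positive-semidefinite G>0
  -- H is already fixed: the variables that vanish are the proper ones, whatever α is.
  , λ α α∈𝒪 α≻0 →
      let γ , γ∈𝒪 , γ-proper , Gγ≡α = represented-without-proper G nonsquare G>0 G-universal α α∈𝒪 α≻0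
      in γ ∘ ρ , γ∈𝒪 ∘ ρ , trans (evalG-subform γ γ-proper) Gγ≡α
  where open Subform G (select (¬_ ∘ Proper G) (¬? ∘ proper? G))
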